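{- Let $\mathcal{T}$ be a tree on $k$ vertices, and let $G$ be a chain of connected graphs $G_1,\dots,G_k$ with respect to $\mathcal{T}$, where $G$ has at least one edge. Then $$\kappa(G)=\sum_{i=1}^{k}\frac{m_{G_i}}{m_G}\kappa(G_i)+\sum_{x\sim y\in\mathcal{B}_G}\left(\frac{\overline{W}_x}{m_G}\mathbf{d}_{G_x}^TR_{G_x}\mathbf{e}_x+\frac{\overline{W}_y}{m_G}\mathbf{d}_{G_y}^TR_{G_y}\mathbf{e}_y\right)+\sum_{i=1}^{k}\sum_{(z_1,z_2)\in\widetilde{V}_i\times\widetilde{V}_i}\frac{\overline{W}_{z_1}\overline{W}_{z_2}}{m_G}r^{G_i}_{z_1,z_2}+\sum_{x\sim y\in\mathcal{B}_G}\frac{(2\overline{W}_x-1)(2\overline{W}_y-1)}{2m_G}.$$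
   Context: All graphs are finite, simple and undirected. For a graph $H$: $m_H$ is the number of edges; $\mathbf{d}_H$ is the column vector of vertex degrees; $\mathbf{e}_v$ is the standard basis vector indexed by the vertex $v$. For connected $H$, $R_H=[r^H_{u,v}]$ is the effective resistance matrix, $r^H_{u,v}=(\mathbf{e}_u-\mathbf{e}_v)^TL^\dagger(\mathbf{e}_u-\mathbf{e}_v)$ with $L^\dagger$ the Moore–Penrose inverse of the Laplacian matrix of $H$. Kemeny's constant $\kappa(H)$ of a connected graph $H$ is that of the simple random walk on $H$ (from a vertex, move to a uniformly random neighbour): $\kappa(H)=\sum_{j\neq i}\pi_j m_{i,j}$, where $\pi_j=\deg_H(j)/(2m_H)$ is the stationary distribution and $m_{i,j}$ is the mean first passage time from $i$ to $j$; it does not depend on the choice of $i$. For a graph with at least one edge, $\kappa(H)=\mathbf{d}_H^TR_H\mathbf{d}_H/(4m_H)$. For a single-vertex graph, $\kappa(H)=0$ (empty sum). Chain: let $\mathcal{T}$ be a tree with vertex set $\{1,\dots,k\}$ and $G_1,\dots,G_k$ connected graphs (on disjoint vertex sets). A chain of $G_1,\dots,G_k$ with respect to $\mathcal{T}$ is a graph $G$ obtained from the disjoint union of $G_1,\dots,G_k$ by choosing, for each edge $i\sim j$ of $\mathcal{T}$, some vertex $v_i\in V(G_i)$ and some vertex $v_j\in V(G_j)$ and adding the edge $v_i\sim v_j$ (the choices for different edges of $\mathcal{T}$ are independent; the same vertex may be chosen several times). $\mathcal{B}_G$ is the set of the $k-1$ added edges; each is a bridge of $G$. For a vertex $z$ of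 $G$, $G_z$ denotes the graph $G_j$ with $z\in V(G_j)$. $\widetilde{V}_i$ is the collection of ends in $V(G_i)$ of bridges in $\mathcal{B}_G$, one element for each bridge in $\mathcal{B}_G$ having an end in $G_i$; so $|\widetilde{V}_i|=\deg_{\mathcal{T}}(i)$, and a vertex incident to several bridges of $\mathcal{B}_G$ occurs once for each of them. For an end $x$ of a bridge $x\sim y\in\mathcal{B}_G$, $W_x$ is the number of edges of the component containing $x$ of $G$ with the edge $x\sim y$ removed, and $\overline{W}_x=m_G-W_x$ (so these numbers depend on the end together with its bridge); in particular $\overline{W}_x=W_y+1$. -}

module Defs where

import Algebra.Properties.CommutativeMonoid.Sum as Sum
open import Data.Bool using (Bool; false; T; if_then_else_; _∧_; _∨_; not)
open import Data.Bool.Properties using (T?; ∨-comm)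
open import Data.Fin using (Fin; zero; suc; toℕ; fromℕ; inject₁; _<?_)
open import Data.Fin.Properties using (_≟_; any?)
open import Data.Fin.Subset using (Subset; _∈_; _∪_; _⊃_; ⁅_⁆)
open import Data.Fin.Subset.Induction using (⊃-wellFounded; Acc; acc)
open import Data.Fin.Subset.Properties
  using (_∈?_; x∈⁅x⁆; x∈⁅y⁆⇒x≡y; x∈p∪q⁻; p⊆p∪q; q⊆p∪q)
open import Data.Integer as ℤ using (ℤ; +_)
open import Data.Nat as ℕ using (ℕ; zero; suc)
import Data.Nat.Properties as ℕₚ
open import Data.Product using (Σ-syntax; ∃-syntax; _×_; _,_; proj₁; proj₂)
open import Data.Rational as ℚ using (ℚ; 0ℚ; 1ℚ; _/_)
import Data.Rational.Properties as ℚₚ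
open import Data.Sum using (inj₁; inj₂)
open import Function using (_⇔_; _↔_; mk⇔; Inverse; Injective)
open import Relation.Binary.Construct.Closure.ReflexiveTransitive using (Star; ε; _◅_; _◅◅_)
open import Relation.Binary.PropositionalEquality
  using (_≡_; _≢_; refl; sym; cong; cong₂; subst)
open import Relation.Nullary using (¬_; Dec; yes; no; does; contradiction)
open import Relation.Nullary.Decidable using (_×-dec_; ¬?; map)

open Sum ℕₚ.+-0-commutativeMonoid public using () renaming (sum to sumℕ)
open Sum ℚₚ.+-0-commutativeMonoid public using (sum)

private
  variable
    k n : ℕ

when : ∀ {p} {P : Set p} → Dec P → (P → ℚ) → ℚ
when (yes p) f = f p
when (no _)  f = 0ℚ

indicator : ∀ {p} {P : Set p} → Dec P → ℕ
indicator P? = if does P? then 1 else 0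

-- Adjacency is Boolean, so that "u is adjacent to v" has at most one proof
-- and a function on proofs of adjacency is a function on (oriented) edges.
record Graph (n : ℕ) : Set where
  field
    adj     : Fin n → Fin n → Bool
    adj-sym : ∀ u v → adj u v ≡ adj v u
    adj-irr : ∀ v → adj v v ≡ false

  Adj : Fin n → Fin n → Set
  Adj u v = T (adj u v)

  adj? : ∀ u v → Dec (Adj u v)
  adj? u v = T? (adj u v)

  flip : ∀ {u v} → Adj u v → Adj v u
  flip {u} {v} = subst T (adj-sym u v)

  Reachable : Fin n → Fin n → Set
  Reachable = Star Adj

  deg : Fin n → ℕ
  deg v = sumℕ λ u → indicator (adj? v u)

  ∣E∣ : ℕ
  ∣E∣ = sumℕ λ u → sumℕ λ v → indicator (u <? v ×-dec adj? u v)

open Graph public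

record Connected (H : Graph n) : Set where
  field
    nonempty  : Fin n
    reachable : ∀ u v → Reachable H u v

-- The vertices c 0, …, c (l + 2) of a cycle are distinct and consecutive
-- ones are adjacent, cyclically.
IsCycle : Graph n → (l : ℕ) → (Fin (3 ℕ.+ l) → Fin n) → Set
IsCycle H l c =
  Injective _≡_ _≡_ c
  × (∀ (a : Fin (2 ℕ.+ l)) → Adj H (c (inject₁ a)) (c (suc a)))
  × Adj H (c (fromℕ (2 ℕ.+ l))) (c zero)

record IsTree (H : Graph n) : Set where
  field
    connected : Connected H
    acyclic   : ∀ l c → ¬ IsCycle H l c

-- Each undirected edge is visited once, as the pair (i , j) with i < j.
sumEdges : (H : Graph n) → (∀ i j → Adj H i j → ℚ) → ℚ
sumEdges H f =
  sum λ i → sum λ j → when (i <? j ×-dec adj? H i j) λ (_ , e) → f i j e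

sumNeighbours : (H : Graph n) (i : Fin n) → (∀ j → Adj H i j → ℚ) → ℚ
sumNeighbours H i f = sum λ j → when (adj? H i j) (f j)

-- Reachability is decidable: enlarge {u} by one adjacent vertex at a time
-- until it is closed under adjacency.
module _ (H : Graph n) (u : Fin n) where

  private
    Sound : Subset n → Set
    Sound S = u ∈ S × (∀ {v} → v ∈ S → Reachable H u v)

    Exit : Subset n → Set
    Exit S = ∃[ x ] ∃[ y ] (x ∈ S × ¬ (y ∈ S) × Adj H x y)

    exit? : ∀ S → Dec (Exit S)
    exit? S = any? λ x → any? λ y → (x ∈? S) ×-dec (¬? (y ∈? S) ×-dec adj? H x y)

    stays : ∀ {S x y} → ¬ Exit S → x ∈ S → Star (Adj H) x y → y ∈ S
    stays ¬e x∈S ε = x∈S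
    stays {S} ¬e x∈S (_◅_ {j = z} a w) with z ∈? S
    ... | yes z∈S = stays ¬e z∈S w
    ... | no  z∉S = contradiction (_ , z , x∈S , z∉S , a) ¬e

    saturate : ∀ S → Acc _⊃_ S → Sound S →
               Σ[ S′ ∈ Subset n ] (∀ v → v ∈ S′ ⇔ Reachable H u v)
    saturate S (acc rec) (u∈S , sound) with exit? S
    ... | no ¬e = S , λ v → mk⇔ sound (stays ¬e u∈S)
    ... | yes (x , y , x∈S , y∉S , a) =
      saturate (S ∪ ⁅ y ⁆)
        (rec (p⊆p∪q ⁅ y ⁆ , y , q⊆p∪q S ⁅ y ⁆ (x∈⁅x⁆ y) , y∉S))
        (p⊆p∪q ⁅ y ⁆ u∈S , sound′)
      where
      sound′ : ∀ {v} → v ∈ S ∪ ⁅ y ⁆ → Reachable H u v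
      sound′ v∈ with x∈p∪q⁻ S ⁅ y ⁆ v∈
      ... | inj₁ v∈S = sound v∈S
      ... | inj₂ v∈y with refl ← x∈⁅y⁆⇒x≡y y v∈y = sound x∈S ◅◅ (a ◅ ε)

    component : Σ[ S ∈ Subset n ] (∀ v → v ∈ S ⇔ Reachable H u v)
    component = saturate ⁅ u ⁆ (⊃-wellFounded ⁅ u ⁆)
      (x∈⁅x⁆ u , λ v∈u → subst (Reachable H u) (sym (x∈⁅y⁆⇒x≡y u v∈u)) ε)

  reachable? : ∀ v → Dec (Reachable H u v)
  reachable? v = map (proj₂ component v) (v ∈? proj₁ component)

componentEdges : Graph n → Fin n → ℕ
componentEdges H x = sumℕ λ u → sumℕ λ v →
  indicator (u <? v ×-dec adj? H u v ×-dec reachable? H x u ×-dec reachable? H x v)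

removeEdge : Graph n → Fin n → Fin n → Graph n
removeEdge {n} H x y = record
  { adj     = λ u v → adj H u v ∧ not (joins u v)
  ; adj-sym = λ u v → cong₂ (λ a b → a ∧ not b) (adj-sym H u v) (joins-sym u v)
  ; adj-irr = λ v → cong (_∧ not (joins v v)) (adj-irr H v)
  }
  where
  joins : Fin n → Fin n → Bool
  joins u v = (does (u ≟ x) ∧ does (v ≟ y)) ∨ (does (v ≟ x) ∧ does (u ≟ y))

  joins-sym : ∀ u v → joins u v ≡ joins v u
  joins-sym u v = ∨-comm (does (u ≟ x) ∧ does (v ≟ y)) _

Vector : ℕ → Set
Vector n = Fin n → ℚ

Matrix : ℕ → Set
Matrix n = Fin n → Fin n → ℚ

infixl 7 _·_ _*ᵥ_ _*ₘ_

_·_ : Vector n → Vector n → ℚ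
a · b = sum λ i → a i ℚ.* b i

_*ᵥ_ : Matrix n → Vector n → Vector n
(A *ᵥ b) i = A i · b

_*ₘ_ : Matrix n → Matrix n → Matrix n
(A *ₘ B) i j = sum λ l → A i l ℚ.* B l j

infix 8 _ᵀ
_ᵀ : Matrix n → Matrix n
(A ᵀ) i j = A j i

infix 4 _≈ₘ_
_≈ₘ_ : Matrix n → Matrix n → Set
A ≈ₘ B = ∀ i j → A i j ≡ B i j

-- The four Penrose conditions, which determine X uniquely.
record IsMoorePenroseInverse (A X : Matrix n) : Set where
  field
    AXA≈A  : A *ₘ X *ₘ A ≈ₘ A
    XAX≈X  : X *ₘ A *ₘ X ≈ₘ X
    AX-sym : (A *ₘ X) ᵀ ≈ₘ A *ₘ X
    XA-sym : (X *ₘ A) ᵀ ≈ₘ X *ₘ A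

ℕ→ℚ : ℕ → ℚ
ℕ→ℚ a = + a / 1

𝐞 : Fin n → Vector n
𝐞 v i = ℕ→ℚ (indicator (i ≟ v))

𝐝 : Graph n → Vector n
𝐝 H v = ℕ→ℚ (deg H v)

laplacian : Graph n → Matrix n
laplacian H u v = 𝐝 H u ℚ.* 𝐞 u v ℚ.- ℕ→ℚ (indicator (adj? H u v))

resistance : (L† : Matrix n) → Matrix n
resistance L† u v = δ · (L† *ᵥ δ)
  where δ = λ i → 𝐞 u i ℚ.- 𝐞 v i

-- The value at denominator 0 is a dummy: below, a zero denominator occurs
-- for a connected graph only when it is a single vertex, and there no
-- quotient is ever used (there are no two distinct vertices).
ratio : ℕ → ℕ → ℚ
ratio a zero      = 0ℚ
ratio a d@(suc _) = + a / d

transition : Graph n → Matrix n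
transition H u v = ratio (indicator (adj? H u v)) (deg H u)

stationary : Graph n → Vector n
stationary H v = ratio (deg H v) (2 ℕ.* ∣E∣ H)

-- firstPassage H t i j is the probability that the walk started at i visits j
-- for the first time (at a time ≥ 1) at time t + 1; the recursion conditions
-- on the first step.
firstPassage : Graph n → ℕ → Matrix n
firstPassage H zero    i j = transition H i j
firstPassage H (suc t) i j =
  sum λ l → when (¬? (l ≟ j)) λ _ → transition H i l ℚ.* firstPassage H t l j

SeriesSum : (ℕ → ℚ) → ℚ → Set
SeriesSum a s = ∀ δ → 0ℚ ℚ.< δ → ∃[ M ] ∀ N → M ℕ.≤ N →
  ℚ.∣ sum {N} (λ t → a (toℕ t)) ℚ.- s ∣ ℚ.< δ

-- The expectation of the first passage time being μ means that this time is
-- almost surely finite and Σ_{t ≥ 1} t · Pr(time = t) = μ.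
record IsMeanFirstPassageTime (H : Graph n) (i j : Fin n) (μ : ℚ) : Set where
  field
    finite : SeriesSum (λ t → firstPassage H t i j) 1ℚ
    mean   : SeriesSum (λ t → ℕ→ℚ (suc t) ℚ.* firstPassage H t i j) μ

-- κ = Σ_{j ≠ i} πⱼ mᵢⱼ for some start vertex i; for a connected graph the
-- value does not depend on i.
record IsKemenyConstant (H : Graph n) (κ : ℚ) : Set where
  field
    m      : Matrix n
    m-mfpt : ∀ i j → i ≢ j → IsMeanFirstPassageTime H i j (m i j)
    start  : Fin n
    value  : κ ≡ sum λ j → when (¬? (j ≟ start)) λ _ → stationary H j ℚ.* m start j

-- The vertices of G are the disjoint union of those of the Gs i, up to a
-- relabelling.
record Chain (𝒯 : Graph k) {n : Fin k → ℕ} (Gs : ∀ i → Graph (n i))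
             {N : ℕ} (G : Graph N) : Set where
  field
    vertices : (Σ[ i ∈ Fin k ] Fin (n i)) ↔ Fin N

    -- end i j e is the vertex of Gs i chosen for the edge i ∼ j of 𝒯; the
    -- vertex of Gs j chosen for that edge is end j i (flip 𝒯 e).
    end : ∀ i j → Adj 𝒯 i j → Fin (n i)

  ι : ∀ i → Fin (n i) → Fin N
  ι i u = Inverse.to vertices (i , u)

  field
    within : ∀ i u v → Adj G (ι i u) (ι i v) ⇔ Adj (Gs i) u v
    across : ∀ i j → i ≢ j → ∀ u v → Adj G (ι i u) (ι j v) ⇔
      (Σ[ e ∈ Adj 𝒯 i j ] (u ≡ end i j e × v ≡ end j i (flip 𝒯 e)))

  -- The added bridges correspond to the edges of 𝒯, and their ends to the
  -- oriented edges: (i , j , e) stands for the end x in Gs i of the bridge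
  -- x ∼ y coming from e. So the ends in Gs i, counted once for each bridge,
  -- are indexed by the neighbours j of i in 𝒯.
  W : ∀ i j → Adj 𝒯 i j → ℕ
  W i j e = componentEdges (removeEdge G x y) x
    where
    x = ι i (end i j e)
    y = ι j (end j i (flip 𝒯 e))

  W̄ : ∀ i j → Adj 𝒯 i j → ℤ
  W̄ i j e = + ∣E∣ G ℤ.- + W i j e

{-# OPTIONS --safe #-}

{-
A matrix R with zero diagonal is the effective resistance matrix of a connected
graph H as soon as the Laplacian of its column R(·,v) is τ − 2 𝐞 v with τ not
depending on v, and for such R the equations for the mean first passage times
give 2 · 2m · κ(H) = 𝐝ᵀ R 𝐝.

For a vertex v of a chain let π i v be the vertex of G_i at which a walk from v
enters G_i.  The matrix Σ_i R_i(π i v, π i v′) + #{bridges separating v from v′}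
satisfies the criterion above, because moving v along an edge of G_i changes only
the i-th summand, and moving v along a bridge changes only the number of separating
bridges.  In 𝐝ᵀ R 𝐝 the push-forward of 𝐝 along π i is 𝐝 plus 2 W̄_z at each
bridge end z of G_i, since the degrees beyond the bridge sum to 2 W̄_z − 1; expanding
the quadratic form gives the formula.
-}

module Submission where

open import Defs
import Algebra.Properties.CommutativeMonoid.Sum as Sum
import Algebra.Properties.Semiring.Sum as SemiringSum
open import Algebra.Bundles using (module CommutativeRing)
open import Data.Bool using (T; true)
open import Data.Bool.Properties using (T-irrelevant)
open import Data.Fin as Fin using (Fin; zero; suc; toℕ; fromℕ; inject₁; _<?_)
open import Data.Fin.Properties using (_≟_; <-cmp; any?; suc-injective)
open import Data.Integer as ℤ using (ℤ; -[1+_])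
import Data.Integer.Properties as ℤₚ
open import Data.Nat as ℕ using (ℕ; zero; suc; NonZero)
import Data.Nat.Properties as ℕₚ
open import Data.Nat.Properties using (m*n≢0)
open import Data.Product using (Σ-syntax; ∃-syntax; _×_; _,_; proj₁; proj₂)
open import Data.Rational as ℚ
  using (ℚ; 0ℚ; 1ℚ; ½; _/_; _+_; _*_; _-_; ∣_∣; _≤_; _<_; fromℚᵘ)
import Data.Rational.Properties as ℚₚ
open import Data.Rational.Unnormalised as ℚᵘ using (mkℚᵘ; *≡*)
import Data.Rational.Unnormalised.Properties as ℚᵘₚ
open import Data.Sum using (_⊎_; inj₁; inj₂)
open import Function using (_∘_; id; Inverse; Equivalence; Injective)
open import Level using (0ℓ)
open import Relation.Binary using (tri<; tri≈; tri>)
open import Relation.Binary.Construct.Closure.ReflexiveTransitive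
  using (ε; _◅_; _◅◅_; gmap; reverse)
open import Relation.Binary.PropositionalEquality
open import Relation.Nullary using (¬_; Dec; yes; no; contradiction)
open import Relation.Nullary.Decidable using (¬?; _×-dec_; dec⇒maybe)
open import Tactic.RingSolver using (solve-∀)
open import Tactic.RingSolver.Core.AlmostCommutativeRing
  using (AlmostCommutativeRing; fromCommutativeRing)

-- One fact carries every uniqueness argument: on a connected graph a function with vanishing
-- Laplacian is constant. It gives the entries of L L† and L† L for a piece, it shows that hitting
-- times and resistances differ only by a potential, and it makes the degree-weighted sum of hitting
-- times independent of the start. The link with κ is the identity 2 h(u,v) = 2m R(u,v) + α(u) -
-- α(v), where h is the matrix of mean hitting times. The potential α drops out once u and v are
-- both averaged with the degrees. Hitting times are given as limits of rational series. They enter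
-- only through an exact first-step recursion for the partial sums and the uniqueness of limits, so
-- no limit has to be constructed. Quotients are cleared throughout: transition probabilities are
-- multiplied by the degree, the stationary distribution by 2m, the final formula by 4m.
-- Single-vertex pieces then fit in, as both sides of their equations are 0. The 2 W̄_z - 1 arises
-- because W̄_z counts the bridge itself: beyond it lie W̄_z - 1 edges, each counted twice by the
-- degrees there, and the bridge counts once.

private variable
  k n : ℕ

private
  module S  = Sum ℚₚ.+-0-commutativeMonoid
  module S* = SemiringSum (CommutativeRing.semiring ℚₚ.+-*-commutativeRing)

-- -- Finite sums of rationals

ℚ-ring : AlmostCommutativeRing 0ℓ 0ℓ
ℚ-ring = fromCommutativeRing ℚₚ.+-*-commutativeRing λ x → dec⇒maybe (0ℚ ℚₚ.≟ x)

2ℚ : ℚ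
2ℚ = 1ℚ + 1ℚ

p+q≡0⇒p≡0 : ∀ {p q} → 0ℚ ≤ p → 0ℚ ≤ q → p + q ≡ 0ℚ → p ≡ 0ℚ
p+q≡0⇒p≡0 {p} {q} 0≤p 0≤q p+q≡0 = ℚₚ.≤-antisym
  (ℚₚ.≤-trans (ℚₚ.≤-reflexive (sym (ℚₚ.+-identityʳ p)))
  (ℚₚ.≤-trans (ℚₚ.+-monoʳ-≤ p 0≤q) (ℚₚ.≤-reflexive p+q≡0)))
  0≤p

-1*p≡-p : ∀ p → (ℚ.- 1ℚ) * p ≡ ℚ.- p
-1*p≡-p = solve-∀ ℚ-ring

-- A copy of sum that does not unfold: unification can then read the summand
-- off an equation between sums.
opaque
  ∑ : Vector n → ℚ
  ∑ = sum

  sum≡∑ : (f : Vector n) → sum f ≡ ∑ f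
  sum≡∑ f = refl

  ∑-suc : (f : Vector (suc n)) → ∑ f ≡ f zero + ∑ (f ∘ suc)
  ∑-suc f = refl

  ∑-cong : {f g : Vector n} → (∀ i → f i ≡ g i) → ∑ f ≡ ∑ g
  ∑-cong = S.sum-cong-≗

  ∑-+ : (f g : Vector n) → ∑ (λ i → f i + g i) ≡ ∑ f + ∑ g
  ∑-+ = S.∑-distrib-+

  ∑-swap : (f : Fin k → Fin n → ℚ) → ∑ (λ i → ∑ (f i)) ≡ ∑ (λ j → ∑ λ i → f i j)
  ∑-swap = S.∑-comm

  *-∑ : (c : ℚ) (f : Vector n) → c * ∑ f ≡ ∑ (λ i → c * f i)
  *-∑ = S*.*-distribˡ-sum

  ∑-* : (c : ℚ) (f : Vector n) → ∑ f * c ≡ ∑ (λ i → f i * c)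
  ∑-* = S*.*-distribʳ-sum

  ∑-0 : (f : Vector n) → (∀ i → f i ≡ 0ℚ) → ∑ f ≡ 0ℚ
  ∑-0 {zero}  f f≡0 = refl
  ∑-0 {suc n} f f≡0 = cong₂ _+_ (f≡0 zero) (∑-0 (f ∘ suc) (f≡0 ∘ suc))

  ∑-only : (f : Vector n) (i : Fin n) → (∀ j → j ≢ i → f j ≡ 0ℚ) → ∑ f ≡ f i
  ∑-only f zero    f≡0 =
    trans (cong (f zero +_) (∑-0 (f ∘ suc) λ j → f≡0 (suc j) λ ())) (ℚₚ.+-identityʳ _)
  ∑-only f (suc i) f≡0 =
    trans (cong₂ _+_ (f≡0 zero λ ()) (∑-only (f ∘ suc) i λ j j≢i → f≡0 (suc j) λ { refl → j≢i refl }))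
          (ℚₚ.+-identityˡ _)

  ∑-nonNeg : (f : Vector n) → (∀ i → 0ℚ ≤ f i) → 0ℚ ≤ ∑ f
  ∑-nonNeg {zero}  f 0≤f = ℚₚ.≤-refl
  ∑-nonNeg {suc n} f 0≤f = ℚₚ.+-mono-≤ (0≤f zero) (∑-nonNeg (f ∘ suc) (0≤f ∘ suc))

  ∑≡0⇒≡0 : (f : Vector n) → (∀ i → 0ℚ ≤ f i) → ∑ f ≡ 0ℚ → ∀ i → f i ≡ 0ℚ
  ∑≡0⇒≡0 f 0≤f eq zero    = p+q≡0⇒p≡0 (0≤f zero) (∑-nonNeg (f ∘ suc) (0≤f ∘ suc)) eq
  ∑≡0⇒≡0 f 0≤f eq (suc i) = ∑≡0⇒≡0 (f ∘ suc) (0≤f ∘ suc)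
    (p+q≡0⇒p≡0 (∑-nonNeg (f ∘ suc) (0≤f ∘ suc)) (0≤f zero) (trans (ℚₚ.+-comm _ (f zero)) eq)) i

-- Limits of rational sequences

-- `SeriesSum a s` is by definition the case where the sequence consists of the partial sums of `a`.
Limit : (ℕ → ℚ) → ℚ → Set
Limit s l = ∀ δ → 0ℚ < δ → ∃[ M ] ∀ N → M ℕ.≤ N → ∣ s N - l ∣ < δ

module _ where
  open ℚₚ.≤-Reasoning

  private
    half-pos : ∀ {δ} → 0ℚ < δ → 0ℚ < ½ * δ
    half-pos {δ} 0<δ = ℚₚ.positive⁻¹ (½ * δ) {{ℚₚ.pos*pos⇒pos ½ δ {{ℚ.positive 0<δ}}}}

    halves : ∀ δ → ½ * δ + ½ * δ ≡ δ
    halves δ = trans (sym (ℚₚ.*-distribʳ-+ δ ½ ½)) (ℚₚ.*-identityˡ δ)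

    triangle : ∀ a b c d {δ} → ∣ a - c ∣ < ½ * δ → ∣ b - d ∣ < ½ * δ → ∣ (a + b) - (c + d) ∣ < δ
    triangle a b c d {δ} p q = begin-strict
      ∣ (a + b) - (c + d) ∣      ≡⟨ cong ∣_∣ (lemma a b c d) ⟩
      ∣ (a - c) + (b - d) ∣      ≤⟨ ℚₚ.∣p+q∣≤∣p∣+∣q∣ (a - c) (b - d) ⟩
      ∣ a - c ∣ + ∣ b - d ∣      <⟨ ℚₚ.+-mono-< p q ⟩
      ½ * δ + ½ * δ              ≡⟨ halves δ ⟩
      δ                          ∎
      where
      lemma : ∀ a b c d → (a + b) - (c + d) ≡ (a - c) + (b - d)
      lemma = solve-∀ ℚ-ring

    ∣p-q∣≡∣q-p∣ : ∀ p q → ∣ p - q ∣ ≡ ∣ q - p ∣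
    ∣p-q∣≡∣q-p∣ p q = trans (sym (ℚₚ.∣-p∣≡∣p∣ (p - q))) (cong ∣_∣ (lemma p q))
      where
      lemma : ∀ p q → ℚ.- (p - q) ≡ q - p
      lemma = solve-∀ ℚ-ring

  Limit-cong : ∀ {s t l} → (∀ N → s N ≡ t N) → Limit s l → Limit t l
  Limit-cong {l = l} s≗t S δ 0<δ with S δ 0<δ
  ... | M , close = M , λ N M≤N → subst (λ x → ∣ x - l ∣ < δ) (s≗t N) (close N M≤N)

  Limit-const : ∀ c → Limit (λ _ → c) c
  Limit-const c δ 0<δ = 0 , λ N _ → subst (_< δ) (cong ∣_∣ (sym (ℚₚ.+-inverseʳ c))) 0<δ

  Limit-suc : ∀ {s l} → Limit s l → Limit (s ∘ suc) l
  Limit-suc S δ 0<δ with S δ 0<δ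
  ... | M , close = M , λ N M≤N → close (suc N) (ℕₚ.m≤n⇒m≤1+n M≤N)

  Limit-+ : ∀ {s t l m} → Limit s l → Limit t m → Limit (λ N → s N + t N) (l + m)
  Limit-+ {s} {t} {l} {m} S T δ 0<δ with S (½ * δ) (half-pos 0<δ) | T (½ * δ) (half-pos 0<δ)
  ... | M₁ , close₁ | M₂ , close₂ = M₁ ℕ.⊔ M₂ , λ N M≤N →
    triangle (s N) (t N) l m
      (close₁ N (ℕₚ.≤-trans (ℕₚ.m≤m⊔n M₁ M₂) M≤N))
      (close₂ N (ℕₚ.≤-trans (ℕₚ.m≤n⊔m M₁ M₂) M≤N))

  Limit-* : ∀ c {s l} → Limit s l → Limit (λ N → c * s N) (c * l)
  Limit-* c {s} {l} S δ 0<δ = proj₁ close , λ N M≤N → begin-strict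
    ∣ c * s N - c * l ∣   ≡⟨ cong ∣_∣ (lemma c (s N) l) ⟩
    ∣ c * (s N - l) ∣     ≡⟨ ℚₚ.∣p*q∣≡∣p∣*∣q∣ c (s N - l) ⟩
    ∣ c ∣ * ∣ s N - l ∣   ≤⟨ ℚₚ.*-monoʳ-≤-nonNeg ∣ s N - l ∣ {{ℚₚ.∣-∣-nonNeg (s N - l)}} ∣c∣≤b ⟩
    b * ∣ s N - l ∣       <⟨ ℚₚ.*-monoʳ-<-pos b (proj₂ close N M≤N) ⟩
    b * (1/b * δ)         ≡⟨ ℚₚ.*-assoc b 1/b δ ⟨
    b * 1/b * δ           ≡⟨ cong (_* δ) (ℚₚ.*-inverseʳ b) ⟩
    1ℚ * δ                ≡⟨ ℚₚ.*-identityˡ δ ⟩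
    δ                     ∎
    where
    -- The summand 1 keeps the bound invertible when c is 0.
    b = 1ℚ + ∣ c ∣
    instance
      b-pos : ℚ.Positive b
      b-pos = ℚₚ.pos+nonNeg⇒pos 1ℚ ∣ c ∣ {{ℚₚ.∣-∣-nonNeg c}}
      b-nonZero : ℚ.NonZero b
      b-nonZero = ℚₚ.pos⇒nonZero b
    1/b = ℚ.1/ b
    close = S (1/b * δ)
      (ℚₚ.positive⁻¹ (1/b * δ) {{ℚₚ.pos*pos⇒pos 1/b {{ℚₚ.1/pos⇒pos b}} δ {{ℚ.positive 0<δ}}}})
    lemma : ∀ c p q → c * p - c * q ≡ c * (p - q)
    lemma = solve-∀ ℚ-ring
    ∣c∣≤b : ∣ c ∣ ≤ b
    ∣c∣≤b = begin
      ∣ c ∣      ≡⟨ ℚₚ.+-identityˡ _ ⟨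
      0ℚ + ∣ c ∣ ≤⟨ ℚₚ.+-monoˡ-≤ ∣ c ∣ (ℚₚ.nonNegative⁻¹ 1ℚ) ⟩
      b          ∎

  opaque
    unfolding ∑

    Limit-∑ : (s : Fin n → ℕ → ℚ) {l : Vector n} → (∀ i → Limit (s i) (l i)) →
              Limit (λ N → ∑ λ i → s i N) (∑ l)
    Limit-∑ {zero}  s S = Limit-const 0ℚ
    Limit-∑ {suc n} s S =
      Limit-+ {s zero} {λ N → ∑ λ i → s (suc i) N} (S zero) (Limit-∑ (s ∘ suc) (S ∘ suc))

  Limit-unique : ∀ {s l m} → Limit s l → Limit s m → l ≡ m
  Limit-unique {s} {l} {m} S T with l - m ℚₚ.≟ 0ℚ
  ... | yes l-m≡0 = trans (lemma l m) (trans (cong (_+ m) l-m≡0) (ℚₚ.+-identityˡ m))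
    where
    lemma : ∀ l m → l ≡ (l - m) + m
    lemma = solve-∀ ℚ-ring
  ... | no l-m≢0 with S (½ * δ) (half-pos 0<δ) | T (½ * δ) (half-pos 0<δ)
    where
    δ = ∣ l - m ∣
    0<δ : 0ℚ < δ
    0<δ = ℚₚ.≰⇒> λ δ≤0 → l-m≢0 (ℚₚ.∣p∣≡0⇒p≡0 _ (ℚₚ.≤-antisym δ≤0 (ℚₚ.0≤∣p∣ _)))
  ... | M₁ , close₁ | M₂ , close₂ = contradiction (begin-strict
    δ                       ≡⟨ cong ∣_∣ (lemma l m (s N)) ⟩
    ∣ (l + s N) - (s N + m) ∣ <⟨ triangle l (s N) (s N) m
      (subst (_< ½ * δ) (∣p-q∣≡∣q-p∣ (s N) l) (close₁ N (ℕₚ.m≤m⊔n M₁ M₂))) (close₂ N (ℕₚ.m≤n⊔m M₁ M₂)) ⟩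
    δ ∎) (ℚₚ.<-irrefl refl)
    where
    δ = ∣ l - m ∣
    N = M₁ ℕ.⊔ M₂
    lemma : ∀ l m x → l - m ≡ (l + x) - (x + m)
    lemma = solve-∀ ℚ-ring

open ≡-Reasoning

∑-- : (f g : Vector n) → ∑ (λ i → f i - g i) ≡ ∑ f - ∑ g
∑-- f g = begin
  ∑ (λ i → f i - g i)              ≡⟨ ∑-+ f (λ i → ℚ.- g i) ⟩
  ∑ f + ∑ (λ i → ℚ.- g i)            ≡⟨ cong (∑ f +_) (∑-cong λ i → -1*p≡-p (g i)) ⟨
  ∑ f + ∑ (λ i → (ℚ.- 1ℚ) * g i)     ≡⟨ cong (∑ f +_) (*-∑ (ℚ.- 1ℚ) g) ⟨
  ∑ f + (ℚ.- 1ℚ) * ∑ g               ≡⟨ cong (∑ f +_) (-1*p≡-p _) ⟩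
  ∑ f - ∑ g                        ∎

⟦_⟧ : ∀ {p} {P : Set p} → Dec P → ℚ
⟦ P? ⟧ = ℕ→ℚ (indicator P?)

⟦⟧-yes : ∀ {p} {P : Set p} (P? : Dec P) → P → ⟦ P? ⟧ ≡ 1ℚ
⟦⟧-yes (yes _) _ = refl
⟦⟧-yes (no ¬p) p = contradiction p ¬p

⟦⟧-no : ∀ {p} {P : Set p} (P? : Dec P) → ¬ P → ⟦ P? ⟧ ≡ 0ℚ
⟦⟧-no (yes p) ¬p = contradiction p ¬p
⟦⟧-no (no _)  _  = refl

⟦⟧-cong : ∀ {p q} {P : Set p} {Q : Set q} (P? : Dec P) (Q? : Dec Q) →
          (P → Q) → (Q → P) → ⟦ P? ⟧ ≡ ⟦ Q? ⟧
⟦⟧-cong (yes p) Q? f g = sym (⟦⟧-yes Q? (f p))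
⟦⟧-cong (no ¬p) Q? f g = sym (⟦⟧-no Q? (¬p ∘ g))

⟦⟧-× : ∀ {p q} {P : Set p} {Q : Set q} (P? : Dec P) (Q? : Dec Q) →
       ⟦ P? ×-dec Q? ⟧ ≡ ⟦ P? ⟧ * ⟦ Q? ⟧
⟦⟧-× (yes _) (yes _) = refl
⟦⟧-× (yes _) (no _)  = refl
⟦⟧-× (no _)  (yes _) = refl
⟦⟧-× (no _)  (no _)  = refl

𝐞-diag : (v : Fin n) → 𝐞 v v ≡ 1ℚ
𝐞-diag v = ⟦⟧-yes (v ≟ v) refl

𝐞-off : {v i : Fin n} → i ≢ v → 𝐞 v i ≡ 0ℚ
𝐞-off {v = v} {i} i≢v = ⟦⟧-no (i ≟ v) i≢v

𝐞-sym : (u v : Fin n) → 𝐞 u v ≡ 𝐞 v u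
𝐞-sym u v = ⟦⟧-cong (v ≟ u) (u ≟ v) sym sym

𝐞· : (v : Fin n) (f : Vector n) → ∑ (λ i → 𝐞 v i * f i) ≡ f v
𝐞· v f = begin
  ∑ (λ i → 𝐞 v i * f i) ≡⟨ ∑-only _ v (λ i i≢v → trans (cong (_* f i) (𝐞-off i≢v)) (ℚₚ.*-zeroˡ (f i))) ⟩
  𝐞 v v * f v             ≡⟨ cong (_* f v) (𝐞-diag v) ⟩
  1ℚ * f v                ≡⟨ ℚₚ.*-identityˡ _ ⟩
  f v                     ∎

·𝐞 : (v : Fin n) (f : Vector n) → ∑ (λ i → f i * 𝐞 v i) ≡ f v
·𝐞 v f = trans (∑-cong λ i → ℚₚ.*-comm (f i) _) (𝐞· v f)

-- Rational quotients are normalised, so they do not compute on variables; z / 1 is `fromℚᵘ` of an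
-- unnormalised fraction by definition, and arithmetic on `ℤ→ℚ` is obtained from there.
fromℚᵘ-+ : ∀ p q → fromℚᵘ (p ℚᵘ.+ q) ≡ fromℚᵘ p + fromℚᵘ q
fromℚᵘ-+ p q = ℚₚ.toℚᵘ-injective
  (ℚᵘₚ.≃-trans (ℚₚ.toℚᵘ-fromℚᵘ _)
  (ℚᵘₚ.≃-trans (ℚᵘₚ.+-cong (ℚᵘₚ.≃-sym (ℚₚ.toℚᵘ-fromℚᵘ p)) (ℚᵘₚ.≃-sym (ℚₚ.toℚᵘ-fromℚᵘ q)))
  (ℚᵘₚ.≃-sym (ℚₚ.toℚᵘ-homo-+ (fromℚᵘ p) (fromℚᵘ q)))))

fromℚᵘ-* : ∀ p q → fromℚᵘ (p ℚᵘ.* q) ≡ fromℚᵘ p * fromℚᵘ q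
fromℚᵘ-* p q = ℚₚ.toℚᵘ-injective
  (ℚᵘₚ.≃-trans (ℚₚ.toℚᵘ-fromℚᵘ _)
  (ℚᵘₚ.≃-trans (ℚᵘₚ.*-cong (ℚᵘₚ.≃-sym (ℚₚ.toℚᵘ-fromℚᵘ p)) (ℚᵘₚ.≃-sym (ℚₚ.toℚᵘ-fromℚᵘ q)))
  (ℚᵘₚ.≃-sym (ℚₚ.toℚᵘ-homo-* (fromℚᵘ p) (fromℚᵘ q)))))

ℤ→ℚ : ℤ → ℚ
ℤ→ℚ z = z / 1

ℤ→ℚ-+ : ∀ a b → ℤ→ℚ (a ℤ.+ b) ≡ ℤ→ℚ a + ℤ→ℚ b
ℤ→ℚ-+ a b = trans (cong ℤ→ℚ (sym (cong₂ ℤ._+_ (ℤₚ.*-identityʳ a) (ℤₚ.*-identityʳ b))))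
                  (fromℚᵘ-+ (mkℚᵘ a 0) (mkℚᵘ b 0))

ℤ→ℚ-* : ∀ a b → ℤ→ℚ (a ℤ.* b) ≡ ℤ→ℚ a * ℤ→ℚ b
ℤ→ℚ-* a b = fromℚᵘ-* (mkℚᵘ a 0) (mkℚᵘ b 0)

ℤ→ℚ-neg : ∀ a → ℤ→ℚ (ℤ.- a) ≡ ℚ.- ℤ→ℚ a
ℤ→ℚ-neg (ℤ.+ zero)  = refl
ℤ→ℚ-neg (ℤ.+ suc n) = refl
ℤ→ℚ-neg -[1+ n ]  = sym (neg-neg (ℤ→ℚ (ℤ.+ suc n)))
  where
  neg-neg : ∀ p → ℚ.- (ℚ.- p) ≡ p
  neg-neg = solve-∀ ℚ-ring

ℤ→ℚ-- : ∀ a b → ℤ→ℚ (a ℤ.- b) ≡ ℤ→ℚ a - ℤ→ℚ b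
ℤ→ℚ-- a b = trans (ℤ→ℚ-+ a (ℤ.- b)) (cong (λ z → ℤ→ℚ a + z) (ℤ→ℚ-neg b))

ℕ→ℚ-+ : ∀ a b → ℕ→ℚ (a ℕ.+ b) ≡ ℕ→ℚ a + ℕ→ℚ b
ℕ→ℚ-+ a b = ℤ→ℚ-+ (ℤ.+ a) (ℤ.+ b)

ℕ→ℚ-* : ∀ a b → ℕ→ℚ (a ℕ.* b) ≡ ℕ→ℚ a * ℕ→ℚ b
ℕ→ℚ-* a b = trans (cong ℤ→ℚ (ℤₚ.pos-* a b)) (ℤ→ℚ-* (ℤ.+ a) (ℤ.+ b))

ℕ→ℚ-suc : ∀ a → ℕ→ℚ (suc a) ≡ 1ℚ + ℕ→ℚ a
ℕ→ℚ-suc a = ℕ→ℚ-+ 1 a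

ℕ→ℚ-sum′ : (f : Fin n → ℕ) → ℕ→ℚ (sumℕ f) ≡ sum (ℕ→ℚ ∘ f)
ℕ→ℚ-sum′ {zero}  f = refl
ℕ→ℚ-sum′ {suc n} f = trans (ℕ→ℚ-+ (f zero) _) (cong (λ z → ℕ→ℚ (f zero) + z) (ℕ→ℚ-sum′ (f ∘ suc)))

ℕ→ℚ-sum : (f : Fin n → ℕ) → ℕ→ℚ (sumℕ f) ≡ ∑ (ℕ→ℚ ∘ f)
ℕ→ℚ-sum f = trans (ℕ→ℚ-sum′ f) (sum≡∑ _)

/-* : ∀ z m .{{_ : ℕ.NonZero m}} → (z / m) * ℕ→ℚ m ≡ ℤ→ℚ z
/-* z (suc m) = trans (sym (fromℚᵘ-* (mkℚᵘ z m) (mkℚᵘ (ℤ.+ suc m) 0)))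
  (ℚₚ.fromℚᵘ-cong {mkℚᵘ z m ℚᵘ.* mkℚᵘ (ℤ.+ suc m) 0} {mkℚᵘ z 0} (*≡* (begin
    (z ℤ.* ℤ.+ suc m) ℤ.* ℤ.+ 1     ≡⟨ ℤₚ.*-identityʳ _ ⟩
    z ℤ.* ℤ.+ suc m               ≡⟨ cong (λ l → z ℤ.* ℤ.+ l) (ℕₚ.*-identityʳ (suc m)) ⟨
    z ℤ.* (ℤ.+ (suc m ℕ.* 1))     ∎)))

ℕ→ℚ-nonNeg : ∀ a → 0ℚ ≤ ℕ→ℚ a
ℕ→ℚ-nonNeg a = ℚₚ.nonNegative⁻¹ (ℕ→ℚ a) {{ℚₚ.normalize-nonNeg a 1}}

ℕ→ℚ-≢0 : ∀ m .{{_ : ℕ.NonZero m}} → ℕ→ℚ m ≢ 0ℚ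
ℕ→ℚ-≢0 m@(suc _) eq = ℚₚ.1≢0 (begin
  1ℚ                    ≡⟨ /-* (ℤ.+ 1) m ⟨
  (ℤ.+ 1 / m) * ℕ→ℚ m   ≡⟨ cong ((ℤ.+ 1 / m) *_) eq ⟩
  (ℤ.+ 1 / m) * 0ℚ      ≡⟨ ℚₚ.*-zeroʳ (ℤ.+ 1 / m) ⟩
  0ℚ                    ∎)

*-cancelˡ : ∀ c {p q} → c ≢ 0ℚ → c * p ≡ c * q → p ≡ q
*-cancelˡ c {p} {q} c≢0 cp≡cq = begin
  p                 ≡⟨ lemma p ⟨
  1/c * (c * p)     ≡⟨ cong (1/c *_) cp≡cq ⟩
  1/c * (c * q)     ≡⟨ lemma q ⟩
  q                 ∎
  where
  instance _ = ℚ.≢-nonZero c≢0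
  1/c = ℚ.1/ c
  lemma : ∀ r → 1/c * (c * r) ≡ r
  lemma r = begin
    1/c * (c * r) ≡⟨ ℚₚ.*-assoc 1/c c r ⟨
    1/c * c * r   ≡⟨ cong (_* r) (ℚₚ.*-inverseˡ c) ⟩
    1ℚ * r        ≡⟨ ℚₚ.*-identityˡ r ⟩
    r             ∎

-- The Laplacian as a difference operator

0≤p*p : ∀ p → 0ℚ ≤ p * p
0≤p*p p with ℚₚ.≤-total 0ℚ p
... | inj₁ 0≤p = ℚₚ.nonNegative⁻¹ (p * p) {{ℚₚ.nonNeg*nonNeg⇒nonNeg p p}}
  where instance _ = ℚ.nonNegative 0≤p
... | inj₂ p≤0 = ℚₚ.nonNegative⁻¹ (p * p) {{ℚₚ.nonPos*nonPos⇒nonPos p p}}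
  where instance _ = ℚ.nonPositive p≤0

p*p≡0⇒p≡0 : ∀ p → p * p ≡ 0ℚ → p ≡ 0ℚ
p*p≡0⇒p≡0 p pp≡0 with p ℚₚ.≟ 0ℚ
... | yes p≡0 = p≡0
... | no  p≢0 = *-cancelˡ p p≢0 (trans pp≡0 (sym (ℚₚ.*-zeroʳ p)))

p-q≡0⇒p≡q : ∀ p q → p - q ≡ 0ℚ → p ≡ q
p-q≡0⇒p≡q p q eq = begin
  p           ≡⟨ lemma p q ⟨
  (p - q) + q ≡⟨ cong (_+ q) eq ⟩
  0ℚ + q      ≡⟨ ℚₚ.+-identityˡ q ⟩
  q           ∎
  where
  lemma : ∀ p q → (p - q) + q ≡ p
  lemma = solve-∀ ℚ-ring

module _ (H : Graph n) where

  𝐚 : Matrix n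
  𝐚 u v = ⟦ adj? H u v ⟧

  𝐚-sym : ∀ u v → 𝐚 u v ≡ 𝐚 v u
  𝐚-sym u v = ⟦⟧-cong (adj? H u v) (adj? H v u) (flip H) (flip H)

  𝐚-irr : ∀ u → 𝐚 u u ≡ 0ℚ
  𝐚-irr u = ⟦⟧-no (adj? H u u) (subst T (adj-irr H u))

  𝐝-sum : ∀ u → 𝐝 H u ≡ ∑ (𝐚 u)
  𝐝-sum u = ℕ→ℚ-sum (λ v → indicator (adj? H u v))

  -- The difference form involves only values at the two ends of an edge. For a chain it can
  -- therefore be evaluated knowing just how a function changes along inner edges and along bridges.
  Δ : Vector n → Vector n
  Δ f u = ∑ λ v → 𝐚 u v * (f u - f v)

  Δ-expand : ∀ f u → Δ f u ≡ 𝐝 H u * f u - ∑ (λ v → 𝐚 u v * f v)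
  Δ-expand f u = begin
    ∑ (λ v → 𝐚 u v * (f u - f v))                      ≡⟨ ∑-cong (λ v → lemma (𝐚 u v) (f u) (f v)) ⟩
    ∑ (λ v → 𝐚 u v * f u - 𝐚 u v * f v)                ≡⟨ ∑-- _ _ ⟩
    ∑ (λ v → 𝐚 u v * f u) - ∑ (λ v → 𝐚 u v * f v)    ≡⟨ cong (_- ∑ (λ v → 𝐚 u v * f v)) (∑-* (f u) (𝐚 u)) ⟨
    ∑ (𝐚 u) * f u - ∑ (λ v → 𝐚 u v * f v)            ≡⟨ cong (λ d → d * f u - ∑ (λ v → 𝐚 u v * f v)) (𝐝-sum u) ⟨
    𝐝 H u * f u - ∑ (λ v → 𝐚 u v * f v)                ∎
    where
    lemma : ∀ a p q → a * (p - q) ≡ a * p - a * q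
    lemma = solve-∀ ℚ-ring

  Δ-cong : ∀ {f g} → (∀ u → f u ≡ g u) → ∀ u → Δ f u ≡ Δ g u
  Δ-cong f≗g u = ∑-cong λ v → cong₂ (λ p q → 𝐚 u v * (p - q)) (f≗g u) (f≗g v)

  Δ-- : ∀ f g u → Δ (λ v → f v - g v) u ≡ Δ f u - Δ g u
  Δ-- f g u = trans (∑-cong λ v → lemma (𝐚 u v) (f u) (g u) (f v) (g v)) (∑-- _ _)
    where
    lemma : ∀ a p q r s → a * (p - q - (r - s)) ≡ a * (p - r) - a * (q - s)
    lemma = solve-∀ ℚ-ring

  Δ-* : ∀ c f u → Δ (λ v → c * f v) u ≡ c * Δ f u
  Δ-* c f u = trans (∑-cong λ v → lemma (𝐚 u v) c (f u) (f v)) (sym (*-∑ c _))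
    where
    lemma : ∀ a c p q → a * (c * p - c * q) ≡ c * (a * (p - q))
    lemma = solve-∀ ℚ-ring

  Δ-sum : ∀ {k} (f : Fin k → Vector n) u → Δ (λ v → ∑ λ i → f i v) u ≡ ∑ λ i → Δ (f i) u
  Δ-sum f u = begin
    ∑ (λ v → 𝐚 u v * (∑ (λ i → f i u) - ∑ (λ i → f i v)))  ≡⟨ ∑-cong (λ v → cong (𝐚 u v *_) (∑-- _ _)) ⟨
    ∑ (λ v → 𝐚 u v * ∑ (λ i → f i u - f i v))                ≡⟨ ∑-cong (λ v → *-∑ (𝐚 u v) _) ⟩
    ∑ (λ v → ∑ (λ i → 𝐚 u v * (f i u - f i v)))              ≡⟨ ∑-swap (λ v i → 𝐚 u v * (f i u - f i v)) ⟩
    ∑ (λ i → Δ (f i) u)                                        ∎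

  Σ𝐚-swap : (f : Matrix n) →
    ∑ (λ u → ∑ λ v → 𝐚 u v * f u v) ≡ ∑ (λ u → ∑ λ v → 𝐚 u v * f v u)
  Σ𝐚-swap f = trans (∑-swap λ u v → 𝐚 u v * f u v)
    (∑-cong λ v → ∑-cong λ u → cong (_* f u v) (𝐚-sym u v))

  -- The summand is antisymmetric in the two ends of an edge. This later supplies the value of a
  -- Laplacian at the one vertex where no equation is available.
  ΣΔ≡0 : ∀ f → ∑ (Δ f) ≡ 0ℚ
  ΣΔ≡0 f = begin
    ∑ (Δ f)
      ≡⟨ ∑-cong (λ u → ∑-cong λ v → lemma (𝐚 u v) (f u) (f v)) ⟩
    ∑ (λ u → ∑ λ v → 𝐚 u v * f u - 𝐚 u v * f v)
      ≡⟨ ∑-cong (λ u → ∑-- (λ v → 𝐚 u v * f u) (λ v → 𝐚 u v * f v)) ⟩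
    ∑ (λ u → ∑ (λ v → 𝐚 u v * f u) - ∑ (λ v → 𝐚 u v * f v)) ≡⟨ ∑-- _ _ ⟩
    S - ∑ (λ u → ∑ λ v → 𝐚 u v * f v)                       ≡⟨ cong (S -_) (Σ𝐚-swap λ u v → f v) ⟩
    S - S                                                       ≡⟨ ℚₚ.+-inverseʳ S ⟩
    0ℚ                                                          ∎
    where
    S = ∑ λ u → ∑ λ v → 𝐚 u v * f u
    lemma : ∀ a p q → a * (p - q) ≡ a * p - a * q
    lemma = solve-∀ ℚ-ring

  -- The Dirichlet form Σ 𝐚 u v (f u − f v)² equals 2 Σ f u Δ f u.
  harmonic⇒const : Connected H → ∀ f → (∀ u → Δ f u ≡ 0ℚ) → ∀ u v → f u ≡ f v
  harmonic⇒const conn f Δf≡0 u v = walk (Connected.reachable conn u v)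
    where
    D : Matrix n
    D u v = 𝐚 u v * ((f u - f v) * (f u - f v))

    split : ∀ a p q → a * ((p - q) * (p - q)) ≡ p * (a * (p - q)) + a * (q * (q - p))
    split = solve-∀ ℚ-ring

    assoc : ∀ a p q → a * (p * q) ≡ p * (a * q)
    assoc = solve-∀ ℚ-ring

    row : ∀ u → ∑ (λ v → f u * (𝐚 u v * (f u - f v))) ≡ 0ℚ
    row u = trans (sym (*-∑ (f u) _)) (trans (cong (f u *_) (Δf≡0 u)) (ℚₚ.*-zeroʳ (f u)))

    col : ∑ (λ u → ∑ λ v → 𝐚 u v * (f v * (f v - f u))) ≡ 0ℚ
    col = trans (Σ𝐚-swap λ u v → f v * (f v - f u))
      (∑-0 _ λ u → trans (∑-cong λ v → assoc (𝐚 u v) (f u) (f u - f v)) (row u))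

    form≡0 : ∑ (λ u → ∑ (D u)) ≡ 0ℚ
    form≡0 = begin
      ∑ (λ u → ∑ (D u))
        ≡⟨ ∑-cong (λ u → trans (∑-cong λ v → split (𝐚 u v) (f u) (f v)) (∑-+ _ _)) ⟩
      ∑ (λ u → ∑ (λ v → f u * (𝐚 u v * (f u - f v))) + ∑ (λ v → 𝐚 u v * (f v * (f v - f u))))
        ≡⟨ ∑-+ _ _ ⟩
      ∑ (λ u → ∑ (λ v → f u * (𝐚 u v * (f u - f v)))) + ∑ (λ u → ∑ (λ v → 𝐚 u v * (f v * (f v - f u))))
        ≡⟨ cong₂ _+_ (∑-0 _ row) col ⟩
      0ℚ ∎

    D-nonNeg : ∀ u v → 0ℚ ≤ D u v
    D-nonNeg u v = ℚₚ.nonNegative⁻¹ (D u v)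
      {{ℚₚ.nonNeg*nonNeg⇒nonNeg (𝐚 u v) {{ℚ.nonNegative (ℕ→ℚ-nonNeg (indicator (adj? H u v)))}}
          ((f u - f v) * (f u - f v)) {{ℚ.nonNegative (0≤p*p (f u - f v))}}}}

    edge : ∀ {u v} → Adj H u v → f u ≡ f v
    edge {u} {v} e = p-q≡0⇒p≡q _ _ (p*p≡0⇒p≡0 _ (begin
      (f u - f v) * (f u - f v)  ≡⟨ ℚₚ.*-identityˡ _ ⟨
      1ℚ * ((f u - f v) * (f u - f v)) ≡⟨ cong (_* ((f u - f v) * (f u - f v))) (⟦⟧-yes (adj? H u v) e) ⟨
      D u v ≡⟨ ∑≡0⇒≡0 (D u) (D-nonNeg u) (∑≡0⇒≡0 _ (λ u → ∑-nonNeg (D u) (D-nonNeg u)) form≡0 u) v ⟩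
      0ℚ ∎))

    walk : ∀ {u v} → Reachable H u v → f u ≡ f v
    walk ε       = refl
    walk (e ◅ w) = trans (edge e) (walk w)

  Δ-unique : Connected H → ∀ f g → (∀ u → Δ f u ≡ Δ g u) → ∀ u v → f u - g u ≡ f v - g v
  Δ-unique conn f g eq = harmonic⇒const conn (λ u → f u - g u) λ u → begin
    Δ (λ v → f v - g v) u ≡⟨ Δ-- f g u ⟩
    Δ f u - Δ g u         ≡⟨ cong (_- Δ g u) (eq u) ⟩
    Δ g u - Δ g u         ≡⟨ ℚₚ.+-inverseʳ (Δ g u) ⟩
    0ℚ                    ∎

-- For connected H and symmetric R these conditions determine R: it is the
-- effective resistance matrix.  They are local, so that they can be checked for
-- a chain without a Moore-Penrose inverse of its Laplacian.
record IsResistance (H : Graph n) (R : Matrix n) : Set where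
  field
    diag      : ∀ v → R v v ≡ 0ℚ
    τ         : Vector n
    potential : ∀ v u → Δ H (λ w → R w v) u ≡ τ u - 2ℚ * 𝐞 v u

module _ (H : Graph n) where

  private L = laplacian H

  laplacian-Δ : ∀ f u → ∑ (λ w → L u w * f w) ≡ Δ H f u
  laplacian-Δ f u = begin
    ∑ (λ w → L u w * f w)
      ≡⟨ ∑-cong (λ w → lemma (𝐝 H u) (𝐞 u w) (𝐚 H u w) (f w)) ⟩
    ∑ (λ w → 𝐞 u w * (𝐝 H u * f w) - 𝐚 H u w * f w)
      ≡⟨ ∑-- _ _ ⟩
    ∑ (λ w → 𝐞 u w * (𝐝 H u * f w)) - ∑ (λ w → 𝐚 H u w * f w)
      ≡⟨ cong (_- ∑ (λ w → 𝐚 H u w * f w)) (𝐞· u _) ⟩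
    𝐝 H u * f u - ∑ (λ w → 𝐚 H u w * f w)
      ≡⟨ Δ-expand H f u ⟨
    Δ H f u ∎
    where
    lemma : ∀ d e a f → (d * e - a) * f ≡ e * (d * f) - a * f
    lemma = solve-∀ ℚ-ring

  laplacian-sym : ∀ u v → L u v ≡ L v u
  laplacian-sym u v = cong₂ _-_ diagonal (𝐚-sym H u v)
    where
    diagonal : 𝐝 H u * 𝐞 u v ≡ 𝐝 H v * 𝐞 v u
    diagonal with v ≟ u
    ... | yes refl = cong (𝐝 H v *_) (sym (𝐞-diag v))
    ... | no v≢u = begin
      𝐝 H u * 0ℚ      ≡⟨ ℚₚ.*-zeroʳ (𝐝 H u) ⟩
      0ℚ              ≡⟨ ℚₚ.*-zeroʳ (𝐝 H v) ⟨
      𝐝 H v * 0ℚ      ≡⟨ cong (𝐝 H v *_) (𝐞-off (v≢u ∘ sym)) ⟨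
      𝐝 H v * 𝐞 v u   ∎

  Δ-𝐞 : ∀ v u → Δ H (𝐞 v) u ≡ L u v
  Δ-𝐞 v u = trans (sym (laplacian-Δ (𝐞 v) u)) (·𝐞 v (L u))

  -- L (M − I) = 0 makes the columns of M − I constant, and symmetry its rows.
  projection-entry : Connected H → (M : Matrix n) → (∀ u v → M u v ≡ M v u) →
    (∀ v u → Δ H (λ w → M w v) u ≡ L u v) →
    ∀ u v → M u v ≡ 𝐞 v u + (M u u - 𝐞 u u)
  projection-entry conn M M-sym LM≡L u v = begin
    M u v                      ≡⟨ lemma (M u v) (𝐞 v u) ⟩
    𝐞 v u + (M u v - 𝐞 v u)    ≡⟨ cong (𝐞 v u +_) (cong₂ _-_ (M-sym u v) (𝐞-sym v u)) ⟩
    𝐞 v u + (M v u - 𝐞 u v)    ≡⟨ cong (𝐞 v u +_) (column v u) ⟩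
    𝐞 v u + (M u u - 𝐞 u u)    ∎
    where
    column : ∀ v u → M v u - 𝐞 u v ≡ M u u - 𝐞 u u
    column v u = Δ-unique H conn (λ w → M w u) (𝐞 u) (λ w → trans (LM≡L u w) (sym (Δ-𝐞 u w))) v u
    lemma : ∀ p q → p ≡ q + (p - q)
    lemma = solve-∀ ℚ-ring

  module _ (X : Matrix n) where

    resistance-entry : ∀ u v → resistance X u v ≡ (X u u - X u v) - (X v u - X v v)
    resistance-entry u v = begin
      resistance X u v                       ≡⟨ sum≡∑ _ ⟩
      ∑ (λ i → δ i * sum (λ j → X i j * δ j)) ≡⟨ ∑-cong (λ i → cong (δ i *_) (trans (sum≡∑ _) (pair (X i)))) ⟩
      ∑ (λ i → δ i * (X i u - X i v))        ≡⟨ ∑-cong (λ i → ℚₚ.*-comm (δ i) (X i u - X i v)) ⟩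
      ∑ (λ i → (X i u - X i v) * δ i)        ≡⟨ pair (λ i → X i u - X i v) ⟩
      (X u u - X u v) - (X v u - X v v)      ∎
      where
      δ : Vector n
      δ i = 𝐞 u i - 𝐞 v i
      lemma : ∀ f p q → f * (p - q) ≡ f * p - f * q
      lemma = solve-∀ ℚ-ring
      pair : ∀ f → ∑ (λ j → f j * δ j) ≡ f u - f v
      pair f = begin
        ∑ (λ j → f j * δ j)                                ≡⟨ ∑-cong (λ j → lemma (f j) (𝐞 u j) (𝐞 v j)) ⟩
        ∑ (λ j → f j * 𝐞 u j - f j * 𝐞 v j)                ≡⟨ ∑-- _ _ ⟩
        ∑ (λ j → f j * 𝐞 u j) - ∑ (λ j → f j * 𝐞 v j)      ≡⟨ cong₂ _-_ (·𝐞 u f) (·𝐞 v f) ⟩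
        f u - f v                                          ∎

    resistance-sym : ∀ u v → resistance X u v ≡ resistance X v u
    resistance-sym u v = begin
      resistance X u v                  ≡⟨ resistance-entry u v ⟩
      (X u u - X u v) - (X v u - X v v) ≡⟨ lemma (X u u) (X u v) (X v u) (X v v) ⟩
      (X v v - X v u) - (X u v - X u u) ≡⟨ resistance-entry v u ⟨
      resistance X v u                  ∎
      where
      lemma : ∀ a b c d → (a - b) - (c - d) ≡ (d - c) - (b - a)
      lemma = solve-∀ ℚ-ring

    -- In X u u - X u v - X v u + X v v the first term has a Laplacian free of v and the last is
    -- constant in u. Each mixed term contributes -𝐞 v and a part depending on u alone, whence the
    -- factor 2. The two mixed terms are treated separately, one through L X and the other through X
    -- L, as symmetry of X is not one of the Penrose conditions.
    resistance-isResistance : Connected H → IsMoorePenroseInverse L X →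
                              IsResistance H (resistance X)
    resistance-isResistance conn mp = record
      { diag = λ v → trans (resistance-entry v v) (lemma₀ (X v v))
      ; τ    = λ u → Δ H (λ w → X w w) u - (p u + q u)
      ; potential = λ v u → begin
          Δ H (λ w → resistance X w v) u
            ≡⟨ Δ-cong H (λ w → resistance-entry w v) u ⟩
          Δ H (λ w → (X w w - X w v) - (X v w - X v v)) u
            ≡⟨ trans (Δ-- H (λ w → X w w - X w v) (λ w → X v w - X v v) u)
                     (cong₂ _-_ (Δ-- H (λ w → X w w) (λ w → X w v) u) (Δ-- H (X v) (λ _ → X v v) u)) ⟩
          (Δ H (λ w → X w w) u - Δ H (λ w → X w v) u) - (Δ H (X v) u - Δ H (λ _ → X v v) u)
            ≡⟨ cong₂ (λ y z → (Δ H (λ w → X w w) u - y) - z) (ΔX v u)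
              (cong₂ _-_ (ΔXᵀ v u) (Δ-const (X v v) u)) ⟩
          (Δ H (λ w → X w w) u - (𝐞 v u + p u)) - (𝐞 v u + q u - 0ℚ)
            ≡⟨ lemma₁ (Δ H (λ w → X w w) u) (𝐞 v u) (p u) (q u) ⟩
          Δ H (λ w → X w w) u - (p u + q u) - 2ℚ * 𝐞 v u ∎
      }
      where
      open IsMoorePenroseInverse mp
      P Q : Matrix n
      P = L *ₘ X
      Q = X *ₘ L

      -- Both projections are the identity minus the averaging matrix, so these entries are -1/n;
      -- what matters here is that they do not depend on the column v.
      p q : Vector n
      p u = P u u - 𝐞 u u
      q u = Q u u - 𝐞 u u

      lemma₀ : ∀ x → (x - x) - (x - x) ≡ 0ℚ
      lemma₀ = solve-∀ ℚ-ring
      lemma₁ : ∀ a e p q → (a - (e + p)) - (e + q - 0ℚ) ≡ a - (p + q) - 2ℚ * e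
      lemma₁ = solve-∀ ℚ-ring

      Δ-const : ∀ c u → Δ H (λ _ → c) u ≡ 0ℚ
      Δ-const c u = ∑-0 _ λ w → trans (cong (𝐚 H u w *_) (ℚₚ.+-inverseʳ c)) (ℚₚ.*-zeroʳ (𝐚 H u w))

      transpose : ∀ f u → ∑ (λ w → f w * L w u) ≡ Δ H f u
      transpose f u = trans
        (∑-cong λ w → trans (ℚₚ.*-comm (f w) (L w u)) (cong (_* f w) (laplacian-sym w u)))
        (laplacian-Δ f u)

      LP≡L : ∀ v u → Δ H (λ w → P w v) u ≡ L u v
      LP≡L v u = begin
        Δ H (λ w → P w v) u     ≡⟨ Δ-cong H (λ w → AX-sym v w) u ⟩
        Δ H (P v) u             ≡⟨ transpose (P v) u ⟨
        ∑ (λ w → P v w * L w u) ≡⟨ sum≡∑ _ ⟨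
        (P *ₘ L) v u            ≡⟨ AXA≈A v u ⟩
        L v u                   ≡⟨ laplacian-sym v u ⟩
        L u v                   ∎

      -- This is L (X L) = (L X) L = L, an associativity. For P the same equation came instead from
      -- transposing (L X) L = L, using that L X and L are symmetric.
      LQ≡L : ∀ v u → Δ H (λ w → Q w v) u ≡ L u v
      LQ≡L v u = begin
        Δ H (λ w → Q w v) u
          ≡⟨ laplacian-Δ (λ w → Q w v) u ⟨
        ∑ (λ w → L u w * Q w v)
          ≡⟨ ∑-cong (λ w → trans (cong (L u w *_) (sum≡∑ _)) (*-∑ (L u w) _)) ⟩
        ∑ (λ w → ∑ λ l → L u w * (X w l * L l v))
          ≡⟨ ∑-swap (λ w l → L u w * (X w l * L l v)) ⟩
        ∑ (λ l → ∑ λ w → L u w * (X w l * L l v))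
          ≡⟨ ∑-cong (λ l → ∑-cong λ w → ℚₚ.*-assoc (L u w) (X w l) (L l v)) ⟨
        ∑ (λ l → ∑ λ w → L u w * X w l * L l v)
          ≡⟨ ∑-cong (λ l → trans (cong (_* L l v) (sum≡∑ _)) (∑-* (L l v) _)) ⟨
        ∑ (λ l → P u l * L l v)
          ≡⟨ sum≡∑ _ ⟨
        (P *ₘ L) u v
          ≡⟨ AXA≈A u v ⟩
        L u v ∎

      ΔX : ∀ v u → Δ H (λ w → X w v) u ≡ 𝐞 v u + p u
      ΔX v u = begin
        Δ H (λ w → X w v) u       ≡⟨ laplacian-Δ _ u ⟨
        ∑ (λ w → L u w * X w v)   ≡⟨ sum≡∑ _ ⟨
        P u v                     ≡⟨ projection-entry conn P (λ u v → AX-sym v u) LP≡L u v ⟩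
        𝐞 v u + p u               ∎

      ΔXᵀ : ∀ v u → Δ H (X v) u ≡ 𝐞 v u + q u
      ΔXᵀ v u = begin
        Δ H (X v) u               ≡⟨ transpose (X v) u ⟨
        ∑ (λ w → X v w * L w u)   ≡⟨ sum≡∑ _ ⟨
        Q v u                     ≡⟨ XA-sym u v ⟩
        Q u v                     ≡⟨ projection-entry conn Q (λ u v → XA-sym v u) LQ≡L u v ⟩
        𝐞 v u + q u               ∎

-- Kemeny's constant and resistances

when-⟦⟧ : ∀ {p} {P : Set p} (P? : Dec P) (f : P → ℚ) (x : ℚ) → (∀ p → f p ≡ x) → when P? f ≡ ⟦ P? ⟧ * x
when-⟦⟧ (yes p) f x f≡x = trans (f≡x p) (sym (ℚₚ.*-identityˡ x))
when-⟦⟧ (no _)  f x _   = sym (ℚₚ.*-zeroˡ x)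

⟦≢⟧ : (v w : Fin n) → ⟦ ¬? (w ≟ v) ⟧ ≡ 1ℚ - 𝐞 v w
⟦≢⟧ v w with w ≟ v
... | yes _ = refl
... | no _  = refl

-- By trichotomy an ordered pair off the diagonal occurs in exactly one of the two orders. This
-- translates sums over edges u < v into symmetric double sums.
∑-oriented : (f : Matrix n) → (∀ u → f u u ≡ 0ℚ) →
  ∑ (λ u → ∑ (f u)) ≡ ∑ λ u → ∑ λ v → ⟦ u <? v ⟧ * (f u v + f v u)
∑-oriented f f-irr = begin
  ∑ (λ u → ∑ (f u))
    ≡⟨ ∑-cong (λ u → trans (∑-cong (split u)) (∑-+ _ _)) ⟩
  ∑ (λ u → ∑ (λ v → ⟦ u <? v ⟧ * f u v) + ∑ (λ v → ⟦ v <? u ⟧ * f u v))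
    ≡⟨ ∑-+ _ _ ⟩
  ∑ (λ u → ∑ λ v → ⟦ u <? v ⟧ * f u v) + ∑ (λ u → ∑ λ v → ⟦ v <? u ⟧ * f u v)
    ≡⟨ cong (∑ (λ u → ∑ λ v → ⟦ u <? v ⟧ * f u v) +_) (∑-swap λ u v → ⟦ v <? u ⟧ * f u v) ⟩
  ∑ (λ u → ∑ λ v → ⟦ u <? v ⟧ * f u v) + ∑ (λ u → ∑ λ v → ⟦ u <? v ⟧ * f v u)
    ≡⟨ ∑-+ _ _ ⟨
  ∑ (λ u → ∑ (λ v → ⟦ u <? v ⟧ * f u v) + ∑ (λ v → ⟦ u <? v ⟧ * f v u))
    ≡⟨ ∑-cong (λ u → trans (∑-cong λ v → ℚₚ.*-distribˡ-+ ⟦ u <? v ⟧ (f u v) (f v u)) (∑-+ _ _)) ⟨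
  ∑ (λ u → ∑ λ v → ⟦ u <? v ⟧ * (f u v + f v u)) ∎
  where
  1,0 : ∀ x → x ≡ 1ℚ * x + 0ℚ * x
  1,0 = solve-∀ ℚ-ring
  0,1 : ∀ x → x ≡ 0ℚ * x + 1ℚ * x
  0,1 = solve-∀ ℚ-ring
  0,0 : ∀ a b → 0ℚ ≡ a * 0ℚ + b * 0ℚ
  0,0 = solve-∀ ℚ-ring

  split : ∀ u v → f u v ≡ ⟦ u <? v ⟧ * f u v + ⟦ v <? u ⟧ * f u v
  split u v with <-cmp u v
  ... | tri< u<v _ v≮u = trans (1,0 (f u v)) (sym
    (cong₂ (λ a b → a * f u v + b * f u v) (⟦⟧-yes (u <? v) u<v) (⟦⟧-no (v <? u) v≮u)))
  ... | tri> u≮v _ v<u = trans (0,1 (f u v)) (sym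
    (cong₂ (λ a b → a * f u v + b * f u v) (⟦⟧-no (u <? v) u≮v) (⟦⟧-yes (v <? u) v<u)))
  ... | tri≈ _ refl _ = subst (λ x → x ≡ ⟦ u <? u ⟧ * x + ⟦ u <? u ⟧ * x) (sym (f-irr u))
    (0,0 ⟦ u <? u ⟧ ⟦ u <? u ⟧)

-- The premise makes the dummy value at denominator 0 correct. It holds in both uses: a vertex of
-- degree 0 has no neighbours, and total degree 0 forces every degree to be 0.
ratio-* : ∀ a d → (ℕ→ℚ d ≡ 0ℚ → ℕ→ℚ a ≡ 0ℚ) → ℕ→ℚ d * ratio a d ≡ ℕ→ℚ a
ratio-* a zero    a≡0 = trans (ℚₚ.*-zeroˡ 0ℚ) (sym (a≡0 refl))
ratio-* a (suc d) _   = trans (ℚₚ.*-comm (ℕ→ℚ (suc d)) _) (/-* (ℤ.+ a) (suc d))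

vol : Graph n → ℚ
vol H = ∑ (𝐝 H)

module _ (H : Graph n) where

  private
    A = 𝐚 H
    d = 𝐝 H
    D = vol H

  vol≡2∣E∣ : D ≡ 2ℚ * ℕ→ℚ (∣E∣ H)
  vol≡2∣E∣ = begin
    ∑ d                                               ≡⟨ ∑-cong (𝐝-sum H) ⟩
    ∑ (λ u → ∑ (A u))                                 ≡⟨ ∑-oriented A (𝐚-irr H) ⟩
    ∑ (λ u → ∑ λ v → ⟦ u <? v ⟧ * (A u v + A v u))    ≡⟨ ∑-cong (λ u → ∑-cong λ v → term u v) ⟩
    ∑ (λ u → ∑ λ v → 2ℚ * ℕ→ℚ (E u v))
      ≡⟨ ∑-cong (λ u → trans (cong (2ℚ *_) (ℕ→ℚ-sum (E u))) (*-∑ 2ℚ _)) ⟨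
    ∑ (λ u → 2ℚ * ℕ→ℚ (sumℕ (E u)))
      ≡⟨ trans (cong (2ℚ *_) (ℕ→ℚ-sum λ u → sumℕ (E u))) (*-∑ 2ℚ _) ⟨
    2ℚ * ℕ→ℚ (∣E∣ H)                                  ∎
    where
    E : Fin n → Fin n → ℕ
    E u v = indicator (u <? v ×-dec adj? H u v)
    double : ∀ l a → l * (a + a) ≡ 2ℚ * (l * a)
    double = solve-∀ ℚ-ring
    term : ∀ u v → ⟦ u <? v ⟧ * (A u v + A v u) ≡ 2ℚ * ℕ→ℚ (E u v)
    term u v = begin
      ⟦ u <? v ⟧ * (A u v + A v u) ≡⟨ cong (λ a → ⟦ u <? v ⟧ * (A u v + a)) (𝐚-sym H v u) ⟩
      ⟦ u <? v ⟧ * (A u v + A u v) ≡⟨ double ⟦ u <? v ⟧ (A u v) ⟩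
      2ℚ * (⟦ u <? v ⟧ * A u v)    ≡⟨ cong (2ℚ *_) (⟦⟧-× (u <? v) (adj? H u v)) ⟨
      2ℚ * ℕ→ℚ (E u v)             ∎

  vol≡0⇒𝐝≡0 : D ≡ 0ℚ → ∀ u → d u ≡ 0ℚ
  vol≡0⇒𝐝≡0 = ∑≡0⇒≡0 d (λ u → ℕ→ℚ-nonNeg (deg H u))

  𝐝-transition : ∀ u v → d u * transition H u v ≡ A u v
  𝐝-transition u v = ratio-* (indicator (adj? H u v)) (deg H u) λ d≡0 →
    ∑≡0⇒≡0 (A u) (λ w → ℕ→ℚ-nonNeg (indicator (adj? H u w))) (trans (sym (𝐝-sum H u)) d≡0) v

  vol≡ℕ : D ≡ ℕ→ℚ (2 ℕ.* ∣E∣ H)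
  vol≡ℕ = trans vol≡2∣E∣ (sym (ℕ→ℚ-* 2 (∣E∣ H)))

  vol-stationary : ∀ u → D * stationary H u ≡ d u
  vol-stationary u = trans (cong (_* stationary H u) vol≡ℕ)
    (ratio-* (deg H u) (2 ℕ.* ∣E∣ H) λ 2m≡0 → vol≡0⇒𝐝≡0 (trans vol≡ℕ 2m≡0) u)

  module _ (m : Matrix n) (mfpt : ∀ i j → i ≢ j → IsMeanFirstPassageTime H i j (m i j)) where

    private
      -- The given mean times say nothing about the diagonal of `m`. Setting it to 0 yields hitting
      -- times rather than return times.
      h : Matrix n
      h u v = (1ℚ - 𝐞 v u) * m u v

      module _ (v : Fin n) where
        f : ℕ → Vector n
        f t u = firstPassage H t u v

        -- For the walk from u, `X N u` is the probability of reaching v within N steps, and `Y N u`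
        -- is the contribution of those N steps to the mean.
        X Y : ℕ → Vector n
        X N u = ∑ {N} λ t → f (toℕ t) u
        Y N u = ∑ {N} λ t → ℕ→ℚ (suc (toℕ t)) * f (toℕ t) u

        first-step : ∀ t u → d u * f (suc t) u ≡ ∑ λ w → A u w * (1ℚ - 𝐞 v w) * f t w
        first-step t u = begin
          d u * f (suc t) u
            ≡⟨ cong (d u *_) (trans (sum≡∑ _) (∑-cong λ w → trans (when-⟦⟧ (¬? (w ≟ v)) _ _ λ _ → refl)
              (cong (_* (transition H u w * f t w)) (⟦≢⟧ v w)))) ⟩
          d u * ∑ (λ w → (1ℚ - 𝐞 v w) * (transition H u w * f t w))
            ≡⟨ *-∑ (d u) _ ⟩
          ∑ (λ w → d u * ((1ℚ - 𝐞 v w) * (transition H u w * f t w)))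
            ≡⟨ ∑-cong (λ w → trans (lemma (d u) (1ℚ - 𝐞 v w) (transition H u w) (f t w))
              (cong (λ a → a * (1ℚ - 𝐞 v w) * f t w) (𝐝-transition u w))) ⟩
          ∑ (λ w → A u w * (1ℚ - 𝐞 v w) * f t w) ∎
          where
          lemma : ∀ d o p f → d * (o * (p * f)) ≡ d * p * o * f
          lemma = solve-∀ ℚ-ring

        -- After the first step the remaining time is one less, and the extra one, weighted by first
        -- passage probabilities, adds up to `X N`. Allowing one step more on the left makes this
        -- exact, with no remainder term.
        Y-step : ∀ N u → d u * Y (suc N) u ≡ A u v + ∑ λ w → A u w * (1ℚ - 𝐞 v w) * (Y N w + X N w)
        Y-step N u = begin
          d u * Y (suc N) u
            ≡⟨ cong (d u *_) (∑-suc _) ⟩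
          d u * (ℕ→ℚ 1 * f 0 u + ∑ {N} (λ t → ℕ→ℚ (2 ℕ.+ toℕ t) * f (suc (toℕ t)) u))
            ≡⟨ lemma₁ (d u) (f 0 u) _ ⟩
          d u * f 0 u + d u * ∑ {N} (λ t → ℕ→ℚ (2 ℕ.+ toℕ t) * f (suc (toℕ t)) u)
            ≡⟨ cong₂ _+_ (𝐝-transition u v) (trans (*-∑ (d u) _) (∑-cong {N} λ t → later (toℕ t))) ⟩
          A u v + ∑ {N} (λ t → ∑ λ w → A u w * (1ℚ - 𝐞 v w) * (ℕ→ℚ (suc (toℕ t)) * f (toℕ t) w + f (toℕ t) w))
            ≡⟨ cong (A u v +_) (∑-swap {N} (λ t w → A u w * (1ℚ - 𝐞 v w) *
              (ℕ→ℚ (suc (toℕ t)) * f (toℕ t) w + f (toℕ t) w))) ⟩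
          A u v + ∑ (λ w → ∑ {N} λ t → A u w * (1ℚ - 𝐞 v w) * (ℕ→ℚ (suc (toℕ t)) * f (toℕ t) w + f (toℕ t) w))
            ≡⟨ cong (A u v +_) (∑-cong λ w → trans (cong (A u w * (1ℚ - 𝐞 v w) *_) (sym (∑-+ {N} _ _)))
              (*-∑ {N} (A u w * (1ℚ - 𝐞 v w)) _)) ⟨
          A u v + ∑ (λ w → A u w * (1ℚ - 𝐞 v w) * (Y N w + X N w)) ∎
          where
          lemma₁ : ∀ d f s → d * (1ℚ * f + s) ≡ d * f + d * s
          lemma₁ = solve-∀ ℚ-ring
          lemma₂ : ∀ d c f → d * (c * f) ≡ c * (d * f)
          lemma₂ = solve-∀ ℚ-ring
          lemma₃ : ∀ c a f → (1ℚ + c) * (a * f) ≡ a * (c * f + f)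
          lemma₃ = solve-∀ ℚ-ring
          later : ∀ t → d u * (ℕ→ℚ (2 ℕ.+ t) * f (suc t) u) ≡
                        ∑ λ w → A u w * (1ℚ - 𝐞 v w) * (ℕ→ℚ (suc t) * f t w + f t w)
          later t = begin
            d u * (ℕ→ℚ (2 ℕ.+ t) * f (suc t) u)
              ≡⟨ lemma₂ (d u) (ℕ→ℚ (2 ℕ.+ t)) (f (suc t) u) ⟩
            ℕ→ℚ (2 ℕ.+ t) * (d u * f (suc t) u)
              ≡⟨ cong₂ _*_ (ℕ→ℚ-suc (suc t)) (first-step t u) ⟩
            (1ℚ + ℕ→ℚ (suc t)) * ∑ (λ w → A u w * (1ℚ - 𝐞 v w) * f t w)
              ≡⟨ *-∑ (1ℚ + ℕ→ℚ (suc t)) _ ⟩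
            ∑ (λ w → (1ℚ + ℕ→ℚ (suc t)) * (A u w * (1ℚ - 𝐞 v w) * f t w))
              ≡⟨ ∑-cong (λ w → lemma₃ (ℕ→ℚ (suc t)) (A u w * (1ℚ - 𝐞 v w)) (f t w)) ⟩
            ∑ (λ w → A u w * (1ℚ - 𝐞 v w) * (ℕ→ℚ (suc t) * f t w + f t w)) ∎

        X-limit : ∀ w → w ≢ v → Limit (λ N → X N w) 1ℚ
        X-limit w w≢v = Limit-cong {l = 1ℚ} (λ N → sum≡∑ {N} _) (IsMeanFirstPassageTime.finite (mfpt w v w≢v))

        Y-limit : ∀ w → w ≢ v → Limit (λ N → Y N w) (m w v)
        Y-limit w w≢v = Limit-cong {l = m w v} (λ N → sum≡∑ {N} _) (IsMeanFirstPassageTime.mean (mfpt w v w≢v))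

        term-limit : ∀ u w → Limit (λ N → A u w * (1ℚ - 𝐞 v w) * (Y N w + X N w))
                                   (A u w * (1ℚ - 𝐞 v w) * (m w v + 1ℚ))
        term-limit u w with w ≟ v
        ... | no w≢v = Limit-* (A u w * (1ℚ - 0ℚ)) {λ N → Y N w + X N w}
                         (Limit-+ {λ N → Y N w} {λ N → X N w} (Y-limit w w≢v) (X-limit w w≢v))
        -- At w = v the factor 1 - 𝐞 v w vanishes, so the sequences at v itself, of which no limit
        -- is known, do not matter.
        ... | yes _ = Limit-cong {λ _ → A u w * (1ℚ - 1ℚ) * (m w v + 1ℚ)}
                        (λ N → trans (lemma (A u w) (m w v + 1ℚ)) (sym (lemma (A u w) (Y N w + X N w))))
                        (Limit-const (A u w * (1ℚ - 1ℚ) * (m w v + 1ℚ)))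
          where
          lemma : ∀ a y → a * (1ℚ - 1ℚ) * y ≡ 0ℚ
          lemma = solve-∀ ℚ-ring

        -- The two sides are limits of the same sequence, by `Y-step`; in the limit `X N w` becomes
        -- 1, which is where almost sure finiteness enters.
        m-equation : ∀ u → u ≢ v →
          d u * m u v ≡ A u v + ∑ λ w → A u w * (1ℚ - 𝐞 v w) * (m w v + 1ℚ)
        m-equation u u≢v = Limit-unique {λ N → d u * Y (suc N) u}
          (Limit-* (d u) {λ N → Y (suc N) u} (Limit-suc {λ N → Y N u} (Y-limit u u≢v)))
          (Limit-cong (λ N → sym (Y-step N u))
            (Limit-+ {λ _ → A u v} {λ N → ∑ λ w → A u w * (1ℚ - 𝐞 v w) * (Y N w + X N w)}
               (Limit-const (A u v))
               (Limit-∑ (λ w N → A u w * (1ℚ - 𝐞 v w) * (Y N w + X N w)) (term-limit u))))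

        Δh-off : ∀ u → u ≢ v → Δ H (λ w → h w v) u ≡ d u
        Δh-off u u≢v = begin
          Δ H (λ w → h w v) u
            ≡⟨ Δ-expand H (λ w → h w v) u ⟩
          d u * ((1ℚ - 𝐞 v u) * m u v) - S
            ≡⟨ cong (λ e → d u * ((1ℚ - e) * m u v) - S) (𝐞-off u≢v) ⟩
          d u * ((1ℚ - 0ℚ) * m u v) - S
            ≡⟨ lemma₁ (d u) (m u v) S ⟩
          d u * m u v - S
            ≡⟨ cong (_- S) (m-equation u u≢v) ⟩
          A u v + ∑ (λ w → A u w * (1ℚ - 𝐞 v w) * (m w v + 1ℚ)) - S
            ≡⟨ cong (λ s → A u v + s - S) expand ⟩
          A u v + (S + d u - A u v) - S
            ≡⟨ lemma₂ (A u v) S (d u) ⟩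
          d u ∎
          where
          S = ∑ λ w → A u w * h w v
          lemma₁ : ∀ d m s → d * ((1ℚ - 0ℚ) * m) - s ≡ d * m - s
          lemma₁ = solve-∀ ℚ-ring
          lemma₂ : ∀ a s d → a + (s + d - a) - s ≡ d
          lemma₂ = solve-∀ ℚ-ring
          lemma₃ : ∀ a e m → a * (1ℚ - e) * (m + 1ℚ) ≡ a * ((1ℚ - e) * m) + a - a * e
          lemma₃ = solve-∀ ℚ-ring
          expand : ∑ (λ w → A u w * (1ℚ - 𝐞 v w) * (m w v + 1ℚ)) ≡ S + d u - A u v
          expand = begin
            ∑ (λ w → A u w * (1ℚ - 𝐞 v w) * (m w v + 1ℚ))
              ≡⟨ ∑-cong (λ w → lemma₃ (A u w) (𝐞 v w) (m w v)) ⟩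
            ∑ (λ w → A u w * h w v + A u w - A u w * 𝐞 v w)
              ≡⟨ ∑-- _ _ ⟩
            ∑ (λ w → A u w * h w v + A u w) - ∑ (λ w → A u w * 𝐞 v w)
              ≡⟨ cong₂ _-_ (∑-+ _ _) (·𝐞 v (A u)) ⟩
            S + ∑ (A u) - A u v
              ≡⟨ cong (λ x → S + x - A u v) (𝐝-sum H u) ⟨
            S + d u - A u v ∎

    hitting-diag : ∀ v → h v v ≡ 0ℚ
    hitting-diag v = trans (cong (λ e → (1ℚ - e) * m v v) (𝐞-diag v)) (ℚₚ.*-zeroˡ (m v v))

    -- Away from v this is the first-step equation. At v that equation would speak of the return
    -- time; but a Laplacian sums to 0 while the degrees sum to D, which forces the missing value to
    -- be d v - D.
    hitting-Δ : ∀ v u → Δ H (λ w → h w v) u ≡ d u - D * 𝐞 v u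
    hitting-Δ v u = split (u ≟ v)
      where
      Δh : Vector n
      Δh = Δ H (λ w → h w v)
      others : ∀ w → w ≢ v → Δh w - d w ≡ 0ℚ
      others w w≢v = trans (cong (_- d w) (Δh-off v w w≢v)) (ℚₚ.+-inverseʳ (d w))
      lemma₁ : ∀ a b → a ≡ b + (a - b)
      lemma₁ = solve-∀ ℚ-ring
      lemma₂ : ∀ a b → a + (0ℚ - b) ≡ a - b * 1ℚ
      lemma₂ = solve-∀ ℚ-ring
      lemma₃ : ∀ a b → a ≡ a - b * 0ℚ
      lemma₃ = solve-∀ ℚ-ring
      split : Dec (u ≡ v) → Δh u ≡ d u - D * 𝐞 v u
      split (no u≢v) = begin
        Δh u              ≡⟨ Δh-off v u u≢v ⟩
        d u               ≡⟨ lemma₃ (d u) D ⟩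
        d u - D * 0ℚ      ≡⟨ cong (λ e → d u - D * e) (𝐞-off u≢v) ⟨
        d u - D * 𝐞 v u   ∎
      split (yes refl) = begin
        Δh u                              ≡⟨ lemma₁ (Δh u) (d u) ⟩
        d u + (Δh u - d u)                ≡⟨ cong (d u +_) (∑-only (λ w → Δh w - d w) u others) ⟨
        d u + ∑ (λ w → Δh w - d w)        ≡⟨ cong (d u +_)
          (trans (∑-- Δh d) (cong (_- D) (ΣΔ≡0 H (λ w → h w v)))) ⟩
        d u + (0ℚ - D)                    ≡⟨ lemma₂ (d u) D ⟩
        d u - D * 1ℚ                      ≡⟨ cong (λ e → d u - D * e) (𝐞-diag u) ⟨
        d u - D * 𝐞 u u                   ∎

  -- The interface between the random walk and the linear algebra: the hitting times as solutions of
  -- Poisson equations, and κ with the stationary distribution cleared.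
  record HittingTimes (κ : ℚ) : Set where
    field
      h      : Matrix n
      h-diag : ∀ v → h v v ≡ 0ℚ
      h-Δ    : ∀ v u → Δ H (λ w → h w v) u ≡ d u - D * 𝐞 v u
      start  : Fin n
      kemeny : D * κ ≡ ∑ λ v → d v * h start v

  hitting-times : ∀ {κ} → IsKemenyConstant H κ → HittingTimes κ
  hitting-times {κ} K = record
    { h = λ u v → (1ℚ - 𝐞 v u) * m u v
    ; h-diag = hitting-diag m m-mfpt
    ; h-Δ = hitting-Δ m m-mfpt
    ; start = start
    ; kemeny = begin
        D * κ
          ≡⟨ cong (D *_) (trans value (trans (sum≡∑ _)
            (∑-cong λ j → when-⟦⟧ (¬? (j ≟ start)) _ _ λ _ → refl))) ⟩
        D * ∑ (λ j → ⟦ ¬? (j ≟ start) ⟧ * (stationary H j * m start j))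
          ≡⟨ *-∑ D _ ⟩
        ∑ (λ j → D * (⟦ ¬? (j ≟ start) ⟧ * (stationary H j * m start j)))
          ≡⟨ ∑-cong (λ j → trans (lemma D ⟦ ¬? (j ≟ start) ⟧ (stationary H j) (m start j))
               (cong₂ (λ a e → a * (e * m start j)) (vol-stationary j)
                  (trans (⟦≢⟧ start j) (cong (1ℚ -_) (𝐞-sym start j))))) ⟩
        ∑ (λ j → d j * ((1ℚ - 𝐞 j start) * m start j)) ∎
    }
    where
    open IsKemenyConstant K
    lemma : ∀ D o s m → D * (o * (s * m)) ≡ D * s * (o * m)
    lemma = solve-∀ ℚ-ring

  module _ (conn : Connected H) {R : Matrix n} (isR : IsResistance H R)
           {h : Matrix n} (h-diag : ∀ v → h v v ≡ 0ℚ)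
           (h-Δ : ∀ v u → Δ H (λ w → h w v) u ≡ d u - D * 𝐞 v u) (s : Fin n) where

    private
      open IsResistance isR

      K′ Rd : Vector n
      K′ u = ∑ λ v → d v * h u v
      Rd u = ∑ λ v → R u v * d v

      -- The point masses at v of the two Laplacians cancel, so all columns have the same Laplacian
      -- and differ by constants. Evaluating at v, where h and R vanish, identifies the constants.
      g : Fin n → Vector n
      g v u = 2ℚ * h u v - D * R u v

      α : Vector n
      α = g s

      dα : ℚ
      dα = ∑ λ u → d u * α u

      lemma₁ : ∀ d D e t → 2ℚ * (d - D * e) - D * (t - 2ℚ * e) ≡ 2ℚ * d - D * t
      lemma₁ = solve-∀ ℚ-ring

      Δg : ∀ v u → Δ H (g v) u ≡ 2ℚ * d u - D * τ u
      Δg v u = begin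
        Δ H (g v) u
          ≡⟨ Δ-- H (λ w → 2ℚ * h w v) (λ w → D * R w v) u ⟩
        Δ H (λ w → 2ℚ * h w v) u - Δ H (λ w → D * R w v) u
          ≡⟨ cong₂ _-_ (Δ-* H 2ℚ (λ w → h w v) u) (Δ-* H D (λ w → R w v) u) ⟩
        2ℚ * Δ H (λ w → h w v) u - D * Δ H (λ w → R w v) u
          ≡⟨ cong₂ (λ a b → 2ℚ * a - D * b) (h-Δ v u) (potential v u) ⟩
        2ℚ * (d u - D * 𝐞 v u) - D * (τ u - 2ℚ * 𝐞 v u)
          ≡⟨ lemma₁ (d u) D (𝐞 v u) (τ u) ⟩
        2ℚ * d u - D * τ u ∎

      2h : ∀ u v → 2ℚ * h u v ≡ D * R u v + α u - α v
      2h u v = begin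
        2ℚ * h u v                          ≡⟨ l₁ (2ℚ * h u v) (D * R u v) (α u) ⟩
        D * R u v + α u + (g v u - α u)     ≡⟨ cong (D * R u v + α u +_)
          (Δ-unique H conn (g v) α (λ w → trans (Δg v w) (sym (Δg s w))) u v) ⟩
        D * R u v + α u + (g v v - α v)     ≡⟨ cong₂ (λ a b → D * R u v + α u + (2ℚ * a - D * b - α v))
          (h-diag v) (diag v) ⟩
        D * R u v + α u + (2ℚ * 0ℚ - D * 0ℚ - α v) ≡⟨ l₂ (D * R u v) (α u) (α v) D ⟩
        D * R u v + α u - α v ∎
        where
        l₁ : ∀ x y a → x ≡ y + a + (x - y - a)
        l₁ = solve-∀ ℚ-ring
        l₂ : ∀ x a b D → x + a + (2ℚ * 0ℚ - D * 0ℚ - b) ≡ x + a - b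
        l₂ = solve-∀ ℚ-ring

      2K′ : ∀ u → 2ℚ * K′ u ≡ D * Rd u + D * α u - dα
      2K′ u = begin
        2ℚ * K′ u
          ≡⟨ *-∑ 2ℚ _ ⟩
        ∑ (λ v → 2ℚ * (d v * h u v))
          ≡⟨ ∑-cong (λ v → trans (l₁ (d v) (h u v))
            (trans (cong (d v *_) (2h u v)) (l₂ (d v) D (R u v) (α u) (α v)))) ⟩
        ∑ (λ v → D * (R u v * d v) + d v * α u - d v * α v)
          ≡⟨ trans (∑-- _ _) (cong (_- dα) (∑-+ _ _)) ⟩
        ∑ (λ v → D * (R u v * d v)) + ∑ (λ v → d v * α u) - dα
          ≡⟨ cong₂ (λ a b → a + b - dα) (*-∑ D _) (∑-* (α u) d) ⟨
        D * Rd u + D * α u - dα ∎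
        where
        l₁ : ∀ d h → 2ℚ * (d * h) ≡ d * (2ℚ * h)
        l₁ = solve-∀ ℚ-ring
        l₂ : ∀ d D r a b → d * (D * r + a - b) ≡ D * (r * d) + d * a - d * b
        l₂ = solve-∀ ℚ-ring

      -- The random target lemma: weighting the equations for targets v by d v turns the sources d u
      -- - D 𝐞 v u into D d u - D d u.
      K′-const : ∀ u v → K′ u ≡ K′ v
      K′-const = harmonic⇒const H conn K′ λ u → begin
        Δ H K′ u
          ≡⟨ Δ-sum H (λ v w → d v * h w v) u ⟩
        ∑ (λ v → Δ H (λ w → d v * h w v) u)
          ≡⟨ ∑-cong (λ v → trans (Δ-* H (d v) (λ w → h w v) u)
            (trans (cong (d v *_) (h-Δ v u)) (l₁ (d v) (d u) D (𝐞 v u)))) ⟩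
        ∑ (λ v → d v * d u - D * (d v * 𝐞 v u))
          ≡⟨ ∑-- _ _ ⟩
        ∑ (λ v → d v * d u) - ∑ (λ v → D * (d v * 𝐞 v u))
          ≡⟨ cong₂ _-_ (∑-* (d u) d) (*-∑ D _) ⟨
        D * d u - D * ∑ (λ v → d v * 𝐞 v u)
          ≡⟨ cong (λ x → D * d u - D * x) (trans (∑-cong λ v → cong (d v *_) (𝐞-sym v u)) (·𝐞 u d)) ⟩
        D * d u - D * d u
          ≡⟨ ℚₚ.+-inverseʳ (D * d u) ⟩
        0ℚ ∎
        where
        l₁ : ∀ a b D e → a * (b - D * e) ≡ a * b - D * (a * e)
        l₁ = solve-∀ ℚ-ring

    -- 2 h u v and vol R u v have, as functions of u, Laplacians whose difference
    -- is independent of v; so they differ by α u − α v for some α.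
    hitting-resistance : D * (2ℚ * ∑ λ v → d v * h s v) ≡ D * ∑ λ u → d u * ∑ λ v → R u v * d v
    hitting-resistance = begin
      D * (2ℚ * K′ s)
        ≡⟨ ∑-* (2ℚ * K′ s) d ⟩
      ∑ (λ u → d u * (2ℚ * K′ s))
        -- The start may vary with u, so both arguments are now averaged with the degrees. This
        -- makes α u and -α v contribute `D * dα` with opposite signs.
        ≡⟨ ∑-cong (λ u → cong (λ x → d u * (2ℚ * x)) (K′-const s u)) ⟩
      ∑ (λ u → d u * (2ℚ * K′ u))
        ≡⟨ ∑-cong (λ u → cong (d u *_) (2K′ u)) ⟩
      ∑ (λ u → d u * (D * Rd u + D * α u - dα))
        ≡⟨ ∑-cong (λ u → lemma₃ (d u) D (Rd u) (α u) dα) ⟩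
      ∑ (λ u → D * (d u * Rd u) + D * (d u * α u) - d u * dα)
        ≡⟨ trans (∑-- _ _) (cong (_- ∑ (λ u → d u * dα)) (∑-+ _ _)) ⟩
      ∑ (λ u → D * (d u * Rd u)) + ∑ (λ u → D * (d u * α u)) - ∑ (λ u → d u * dα)
        ≡⟨ cong₂ _-_ (cong₂ _+_ (sym (*-∑ D _)) (sym (*-∑ D _))) (sym (∑-* dα d)) ⟩
      D * ∑ (λ u → d u * Rd u) + D * dα - D * dα
        ≡⟨ lemma₄ (D * ∑ (λ u → d u * Rd u)) (D * dα) ⟩
      D * ∑ (λ u → d u * Rd u) ∎
      where
      lemma₃ : ∀ d D r a x → d * (D * r + D * a - x) ≡ D * (d * r) + D * (d * a) - d * x
      lemma₃ = solve-∀ ℚ-ring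
      lemma₄ : ∀ a b → a + b - b ≡ a
      lemma₄ = solve-∀ ℚ-ring

  kemeny-resistance : Connected H → ∀ {κ} → IsKemenyConstant H κ → ∀ {R} → IsResistance H R →
    2ℚ * (D * κ) ≡ ∑ λ u → d u * ∑ λ v → R u v * d v
  kemeny-resistance conn {κ} K {R} isR = split (D ℚₚ.≟ 0ℚ) (hitting-times K)
    where
    dRd : ℚ
    dRd = ∑ λ u → d u * ∑ λ v → R u v * d v

    lemma : ∀ κ → 2ℚ * (0ℚ * κ) ≡ 0ℚ
    lemma = solve-∀ ℚ-ring

    split : Dec (D ≡ 0ℚ) → HittingTimes κ → 2ℚ * (D * κ) ≡ dRd
    -- The case of a single vertex: D cannot be cancelled, but both sides are 0.
    split (yes D≡0) _ = begin
      2ℚ * (D * κ)   ≡⟨ cong (λ D → 2ℚ * (D * κ)) D≡0 ⟩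
      2ℚ * (0ℚ * κ)  ≡⟨ lemma κ ⟩
      0ℚ             ≡⟨ ∑-0 _ (λ u → trans (cong (_* ∑ (λ v → R u v * d v)) (vol≡0⇒𝐝≡0 D≡0 u))
        (ℚₚ.*-zeroˡ (∑ (λ v → R u v * d v)))) ⟨
      dRd            ∎
    split (no D≢0) times = *-cancelˡ D D≢0
      (trans (cong (λ x → D * (2ℚ * x)) kemeny) (hitting-resistance conn isR {h} h-diag h-Δ start))
      where open HittingTimes times

-- Branches of a tree

module _ (H : Graph n) {x y : Fin n} where

  removeEdge⁻ : ∀ {u v} → Adj (removeEdge H x y) u v →
                Adj H u v × ¬ (u ≡ x × v ≡ y) × ¬ (v ≡ x × u ≡ y)
  removeEdge⁻ {u} {v} e with adj H u v
  ... | true with u ≟ x | v ≟ y | v ≟ x | u ≟ y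
  ... | no u≢x  | _      | no v≢x | _       = _ , u≢x ∘ proj₁ , v≢x ∘ proj₁
  ... | no u≢x  | _      | yes _  | no u≢y  = _ , u≢x ∘ proj₁ , u≢y ∘ proj₂
  ... | yes _   | no v≢y | no v≢x | _       = _ , v≢y ∘ proj₂ , v≢x ∘ proj₁
  ... | yes _   | no v≢y | yes _  | no u≢y  = _ , v≢y ∘ proj₂ , u≢y ∘ proj₂

  removeEdge⁺ : ∀ {u v} → Adj H u v → ¬ (u ≡ x × v ≡ y) → ¬ (v ≡ x × u ≡ y) →
                Adj (removeEdge H x y) u v
  removeEdge⁺ {u} {v} e ¬p ¬q with adj H u v
  ... | true with u ≟ x | v ≟ y | v ≟ x | u ≟ y
  ... | yes p | yes q | _     | _     = ¬p (p , q)
  ... | no _  | _     | yes p | yes q = ¬q (p , q)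
  ... | yes _ | no _  | yes p | yes q = ¬q (p , q)
  ... | no _  | _     | no _  | _     = _
  ... | no _  | _     | yes _ | no _  = _
  ... | yes _ | no _  | no _  | _     = _
  ... | yes _ | no _  | yes _ | no _  = _

removeEdge-comm : ∀ (H : Graph n) {x y u v} →
                  Adj (removeEdge H x y) u v → Adj (removeEdge H y x) u v
removeEdge-comm H e with removeEdge⁻ H e
... | e′ , ¬p , ¬q = removeEdge⁺ H e′ (λ (p , q) → ¬q (q , p)) (λ (p , q) → ¬p (q , p))

Reachable-sym : ∀ (H : Graph n) {u v} → Reachable H u v → Reachable H v u
Reachable-sym H = reverse λ {u} {v} → flip H {u} {v}

invariant : ∀ {H : Graph n} (P : Fin n → Set) → (∀ {u v} → Adj H u v → P u → P v) →
            ∀ {u v} → Reachable H u v → P u → P v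
invariant P step ε       p = p
invariant {H = H} P step (e ◅ w) p = invariant {H = H} P step w (step e p)

-- Given as an injective function on an initial segment, the format in which `IsCycle` expects its
-- vertices.
record SimplePath (H : Graph n) (x y : Fin n) : Set where
  constructor simplePath
  field
    length    : ℕ
    vertex    : Fin (suc length) → Fin n
    injective : Injective _≡_ _≡_ vertex
    starts    : vertex zero ≡ x
    ends      : vertex (fromℕ length) ≡ y
    step      : ∀ a → Adj H (vertex (inject₁ a)) (vertex (suc a))

module _ {H : Graph n} where

  suffix : ∀ {x y} (p : SimplePath H x y) a → SimplePath H (SimplePath.vertex p a) y
  suffix (simplePath l c inj _ c≡y s) zero = simplePath l c inj refl c≡y s
  suffix (simplePath (suc l) c inj _ c≡y s) (suc a) =
    suffix (simplePath l (c ∘ suc) (λ eq → suc-injective (inj eq)) refl c≡y (s ∘ suc)) a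

  -- Loop erasure: if the vertex to be prepended already lies on the path, everything before that
  -- occurrence is dropped.
  simplify : ∀ {x y} → Reachable H x y → SimplePath H x y
  simplify {x} ε = simplePath 0 (λ _ → x) (λ { {zero} {zero} _ → refl }) refl refl λ ()
  simplify {x} (_◅_ {j = z} e w) with simplify w
  ... | p@(simplePath l c inj c≡z c≡y s) with any? (λ a → c a ≟ x)
  ... | yes (a , c≡x) = subst (λ v → SimplePath H v _) c≡x (suffix p a)
  ... | no  x∉c = simplePath (suc l) c′ inj′ refl c≡y s′
    where
    c′ : Fin (suc (suc l)) → Fin n
    c′ zero    = x
    c′ (suc a) = c a
    inj′ : Injective _≡_ _≡_ c′
    inj′ {zero}  {zero}  _  = refl
    inj′ {zero}  {suc b} eq = contradiction (b , sym eq) x∉c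
    inj′ {suc a} {zero}  eq = contradiction (a , eq) x∉c
    inj′ {suc a} {suc b} eq = cong suc (inj eq)
    s′ : ∀ a → Adj H (c′ (inject₁ a)) (c′ (suc a))
    s′ zero    = subst (Adj H x) (sym c≡z) e
    s′ (suc a) = s a

module Tree (𝒯 : Graph k) (isTree : IsTree 𝒯) where

  open IsTree isTree

  -- l lies on the b-side of the edge a ∼ b.
  Beyond : (a b l : Fin k) → Set
  Beyond a b l = Reachable (removeEdge 𝒯 a b) b l

  -- A simple path from b to a avoiding the edge a ∼ b closes up with that edge to a cycle. Length 0
  -- would make the edge a loop and length 1 would be the removed edge, so the cycle has at least
  -- three vertices.
  bridge : ∀ {a b} → Adj 𝒯 a b → ¬ Beyond a b a
  bridge {a} {b} e w with simplify {H = removeEdge 𝒯 a b} w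
  ... | simplePath 0 c inj c≡b c≡a s =
    subst T (adj-irr 𝒯 b) (subst (λ v → Adj 𝒯 v b) (trans (sym c≡a) c≡b) e)
  ... | simplePath 1 c inj c≡b c≡a s =
    proj₂ (proj₂ (removeEdge⁻ 𝒯 (s zero))) (c≡a , c≡b)
  ... | simplePath (suc (suc l)) c inj c≡b c≡a s = acyclic l c
    ( inj
    , (λ x → proj₁ (removeEdge⁻ 𝒯 (s x)))
    , subst₂ (Adj 𝒯) (sym c≡a) (sym c≡b) e)

  not-beyond-both : ∀ {a b l} → Adj 𝒯 a b → Beyond a b l → ¬ Beyond b a l
  not-beyond-both {a} {b} e p q = bridge e
    (p ◅◅ Reachable-sym (removeEdge 𝒯 a b) (gmap id (removeEdge-comm 𝒯) q))

  beyond-step : ∀ {a b l l′} → Adj 𝒯 l l′ → ¬ (l ≡ a × l′ ≡ b) → ¬ (l′ ≡ a × l ≡ b) →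
                Beyond a b l → Beyond a b l′
  beyond-step e ¬p ¬q w = w ◅◅ (removeEdge⁺ 𝒯 e ¬p ¬q ◅ ε)

  beyond-either : ∀ a b l → Beyond a b l ⊎ Beyond b a l
  beyond-either a b l =
    invariant {H = 𝒯} (λ l → Beyond a b l ⊎ Beyond b a l) next (Connected.reachable connected a l) (inj₂ ε)
    where
    next : ∀ {l l₁} → Adj 𝒯 l l₁ → Beyond a b l ⊎ Beyond b a l → Beyond a b l₁ ⊎ Beyond b a l₁
    next {l₁ = l₁} e s with l₁ ≟ a | l₁ ≟ b
    ... | yes refl | _        = inj₂ ε
    ... | no _     | yes refl = inj₁ ε
    next e (inj₁ p) | no l₁≢a | no l₁≢b = inj₁ (beyond-step e (l₁≢b ∘ proj₂) (l₁≢a ∘ proj₁) p)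
    next e (inj₂ p) | no l₁≢a | no l₁≢b = inj₂ (beyond-step e (l₁≢a ∘ proj₂) (l₁≢b ∘ proj₁) p)

  -- Follow a walk from i to l: each departure from i selects the neighbour stepped to, and as long
  -- as the walk stays off i it remains in that branch.
  toward : ∀ i l → l ≢ i → ∃[ j ] Adj 𝒯 i j × Beyond i j l
  toward i l l≢i with invariant {H = 𝒯} Q next (Connected.reachable connected i l) (inj₁ refl)
    where
    Q : Fin k → Set
    Q l = l ≡ i ⊎ ∃[ j ] Adj 𝒯 i j × Beyond i j l
    next : ∀ {l l₁} → Adj 𝒯 l l₁ → Q l → Q l₁
    next {l} {l₁} e q with l₁ ≟ i
    ... | yes l₁≡i = inj₁ l₁≡i
    next {l} {l₁} e (inj₁ refl)         | no _    = inj₂ (l₁ , e , ε)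
    next {l} {l₁} e (inj₂ (j , e′ , p)) | no l₁≢i = inj₂ (j , e′ , beyond-step e
      (λ (l≡i , _) → bridge e′ (subst (Beyond i j) l≡i p)) (l₁≢i ∘ proj₁) p)
  ... | inj₁ l≡i = contradiction l≡i l≢i
  ... | inj₂ r   = r

  -- If j and j′ differed, going from j′ to l, retracing the walk from l to j and crossing j ∼ i
  -- would reach i without the edge i ∼ j′.
  toward-unique : ∀ {i j j′ l} → Adj 𝒯 i j → Adj 𝒯 i j′ → Beyond i j l → Beyond i j′ l → j ≡ j′
  toward-unique {i} {j} {j′} {l} e e′ p q with j ≟ j′
  ... | yes j≡j′ = j≡j′
  ... | no  j≢j′ = contradiction
    (beyond-step (flip 𝒯 e) (λ (j≡i , _) → irr j≡i) (λ (_ , j≡j′) → j≢j′ j≡j′) (back ε p q)) (bridge e′)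
    where
    irr : j ≢ i
    irr refl = subst T (adj-irr 𝒯 j) e
    -- The walk avoids i, so it does not use the edge i ∼ j′.
    back : ∀ {x y} → Beyond i j x → Reachable (removeEdge 𝒯 i j) x y → Beyond i j′ y → Beyond i j′ x
    back b ε q = q
    back b (_◅_ {x} {z} e₁ w) q = beyond-step (flip 𝒯 (proj₁ (removeEdge⁻ 𝒯 e₁)))
      (λ { (refl , _) → bridge e b′ }) (λ { (refl , _) → bridge e b }) (back b′ w q)
      where b′ = b ◅◅ (e₁ ◅ ε)

-- Sums over neighbours and over edges

module _ (H : Graph n) (i : Fin n) where

  ∑N : (∀ j → Adj H i j → ℚ) → ℚ
  ∑N f = ∑ λ j → when (adj? H i j) (f j)

  ∑N-cong : ∀ {f g : ∀ j → Adj H i j → ℚ} → (∀ j e → f j e ≡ g j e) → ∑N f ≡ ∑N g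
  ∑N-cong {f} {g} f≗g = ∑-cong term
    where
    term : ∀ j → when (adj? H i j) (f j) ≡ when (adj? H i j) (g j)
    term j with adj? H i j
    ... | yes e = f≗g j e
    ... | no _  = refl

  ∑N-+ : ∀ (f g : ∀ j → Adj H i j → ℚ) → ∑N (λ j e → f j e + g j e) ≡ ∑N f + ∑N g
  ∑N-+ f g = trans (∑-cong term) (∑-+ _ _)
    where
    term : ∀ j → when (adj? H i j) (λ e → f j e + g j e) ≡ when (adj? H i j) (f j) + when (adj? H i j) (g j)
    term j with adj? H i j
    ... | yes e = refl
    ... | no _  = refl

  *-∑N : ∀ c (f : ∀ j → Adj H i j → ℚ) → c * ∑N f ≡ ∑N (λ j e → c * f j e)
  *-∑N c f = trans (*-∑ c _) (∑-cong term)
    where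
    term : ∀ j → c * when (adj? H i j) (f j) ≡ when (adj? H i j) (λ e → c * f j e)
    term j with adj? H i j
    ... | yes e = refl
    ... | no _  = ℚₚ.*-zeroʳ c

  ∑N-* : ∀ c (f : ∀ j → Adj H i j → ℚ) → ∑N f * c ≡ ∑N (λ j e → f j e * c)
  ∑N-* c f = trans (ℚₚ.*-comm _ c) (trans (*-∑N c f) (∑N-cong λ j e → ℚₚ.*-comm c (f j e)))

  ∑N-- : ∀ (f g : ∀ j → Adj H i j → ℚ) → ∑N (λ j e → f j e - g j e) ≡ ∑N f - ∑N g
  ∑N-- f g = trans (∑-cong term) (∑-- _ _)
    where
    term : ∀ j → when (adj? H i j) (λ e → f j e - g j e) ≡ when (adj? H i j) (f j) - when (adj? H i j) (g j)
    term j with adj? H i j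
    ... | yes e = refl
    ... | no _  = refl

  ∑N-0 : ∀ (f : ∀ j → Adj H i j → ℚ) → (∀ j e → f j e ≡ 0ℚ) → ∑N f ≡ 0ℚ
  ∑N-0 f f≡0 = ∑-0 _ term
    where
    term : ∀ j → when (adj? H i j) (f j) ≡ 0ℚ
    term j with adj? H i j
    ... | yes e = f≡0 j e
    ... | no _  = refl

  ∑N-only : ∀ (f : ∀ j → Adj H i j → ℚ) j e → (∀ j′ e′ → j′ ≢ j → f j′ e′ ≡ 0ℚ) → ∑N f ≡ f j e
  ∑N-only f j e f≡0 = trans (∑-only _ j others) self
    where
    others : ∀ j′ → j′ ≢ j → when (adj? H i j′) (f j′) ≡ 0ℚ
    others j′ j′≢j with adj? H i j′
    ... | yes e′ = f≡0 j′ e′ j′≢j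
    ... | no _   = refl
    self : when (adj? H i j) (f j) ≡ f j e
    self with adj? H i j
    ... | yes e′ = cong (f j) (T-irrelevant e′ e)
    ... | no ¬e  = contradiction e ¬e

  ∑-∑N-swap : ∀ {m} (f : Fin m → ∀ j → Adj H i j → ℚ) →
              ∑ (λ a → ∑N (f a)) ≡ ∑N λ j e → ∑ λ a → f a j e
  ∑-∑N-swap f = trans (∑-swap λ a j → when (adj? H i j) (f a j)) (∑-cong term)
    where
    term : ∀ j → ∑ (λ a → when (adj? H i j) (f a j)) ≡ when (adj? H i j) (λ e → ∑ λ a → f a j e)
    term j with adj? H i j
    ... | yes e = refl
    ... | no _  = ∑-0 _ λ _ → refl

  sumNeighbours≡∑N : ∀ f → sumNeighbours H i f ≡ ∑N f
  sumNeighbours≡∑N f = sum≡∑ _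

module _ (H : Graph n) where

  -- Regroups a sum over bridges with one term for each end into a sum over pieces of their own
  -- bridge ends, so that it can be matched piece by piece.
  sumEdges≡∑∑N : ∀ (f : ∀ i j → Adj H i j → ℚ) →
    sumEdges H (λ i j e → f i j e + f j i (flip H e)) ≡ ∑ λ i → ∑N H i (f i)
  sumEdges≡∑∑N f = begin
    sumEdges H (λ i j e → f i j e + f j i (flip H e))
      ≡⟨ trans (sum≡∑ _) (∑-cong λ i → trans (sum≡∑ _) (∑-cong (term i))) ⟩
    ∑ (λ i → ∑ λ j → ⟦ i <? j ⟧ * (F i j + F j i))
      ≡⟨ ∑-oriented F F-irr ⟨
    ∑ (λ i → ∑N H i (f i)) ∎
    where
    F : Matrix n
    F i j = when (adj? H i j) (f i j)
    F-irr : ∀ i → F i i ≡ 0ℚ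
    F-irr i with adj? H i i
    ... | yes e = contradiction (subst T (adj-irr H i) e) λ ()
    ... | no _  = refl
    term : ∀ i j → when (i <? j ×-dec adj? H i j) (λ (_ , e) → f i j e + f j i (flip H e)) ≡
                   ⟦ i <? j ⟧ * (F i j + F j i)
    term i j = go (i <? j) (adj? H i j) (adj? H j i)
      where
      go : (l : Dec (i Fin.< j)) (a : Dec (Adj H i j)) (b : Dec (Adj H j i)) →
           when (l ×-dec a) (λ (_ , e) → f i j e + f j i (flip H e)) ≡
           ⟦ l ⟧ * (when a (f i j) + when b (f j i))
      go (yes _) (yes e) (yes e′) = trans (cong (λ e″ → f i j e + f j i e″) (T-irrelevant _ e′))
        (sym (ℚₚ.*-identityˡ (f i j e + f j i e′)))
      go (yes _) (no _)  (no _)   = refl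
      go (no _)  (yes e) (yes e′) = sym (ℚₚ.*-zeroˡ (f i j e + f j i e′))
      go (no _)  (no _)  (no _)   = refl
      go _       (yes e) (no ¬e)  = contradiction (flip H e) ¬e
      go _       (no ¬e) (yes e)  = contradiction (flip H e) ¬e

-- Degree sums over a component

module _ (H : Graph n) (x : Fin n) where

  private
    χ : Vector n
    χ u = ⟦ reachable? H x u ⟧
    A = 𝐚 H

  -- The handshake lemma for a component. As the component is closed under adjacency, asking both
  -- ends of an edge to lie in it is the same as asking this of one end.
  componentEdges-degrees : 2ℚ * ℕ→ℚ (componentEdges H x) ≡ ∑ λ u → χ u * 𝐝 H u
  componentEdges-degrees = begin
    2ℚ * ℕ→ℚ (componentEdges H x)
      ≡⟨ trans (cong (2ℚ *_) (trans (ℕ→ℚ-sum _) (∑-cong λ u → ℕ→ℚ-sum _)))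
           (trans (*-∑ 2ℚ _) (∑-cong λ u → *-∑ 2ℚ _)) ⟩
    ∑ (λ u → ∑ λ v → 2ℚ * ⟦ u <? v ×-dec adj? H u v ×-dec reachable? H x u ×-dec reachable? H x v ⟧)
      ≡⟨ ∑-cong (λ u → ∑-cong (term u)) ⟩
    ∑ (λ u → ∑ λ v → ⟦ u <? v ⟧ * (F u v + F v u))
      ≡⟨ ∑-oriented F F-irr ⟨
    ∑ (λ u → ∑ (F u))
      ≡⟨ ∑-cong (λ u → trans (∑-cong (closed u))
        (trans (sym (*-∑ (χ u) (A u))) (cong (χ u *_) (sym (𝐝-sum H u))))) ⟩
    ∑ (λ u → χ u * 𝐝 H u) ∎
    where
    F : Matrix n
    F u v = A u v * (χ u * χ v)
    F-irr : ∀ u → F u u ≡ 0ℚ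
    F-irr u = trans (cong (_* (χ u * χ u)) (𝐚-irr H u)) (ℚₚ.*-zeroˡ (χ u * χ u))
    lemma : ∀ l a b c → 2ℚ * (l * (a * (b * c))) ≡ l * (a * (b * c) + a * (c * b))
    lemma = solve-∀ ℚ-ring
    term : ∀ u v → 2ℚ * ⟦ u <? v ×-dec adj? H u v ×-dec reachable? H x u ×-dec reachable? H x v ⟧ ≡
                   ⟦ u <? v ⟧ * (F u v + F v u)
    term u v = begin
      2ℚ * ⟦ u <? v ×-dec adj? H u v ×-dec reachable? H x u ×-dec reachable? H x v ⟧
        ≡⟨ cong (2ℚ *_) (trans (⟦⟧-× (u <? v) (adj? H u v ×-dec reachable? H x u ×-dec reachable? H x v))
          (cong (⟦ u <? v ⟧ *_) (trans (⟦⟧-× (adj? H u v) (reachable? H x u ×-dec reachable? H x v))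
            (cong (A u v *_) (⟦⟧-× (reachable? H x u) (reachable? H x v)))))) ⟩
      2ℚ * (⟦ u <? v ⟧ * (A u v * (χ u * χ v)))
        ≡⟨ lemma ⟦ u <? v ⟧ (A u v) (χ u) (χ v) ⟩
      ⟦ u <? v ⟧ * (F u v + A u v * (χ v * χ u))
        ≡⟨ cong (λ a → ⟦ u <? v ⟧ * (F u v + a * (χ v * χ u))) (𝐚-sym H u v) ⟩
      ⟦ u <? v ⟧ * (F u v + F v u) ∎
    closed : ∀ u v → F u v ≡ χ u * A u v
    closed u v = go (reachable? H x u) (adj? H u v) (reachable? H x v)
      where
      go : (p : Dec (Reachable H x u)) (a : Dec (Adj H u v)) (q : Dec (Reachable H x v)) →
           ⟦ a ⟧ * (⟦ p ⟧ * ⟦ q ⟧) ≡ ⟦ p ⟧ * ⟦ a ⟧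
      go (yes p) (yes a) (yes q) = refl
      go (yes p) (yes a) (no ¬q) = contradiction (p ◅◅ (a ◅ ε)) ¬q
      go (yes p) (no _)  (yes _) = refl
      go (yes p) (no _)  (no _)  = refl
      go (no _)  (yes _) (yes _) = refl
      go (no _)  (yes _) (no _)  = refl
      go (no _)  (no _)  (yes _) = refl
      go (no _)  (no _)  (no _)  = refl

module _ (G : Graph n) {x y : Fin n} (e : Adj G x y) where

  private H = removeEdge G x y

  𝐝-removeEdge : ∀ u → 𝐝 G u ≡ 𝐝 H u + 𝐞 x u + 𝐞 y u
  𝐝-removeEdge u = begin
    𝐝 G u
      ≡⟨ 𝐝-sum G u ⟩
    ∑ (𝐚 G u)
      ≡⟨ ∑-cong (λ v → trans (entry v (adj? G u v) (adj? H u v) (u ≟ x ×-dec v ≟ y) (u ≟ y ×-dec v ≟ x))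
           (cong₂ (λ p q → 𝐚 H u v + p + q) (⟦⟧-× (u ≟ x) (v ≟ y)) (⟦⟧-× (u ≟ y) (v ≟ x)))) ⟩
    ∑ (λ v → 𝐚 H u v + 𝐞 x u * 𝐞 y v + 𝐞 y u * 𝐞 x v)
      ≡⟨ trans (∑-+ _ _) (cong₂ _+_ (∑-+ _ _) (point (𝐞 y u) x)) ⟩
    ∑ (𝐚 H u) + ∑ (λ v → 𝐞 x u * 𝐞 y v) + 𝐞 y u
      ≡⟨ cong₂ (λ a b → a + b + 𝐞 y u) (sym (𝐝-sum H u)) (point (𝐞 x u) y) ⟩
    𝐝 H u + 𝐞 x u + 𝐞 y u ∎
    where
    point : ∀ c v → ∑ (λ w → c * 𝐞 v w) ≡ c
    point c v = ·𝐞 v (λ _ → c)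
    x≢y : x ≢ y
    x≢y refl = subst T (adj-irr G x) e
    entry : ∀ v (a : Dec (Adj G u v)) (b : Dec (Adj H u v))
            (p : Dec (u ≡ x × v ≡ y)) (q : Dec (u ≡ y × v ≡ x)) → ⟦ a ⟧ ≡ ⟦ b ⟧ + ⟦ p ⟧ + ⟦ q ⟧
    entry v a b (yes (refl , refl)) (yes (x≡y , _)) = contradiction x≡y x≢y
    entry v a b (yes (refl , refl)) (no _) = trans (⟦⟧-yes a e)
      (sym (cong (λ z → z + 1ℚ + 0ℚ) (⟦⟧-no b λ h → proj₁ (proj₂ (removeEdge⁻ G h)) (refl , refl))))
    entry v a b (no _) (yes (refl , refl)) = trans (⟦⟧-yes a (flip G e))
      (sym (cong (λ z → z + 0ℚ + 1ℚ) (⟦⟧-no b λ h → proj₂ (proj₂ (removeEdge⁻ G h)) (refl , refl))))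
    entry v a b (no ¬p) (no ¬q) = trans
      (⟦⟧-cong a b (λ h → removeEdge⁺ G h ¬p λ (v≡x , u≡y) → ¬q (u≡y , v≡x)) (λ h → proj₁ (removeEdge⁻ G h)))
      (lemma ⟦ b ⟧)
      where
      lemma : ∀ z → z ≡ z + 0ℚ + 0ℚ
      lemma = solve-∀ ℚ-ring

  -- The degrees in G exceed those in H by 1 at x and at y, and only x lies in the component; hence
  -- the summand 1.
  component-degrees : ¬ Reachable H x y →
    ∑ (λ u → ⟦ reachable? H x u ⟧ * 𝐝 G u) ≡ 2ℚ * ℕ→ℚ (componentEdges H x) + 1ℚ
  component-degrees ¬xy = begin
    ∑ (λ u → χ u * 𝐝 G u)
      ≡⟨ ∑-cong (λ u → trans (cong (χ u *_) (𝐝-removeEdge u)) (lemma (χ u) (𝐝 H u) (𝐞 x u) (𝐞 y u))) ⟩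
    ∑ (λ u → χ u * 𝐝 H u + χ u * 𝐞 x u + χ u * 𝐞 y u)
      ≡⟨ trans (∑-+ _ _) (cong₂ _+_ (trans (∑-+ _ _)
        (cong₂ _+_ (sym (componentEdges-degrees H x)) (·𝐞 x χ))) (·𝐞 y χ)) ⟩
    2ℚ * ℕ→ℚ (componentEdges H x) + χ x + χ y
      ≡⟨ cong₂ (λ a b → 2ℚ * ℕ→ℚ (componentEdges H x) + a + b) (⟦⟧-yes (reachable? H x x) ε)
        (⟦⟧-no (reachable? H x y) ¬xy) ⟩
    2ℚ * ℕ→ℚ (componentEdges H x) + 1ℚ + 0ℚ
      ≡⟨ ℚₚ.+-identityʳ _ ⟩
    2ℚ * ℕ→ℚ (componentEdges H x) + 1ℚ ∎
    where
    χ : Vector n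
    χ u = ⟦ reachable? H x u ⟧
    lemma : ∀ c d e f → c * (d + e + f) ≡ c * d + c * e + c * f
    lemma = solve-∀ ℚ-ring

Adj-≢ : ∀ {n} (H : Graph n) {i j} → Adj H i j → i ≢ j
Adj-≢ H {i} e refl = subst T (adj-irr H i) e

-- Counting the edges that separate two vertices of a tree

module Branches (𝒯 : Graph k) (isTree : IsTree 𝒯) where

  open Tree 𝒯 isTree public

  opaque
    -- Opaque, so that the search behind `reachable?` never unfolds. `β-⟦⟧` is the only access and
    -- replaces that search by any decision of an equivalent proposition.
    β : (a b l : Fin k) → ℚ
    β a b l = ⟦ reachable? (removeEdge 𝒯 a b) b l ⟧

    β-⟦⟧ : ∀ {a b l p} {P : Set p} (P? : Dec P) → (P → Beyond a b l) → (Beyond a b l → P) →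
           ⟦ P? ⟧ ≡ β a b l
    β-⟦⟧ {a} {b} {l} P? = ⟦⟧-cong P? (reachable? (removeEdge 𝒯 a b) b l)

  β-yes : ∀ {a b l} → Beyond a b l → β a b l ≡ 1ℚ
  β-yes p = sym (β-⟦⟧ (yes p) id id)

  β-no : ∀ {a b l} → ¬ Beyond a b l → β a b l ≡ 0ℚ
  β-no ¬p = sym (β-⟦⟧ (no ¬p) id id)

  β-complement : ∀ {a b} → Adj 𝒯 a b → ∀ l → β b a l ≡ 1ℚ - β a b l
  β-complement {a} {b} e l with beyond-either a b l
  ... | inj₁ p = trans (β-no (not-beyond-both e p)) (cong (1ℚ -_) (sym (β-yes p)))
  ... | inj₂ p = trans (β-yes p) (cong (1ℚ -_) (sym (β-no λ q → not-beyond-both e q p)))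

  -- An edge separating l from l′ is counted once, oriented towards l.
  separation : Matrix k
  separation l l′ = ∑ λ a → ∑ λ b → 𝐚 𝒯 a b * (β a b l * β b a l′)

  𝐚-cong : ∀ a b {x y : ℚ} → (Adj 𝒯 a b → x ≡ y) → 𝐚 𝒯 a b * x ≡ 𝐚 𝒯 a b * y
  𝐚-cong a b {x} {y} eq = go (adj? 𝒯 a b)
    where
    go : (d : Dec (Adj 𝒯 a b)) → ⟦ d ⟧ * x ≡ ⟦ d ⟧ * y
    go (yes e) = cong (1ℚ *_) (eq e)
    go (no _)  = trans (ℚₚ.*-zeroˡ x) (sym (ℚₚ.*-zeroˡ y))

  separation-diag : ∀ l → separation l l ≡ 0ℚ
  separation-diag l = ∑-0 _ λ a → ∑-0 _ λ b → trans (𝐚-cong a b (vanish a b)) (ℚₚ.*-zeroʳ (𝐚 𝒯 a b))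
    where
    vanish : ∀ a b → Adj 𝒯 a b → β a b l * β b a l ≡ 0ℚ
    vanish a b e with beyond-either a b l
    ... | inj₁ p = trans (cong (β a b l *_) (β-no (not-beyond-both e p))) (ℚₚ.*-zeroʳ (β a b l))
    ... | inj₂ p = trans (cong (_* β b a l) (β-no λ q → not-beyond-both e q p)) (ℚₚ.*-zeroˡ (β b a l))

  module _ {i j} (e : Adj 𝒯 i j) where

    -- The vertices i and j are on the same side of every edge except i ∼ j itself, whose two
    -- orientations give the two products.
    β-difference : ∀ {a b} → Adj 𝒯 a b → β a b i - β a b j ≡ 𝐞 j a * 𝐞 i b - 𝐞 i a * 𝐞 j b
    β-difference {a} {b} f = trans (go (a ≟ j ×-dec b ≟ i) (a ≟ i ×-dec b ≟ j))
      (cong₂ _-_ (⟦⟧-× (a ≟ j) (b ≟ i)) (⟦⟧-× (a ≟ i) (b ≟ j)))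
      where
      go : (p : Dec (a ≡ j × b ≡ i)) (q : Dec (a ≡ i × b ≡ j)) → β a b i - β a b j ≡ ⟦ p ⟧ - ⟦ q ⟧
      go (yes (refl , refl)) (yes (j≡i , _)) = contradiction (sym j≡i) (Adj-≢ 𝒯 e)
      go (yes (refl , refl)) (no _) = cong₂ _-_ (β-yes ε) (β-no (bridge f))
      go (no _) (yes (refl , refl)) = cong₂ _-_ (β-no (bridge f)) (β-yes ε)
      go (no ¬p) (no ¬q) = begin
        β a b i - β a b j   ≡⟨ cong (_- β a b j) same ⟩
        β a b j - β a b j   ≡⟨ ℚₚ.+-inverseʳ (β a b j) ⟩
        0ℚ                  ∎
        where
        same : β a b i ≡ β a b j
        same = trans (sym (β-⟦⟧ (reachable? (removeEdge 𝒯 a b) b i) id id))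
          (β-⟦⟧ (reachable? (removeEdge 𝒯 a b) b i)
            (beyond-step e (λ (i≡a , j≡b) → ¬q (sym i≡a , sym j≡b)) (λ (j≡a , i≡b) → ¬p (sym j≡a , sym i≡b)))
            (beyond-step (flip 𝒯 e) (λ (j≡a , i≡b) → ¬p (sym j≡a , sym i≡b))
              (λ (i≡a , j≡b) → ¬q (sym i≡a , sym j≡b))))

    -- Only the edge i ∼ j makes a difference: +1 if l lies on the side of j, and -1 if it lies on
    -- the side of i.
    separation-step : ∀ l → separation i l - separation j l ≡ 2ℚ * β i j l - 1ℚ
    separation-step l = begin
      separation i l - separation j l
        ≡⟨ trans (∑-cong λ a → ∑-- _ _) (∑-- _ _) ⟨
      ∑ (λ a → ∑ λ b → 𝐚 𝒯 a b * (β a b i * β b a l) - 𝐚 𝒯 a b * (β a b j * β b a l))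
        ≡⟨ ∑-cong (λ a → ∑-cong (term a)) ⟩
      ∑ (λ a → ∑ λ b → 𝐞 j a * (𝐞 i b * g a b) - 𝐞 i a * (𝐞 j b * g a b))
        ≡⟨ trans (∑-cong λ a → ∑-- _ _) (∑-- _ _) ⟩
      ∑ (λ a → ∑ λ b → 𝐞 j a * (𝐞 i b * g a b)) - ∑ (λ a → ∑ λ b → 𝐞 i a * (𝐞 j b * g a b))
        ≡⟨ cong₂ _-_ (point j i) (point i j) ⟩
      g j i - g i j
        ≡⟨ cong₂ (λ x y → x * β i j l - y * β j i l) (⟦⟧-yes (adj? 𝒯 j i) (flip 𝒯 e)) (⟦⟧-yes (adj? 𝒯 i j) e) ⟩
      1ℚ * β i j l - 1ℚ * β j i l
        ≡⟨ cong (λ x → 1ℚ * β i j l - 1ℚ * x) (β-complement e l) ⟩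
      1ℚ * β i j l - 1ℚ * (1ℚ - β i j l)
        ≡⟨ lemma₂ (β i j l) ⟩
      2ℚ * β i j l - 1ℚ ∎
      where
      g : Matrix k
      g a b = 𝐚 𝒯 a b * β b a l
      lemma₀ : ∀ a p q y → a * (p * y) - a * (q * y) ≡ a * ((p - q) * y)
      lemma₀ = solve-∀ ℚ-ring
      lemma₁ : ∀ a p q r s y → a * ((p * q - r * s) * y) ≡ p * (q * (a * y)) - r * (s * (a * y))
      lemma₁ = solve-∀ ℚ-ring
      lemma₂ : ∀ x → 1ℚ * x - 1ℚ * (1ℚ - x) ≡ 2ℚ * x - 1ℚ
      lemma₂ = solve-∀ ℚ-ring
      term : ∀ a b → 𝐚 𝒯 a b * (β a b i * β b a l) - 𝐚 𝒯 a b * (β a b j * β b a l) ≡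
                     𝐞 j a * (𝐞 i b * g a b) - 𝐞 i a * (𝐞 j b * g a b)
      term a b = begin
        𝐚 𝒯 a b * (β a b i * β b a l) - 𝐚 𝒯 a b * (β a b j * β b a l)
          ≡⟨ lemma₀ (𝐚 𝒯 a b) (β a b i) (β a b j) (β b a l) ⟩
        𝐚 𝒯 a b * ((β a b i - β a b j) * β b a l)
          ≡⟨ 𝐚-cong a b (λ f → cong (_* β b a l) (β-difference f)) ⟩
        𝐚 𝒯 a b * ((𝐞 j a * 𝐞 i b - 𝐞 i a * 𝐞 j b) * β b a l)
          ≡⟨ lemma₁ (𝐚 𝒯 a b) (𝐞 j a) (𝐞 i b) (𝐞 i a) (𝐞 j b) (β b a l) ⟩
        𝐞 j a * (𝐞 i b * g a b) - 𝐞 i a * (𝐞 j b * g a b) ∎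
      point : ∀ p q → ∑ (λ a → ∑ λ b → 𝐞 p a * (𝐞 q b * g a b)) ≡ g p q
      point p q = begin
        ∑ (λ a → ∑ λ b → 𝐞 p a * (𝐞 q b * g a b))  ≡⟨ ∑-cong (λ a → *-∑ (𝐞 p a) _) ⟨
        ∑ (λ a → 𝐞 p a * ∑ λ b → 𝐞 q b * g a b)    ≡⟨ 𝐞· p _ ⟩
        ∑ (λ b → 𝐞 q b * g p b)                    ≡⟨ 𝐞· q (g p) ⟩
        g p q                                      ∎

-- Resistances of a chain

module Chained {𝒯 : Graph k} (isTree : IsTree 𝒯) {n : Fin k → ℕ} {Gs : ∀ i → Graph (n i)}
               {N : ℕ} {G : Graph N} (C : Chain 𝒯 Gs G) where

  open Chain C public
  open Branches 𝒯 isTree public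

  from : Fin N → Σ[ i ∈ Fin k ] Fin (n i)
  from = Inverse.from vertices

  comp : Fin N → Fin k
  comp v = proj₁ (from v)

  from-ι : ∀ i u → from (ι i u) ≡ (i , u)
  from-ι i u = Inverse.strictlyInverseʳ vertices (i , u)

  ι-from : ∀ v → ι (comp v) (proj₂ (from v)) ≡ v
  ι-from v = Inverse.strictlyInverseˡ vertices v

  comp-ι : ∀ i u → comp (ι i u) ≡ i
  comp-ι i u = cong proj₁ (from-ι i u)

  ι-injective : ∀ {i j u v} → ι i u ≡ ι j v → (i , u) ≡ (j , v)
  ι-injective {i} {j} {u} {v} eq = trans (sym (from-ι i u)) (trans (cong from eq) (from-ι j v))

  ι-injectiveʳ : ∀ {i u v} → ι i u ≡ ι i v → u ≡ v
  ι-injectiveʳ eq with ι-injective eq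
  ... | refl = refl

  𝐞-ι : ∀ i w u → 𝐞 (ι i w) (ι i u) ≡ 𝐞 w u
  𝐞-ι i w u = ⟦⟧-cong (ι i u ≟ ι i w) (u ≟ w) ι-injectiveʳ (cong (ι i))

  𝐞-ι-off : ∀ {i l} → l ≢ i → ∀ w u → 𝐞 (ι l w) (ι i u) ≡ 0ℚ
  𝐞-ι-off l≢i w u = 𝐞-off λ eq → l≢i (sym (cong proj₁ (ι-injective eq)))

  -- Expanding f in point masses at the vertices `ι i u` reduces the reindexing to an exchange of
  -- sums.
  ∑-chain : (f : Vector N) → ∑ f ≡ ∑ λ i → ∑ λ u → f (ι i u)
  ∑-chain f = begin
    ∑ f
      ≡⟨ ∑-cong point ⟨
    ∑ (λ v → ∑ λ i → ∑ λ u → 𝐞 (ι i u) v * f v)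
      ≡⟨ ∑-swap (λ v i → ∑ λ u → 𝐞 (ι i u) v * f v) ⟩
    ∑ (λ i → ∑ λ v → ∑ λ u → 𝐞 (ι i u) v * f v)
      ≡⟨ ∑-cong (λ i → ∑-swap λ v u → 𝐞 (ι i u) v * f v) ⟩
    ∑ (λ i → ∑ λ u → ∑ λ v → 𝐞 (ι i u) v * f v)
      ≡⟨ ∑-cong (λ i → ∑-cong λ u → 𝐞· (ι i u) f) ⟩
    ∑ (λ i → ∑ λ u → f (ι i u)) ∎
    where
    vanish : ∀ {i u v} → ι i u ≢ v → 𝐞 (ι i u) v * f v ≡ 0ℚ
    vanish {v = v} ≢v = trans (cong (_* f v) (𝐞-off (≢v ∘ sym))) (ℚₚ.*-zeroˡ (f v))

    point-ι : ∀ l w → ∑ (λ i → ∑ λ u → 𝐞 (ι i u) (ι l w) * f (ι l w)) ≡ f (ι l w)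
    point-ι l w = begin
      ∑ (λ i → ∑ λ u → 𝐞 (ι i u) (ι l w) * f (ι l w))
        ≡⟨ ∑-only _ l (λ i i≢l → ∑-0 _ λ u → vanish λ eq → i≢l (cong proj₁ (ι-injective eq))) ⟩
      ∑ (λ u → 𝐞 (ι l u) (ι l w) * f (ι l w))
        ≡⟨ ∑-only _ w (λ u u≢w → vanish λ eq → u≢w (ι-injectiveʳ eq)) ⟩
      𝐞 (ι l w) (ι l w) * f (ι l w)
        ≡⟨ trans (cong (_* f (ι l w)) (𝐞-diag (ι l w))) (ℚₚ.*-identityˡ (f (ι l w))) ⟩
      f (ι l w) ∎

    point : ∀ v → ∑ (λ i → ∑ λ u → 𝐞 (ι i u) v * f v) ≡ f v
    point v = subst (λ v → ∑ (λ i → ∑ λ u → 𝐞 (ι i u) v * f v) ≡ f v) (ι-from v) (point-ι _ _)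

  other-end : ∀ i j → Adj 𝒯 i j → Fin N
  other-end i j e = ι j (end j i (flip 𝒯 e))

  -- A neighbour is either inside the piece or the far end of a bridge chosen at u; several bridges
  -- may share u. With F constant this gives degrees, with F a difference the Laplacian.
  ∑-neighbours : ∀ i u (F : Vector N) → ∑ (λ v → 𝐚 G (ι i u) v * F v) ≡
    ∑ (λ w → 𝐚 (Gs i) u w * F (ι i w)) + ∑N 𝒯 i (λ j e → 𝐞 (end i j e) u * F (other-end i j e))
  ∑-neighbours i u F = begin
    ∑ (λ v → 𝐚 G (ι i u) v * F v)
      ≡⟨ ∑-chain _ ⟩
    ∑ (λ l → S l)
      ≡⟨ ∑-cong (λ l → split l (l ≟ i)) ⟩
    ∑ (λ l → 𝐞 i l * S i + when (adj? 𝒯 i l) (bridges l))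
      ≡⟨ ∑-+ _ _ ⟩
    ∑ (λ l → 𝐞 i l * S i) + ∑N 𝒯 i bridges
      ≡⟨ cong (_+ ∑N 𝒯 i bridges) (trans (𝐞· i (λ _ → S i)) (∑-cong λ w → cong (_* F (ι i w)) (inner w))) ⟩
    ∑ (λ w → 𝐚 (Gs i) u w * F (ι i w)) + ∑N 𝒯 i bridges ∎
    where
    S : Fin k → ℚ
    S l = ∑ λ w → 𝐚 G (ι i u) (ι l w) * F (ι l w)

    bridges : ∀ j → Adj 𝒯 i j → ℚ
    bridges j e = 𝐞 (end i j e) u * F (other-end i j e)

    inner : ∀ w → 𝐚 G (ι i u) (ι i w) ≡ 𝐚 (Gs i) u w
    inner w = ⟦⟧-cong (adj? G (ι i u) (ι i w)) (adj? (Gs i) u w)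
      (Equivalence.to (within i u w)) (Equivalence.from (within i u w))

    outer : ∀ l → i ≢ l → (d : Dec (Adj 𝒯 i l)) → S l ≡ when d (bridges l)
    outer l i≢l (no ¬e) = ∑-0 _ λ w → trans
      (cong (_* F (ι l w)) (⟦⟧-no (adj? G (ι i u) (ι l w)) λ a → ¬e
        (proj₁ (Equivalence.to (across i l i≢l u w) a))))
      (ℚₚ.*-zeroˡ (F (ι l w)))
    outer l i≢l (yes e) = begin
      S l
        ≡⟨ ∑-cong (λ w → trans (cong (_* F (ι l w)) (entry w))
          (ℚₚ.*-assoc (𝐞 (end i l e) u) (𝐞 y w) (F (ι l w)))) ⟩
      ∑ (λ w → 𝐞 (end i l e) u * (𝐞 y w * F (ι l w)))
        ≡⟨ *-∑ (𝐞 (end i l e) u) _ ⟨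
      𝐞 (end i l e) u * ∑ (λ w → 𝐞 y w * F (ι l w))
        ≡⟨ cong (𝐞 (end i l e) u *_) (𝐞· y _) ⟩
      bridges l e ∎
      where
      y : Fin (n l)
      y = end l i (flip 𝒯 e)
      entry : ∀ w → 𝐚 G (ι i u) (ι l w) ≡ 𝐞 (end i l e) u * 𝐞 y w
      entry w = trans
        (⟦⟧-cong (adj? G (ι i u) (ι l w)) (u ≟ end i l e ×-dec w ≟ y) to
          (λ p → Equivalence.from (across i l i≢l u w) (e , p)))
        (⟦⟧-× (u ≟ end i l e) (w ≟ y))
        where
        to : Adj G (ι i u) (ι l w) → u ≡ end i l e × w ≡ y
        to a with Equivalence.to (across i l i≢l u w) a
        ... | e′ , p with T-irrelevant e′ e
        ... | refl = p

    split : ∀ l → Dec (l ≡ i) → S l ≡ 𝐞 i l * S i + when (adj? 𝒯 i l) (bridges l)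
    split l (yes refl) = begin
      S i                                                 ≡⟨ lemma (S i) ⟩
      1ℚ * S i + 0ℚ
        ≡⟨ cong₂ (λ a b → a * S i + b) (𝐞-diag i) (no-loop (adj? 𝒯 i i)) ⟨
      𝐞 i i * S i + when (adj? 𝒯 i i) (bridges i)         ∎
      where
      lemma : ∀ s → s ≡ 1ℚ * s + 0ℚ
      lemma = solve-∀ ℚ-ring
      no-loop : (d : Dec (Adj 𝒯 i i)) → when d (bridges i) ≡ 0ℚ
      no-loop (yes e) = contradiction refl (Adj-≢ 𝒯 e)
      no-loop (no _)  = refl
    split l (no l≢i) = begin
      S l                                                 ≡⟨ outer l (l≢i ∘ sym) (adj? 𝒯 i l) ⟩
      when (adj? 𝒯 i l) (bridges l)                       ≡⟨ lemma (S i) _ ⟩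
      0ℚ * S i + when (adj? 𝒯 i l) (bridges l)
        ≡⟨ cong (λ a → a * S i + when (adj? 𝒯 i l) (bridges l)) (𝐞-off l≢i) ⟨
      𝐞 i l * S i + when (adj? 𝒯 i l) (bridges l)         ∎
      where
      lemma : ∀ s x → x ≡ 0ℚ * s + x
      lemma = solve-∀ ℚ-ring

  𝐝-chain : ∀ i u → 𝐝 G (ι i u) ≡ 𝐝 (Gs i) u + ∑N 𝒯 i (λ j e → 𝐞 (end i j e) u)
  𝐝-chain i u = begin
    𝐝 G (ι i u)
      ≡⟨ trans (𝐝-sum G (ι i u)) (∑-cong λ v → sym (ℚₚ.*-identityʳ (𝐚 G (ι i u) v))) ⟩
    ∑ (λ v → 𝐚 G (ι i u) v * 1ℚ)
      ≡⟨ ∑-neighbours i u (λ _ → 1ℚ) ⟩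
    ∑ (λ w → 𝐚 (Gs i) u w * 1ℚ) + ∑N 𝒯 i (λ j e → 𝐞 (end i j e) u * 1ℚ)
      ≡⟨ cong₂ _+_ (trans (∑-cong λ w → ℚₚ.*-identityʳ (𝐚 (Gs i) u w)) (sym (𝐝-sum (Gs i) u)))
                   (∑N-cong 𝒯 i λ j e → ℚₚ.*-identityʳ (𝐞 (end i j e) u)) ⟩
    𝐝 (Gs i) u + ∑N 𝒯 i (λ j e → 𝐞 (end i j e) u) ∎

  entry : ∀ i l → Fin (n l) → Dec (l ≡ i) → Fin (n i)
  entry i l w (yes refl) = w
  entry i l w (no l≢i)   = end i _ (proj₁ (proj₂ (toward i l l≢i)))

  -- The vertex of Gs i at which a walk in G from the vertex w of Gs l enters Gs i.
  π : ∀ i l → Fin (n l) → Fin (n i)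
  π i l w = entry i l w (l ≟ i)

  π-self : ∀ i w → π i i w ≡ w
  π-self i w = go (i ≟ i)
    where
    go : (d : Dec (i ≡ i)) → entry i i w d ≡ w
    go (yes refl) = refl
    go (no i≢i)   = contradiction refl i≢i

  π-toward : ∀ {i j l} (e : Adj 𝒯 i j) → Beyond i j l → ∀ w → π i l w ≡ end i j e
  π-toward {i} {j} {l} e b w = go (l ≟ i)
    where
    go : (d : Dec (l ≡ i)) → entry i l w d ≡ end i j e
    go (yes refl) = contradiction b (bridge e)
    go (no l≢i) with toward i l l≢i
    ... | j′ , e′ , b′ with toward-unique e′ e b′ b
    ... | refl = cong (end i j) (T-irrelevant e′ e)

  π-other : ∀ {i l} → l ≢ i → ∀ w w′ → π i l w ≡ π i l w′
  π-other {i} {l} l≢i w w′ with toward i l l≢i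
  ... | j , e , b = trans (π-toward e b w) (sym (π-toward e b w′))

  -- If l is i or j, the end of the bridge in that piece is itself the entry point from across. For
  -- any other l, both i and j lie in the same branch at l.
  π-bridge : ∀ {i j} (e : Adj 𝒯 i j) l → π l i (end i j e) ≡ π l j (end j i (flip 𝒯 e))
  π-bridge {i} {j} e l = go (i ≟ l) (j ≟ l)
    where
    go : Dec (i ≡ l) → Dec (j ≡ l) → π l i (end i j e) ≡ π l j (end j i (flip 𝒯 e))
    go (yes refl) _ = trans (π-self i _) (sym (π-toward e ε _))
    go (no _) (yes refl) = trans (π-toward (flip 𝒯 e) ε _) (sym (π-self j _))
    go (no i≢l) (no j≢l) with toward l i i≢l
    ... | t , e′ , b = trans (π-toward e′ b _)
      (sym (π-toward e′ (beyond-step e (i≢l ∘ proj₁) (j≢l ∘ proj₁) b) _))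

  πᵥ : ∀ i → Fin N → Fin (n i)
  πᵥ i v = π i (comp v) (proj₂ (from v))

  -- Either v lies in the piece or it is beyond exactly one neighbour, whose bridge end is its entry
  -- point. The form is linear in quantities that can be summed over v.
  𝐞-π : ∀ i v a → 𝐞 (πᵥ i v) a ≡
        𝐞 v (ι i a) + ∑N 𝒯 i (λ j e → β i j (comp v) * 𝐞 (end i j e) a)
  𝐞-π i v a = trans (coordinates _ (proj₂ (from v)) (comp v ≟ i))
    (cong (λ x → 𝐞 x (ι i a) + ∑N 𝒯 i (λ j e → β i j (comp v) * 𝐞 (end i j e) a)) (ι-from v))
    where
    zero* : ∀ {x} y → x ≡ 0ℚ → x * y ≡ 0ℚ
    zero* y refl = ℚₚ.*-zeroˡ y

    coordinates : ∀ l w → Dec (l ≡ i) → 𝐞 (π i l w) a ≡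
      𝐞 (ι l w) (ι i a) + ∑N 𝒯 i (λ j e → β i j l * 𝐞 (end i j e) a)
    coordinates l w (yes refl) = begin
      𝐞 (π i i w) a             ≡⟨ cong (λ x → 𝐞 x a) (π-self i w) ⟩
      𝐞 w a                     ≡⟨ 𝐞-ι i w a ⟨
      𝐞 (ι i w) (ι i a)         ≡⟨ ℚₚ.+-identityʳ _ ⟨
      𝐞 (ι i w) (ι i a) + 0ℚ    ≡⟨ cong (𝐞 (ι i w) (ι i a) +_)
        (∑N-0 𝒯 i _ λ j e → zero* (𝐞 (end i j e) a) (β-no (bridge e))) ⟨
      𝐞 (ι i w) (ι i a) + ∑N 𝒯 i (λ j e → β i j i * 𝐞 (end i j e) a) ∎
    coordinates l w (no l≢i) with toward i l l≢i
    ... | j , e , b = begin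
      𝐞 (π i l w) a                     ≡⟨ cong (λ x → 𝐞 x a) (π-toward e b w) ⟩
      𝐞 (end i j e) a                   ≡⟨ lemma (𝐞 (end i j e) a) ⟩
      0ℚ + 1ℚ * 𝐞 (end i j e) a         ≡⟨ cong₂ (λ x y → x + y * 𝐞 (end i j e) a) (𝐞-ι-off l≢i w a) (β-yes b) ⟨
      𝐞 (ι l w) (ι i a) + β i j l * 𝐞 (end i j e) a
        ≡⟨ cong (𝐞 (ι l w) (ι i a) +_) (∑N-only 𝒯 i _ j e λ j′ e′ j′≢j → zero* (𝐞 (end i j′ e′) a)
             (β-no λ b′ → j′≢j (toward-unique e′ e b′ b))) ⟨
      𝐞 (ι l w) (ι i a) + ∑N 𝒯 i (λ j e → β i j l * 𝐞 (end i j e) a) ∎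
      where
      lemma : ∀ x → x ≡ 0ℚ + 1ℚ * x
      lemma = solve-∀ ℚ-ring

  module _ {R : ∀ i → Matrix (n i)} (isR : ∀ i → IsResistance (Gs i) (R i)) where

    open module IsR i = IsResistance (isR i)

    chain-resistance : Matrix N
    chain-resistance v v′ = ∑ (λ i → R i (πᵥ i v) (πᵥ i v′)) + separation (comp v) (comp v′)

    private
      RG = chain-resistance

      RG-ι : ∀ l w v → RG (ι l w) v ≡ ∑ (λ i → R i (π i l w) (πᵥ i v)) + separation l (comp v)
      RG-ι l w v = cong (λ (l , w) → ∑ (λ i → R i (π i l w) (πᵥ i v)) + separation l (comp v)) (from-ι l w)

      RG-difference : ∀ l w l′ w′ v → RG (ι l w) v - RG (ι l′ w′) v ≡
        ∑ (λ i → R i (π i l w) (πᵥ i v) - R i (π i l′ w′) (πᵥ i v)) +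
          (separation l (comp v) - separation l′ (comp v))
      RG-difference l w l′ w′ v = begin
        RG (ι l w) v - RG (ι l′ w′) v
          ≡⟨ cong₂ _-_ (RG-ι l w v) (RG-ι l′ w′ v) ⟩
        (X + separation l (comp v)) - (Y + separation l′ (comp v))
          ≡⟨ lemma X (separation l (comp v)) Y (separation l′ (comp v)) ⟩
        (X - Y) + (separation l (comp v) - separation l′ (comp v))
          ≡⟨ cong (_+ (separation l (comp v) - separation l′ (comp v))) (∑-- _ _) ⟨
        ∑ (λ i → R i (π i l w) (πᵥ i v) - R i (π i l′ w′) (πᵥ i v)) +
          (separation l (comp v) - separation l′ (comp v)) ∎
        where
        X Y : ℚ
        X = ∑ (λ i → R i (π i l w) (πᵥ i v))
        Y = ∑ (λ i → R i (π i l′ w′) (πᵥ i v))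
        lemma : ∀ a b c d → (a + b) - (c + d) ≡ (a - c) + (b - d)
        lemma = solve-∀ ℚ-ring

      RG-within : ∀ i u w v → RG (ι i u) v - RG (ι i w) v ≡ R i u (πᵥ i v) - R i w (πᵥ i v)
      RG-within i u w v = begin
        RG (ι i u) v - RG (ι i w) v
          ≡⟨ RG-difference i u i w v ⟩
        ∑ (λ l → R l (π l i u) (πᵥ l v) - R l (π l i w) (πᵥ l v)) +
          (separation i (comp v) - separation i (comp v))
          ≡⟨ cong₂ _+_ (∑-only _ i λ l l≢i → trans
            (cong (λ x → R l x (πᵥ l v) - R l (π l i w) (πᵥ l v)) (π-other (l≢i ∘ sym) u w))
              (ℚₚ.+-inverseʳ (R l (π l i w) (πᵥ l v))))
               (ℚₚ.+-inverseʳ (separation i (comp v))) ⟩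
        R i (π i i u) (πᵥ i v) - R i (π i i w) (πᵥ i v) + 0ℚ
          ≡⟨ ℚₚ.+-identityʳ _ ⟩
        R i (π i i u) (πᵥ i v) - R i (π i i w) (πᵥ i v)
          ≡⟨ cong₂ (λ x y → R i x (πᵥ i v) - R i y (πᵥ i v)) (π-self i u) (π-self i w) ⟩
        R i u (πᵥ i v) - R i w (πᵥ i v) ∎

      RG-across : ∀ {i j} (e : Adj 𝒯 i j) v →
        RG (ι i (end i j e)) v - RG (other-end i j e) v ≡ 2ℚ * β i j (comp v) - 1ℚ
      RG-across {i} {j} e v = begin
        RG (ι i (end i j e)) v - RG (other-end i j e) v
          ≡⟨ RG-difference i (end i j e) j (end j i (flip 𝒯 e)) v ⟩
        ∑ (λ l → R l (π l i (end i j e)) (πᵥ l v) - R l (π l j (end j i (flip 𝒯 e))) (πᵥ l v)) +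
          (separation i (comp v) - separation j (comp v))
          ≡⟨ cong₂ _+_ (∑-0 _ λ l → trans (cong
            (λ x → R l x (πᵥ l v) - R l (π l j (end j i (flip 𝒯 e))) (πᵥ l v)) (π-bridge e l))
                 (ℚₚ.+-inverseʳ (R l (π l j (end j i (flip 𝒯 e))) (πᵥ l v))))
               (separation-step e (comp v)) ⟩
        0ℚ + (2ℚ * β i j (comp v) - 1ℚ)
          ≡⟨ ℚₚ.+-identityˡ _ ⟩
        2ℚ * β i j (comp v) - 1ℚ ∎

      -- Seen from a piece not containing v, the source -2 sits at the end z of the bridge leading
      -- to v. That bridge adds 2β - 1 = 1 to the Laplacian at z, every other one adds -1 at its
      -- end: the terms 2β cancel the false source, and the -1 at each end is free of v and goes
      -- into τ.
      potential-ι : ∀ v i u → Δ G (λ x → RG x v) (ι i u) ≡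
        (τ i u - ∑N 𝒯 i (λ j e → 𝐞 (end i j e) u)) - 2ℚ * 𝐞 v (ι i u)
      potential-ι v i u = begin
        Δ G (λ x → RG x v) (ι i u)
          ≡⟨ ∑-neighbours i u (λ x → RG (ι i u) v - RG x v) ⟩
        ∑ (λ w → 𝐚 (Gs i) u w * (RG (ι i u) v - RG (ι i w) v))
          + ∑N 𝒯 i (λ j e → 𝐞 (end i j e) u * (RG (ι i u) v - RG (other-end i j e) v))
          ≡⟨ cong₂ _+_ (∑-cong λ w → cong (𝐚 (Gs i) u w *_) (RG-within i u w v))
            (∑N-cong 𝒯 i λ j e → bridge-term j e (u ≟ end i j e)) ⟩
        Δ (Gs i) (λ w → R i w (πᵥ i v)) u + ∑N 𝒯 i
          (λ j e → 2ℚ * (β i j (comp v) * 𝐞 (end i j e) u) - 𝐞 (end i j e) u)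
          ≡⟨ cong₂ _+_ (potential i (πᵥ i v) u)
            (trans (∑N-- 𝒯 i (λ j e → 2ℚ * (β i j (comp v) * 𝐞 (end i j e) u)) (λ j e → 𝐞 (end i j e) u))
              (cong (_- Y) (sym (*-∑N 𝒯 i 2ℚ (λ j e → β i j (comp v) * 𝐞 (end i j e) u))))) ⟩
        (τ i u - 2ℚ * 𝐞 (πᵥ i v) u) + (2ℚ * Z - Y)
          ≡⟨ cong (λ x → (τ i u - 2ℚ * x) + (2ℚ * Z - Y)) (𝐞-π i v u) ⟩
        (τ i u - 2ℚ * (𝐞 v (ι i u) + Z)) + (2ℚ * Z - Y)
          ≡⟨ lemma (τ i u) (𝐞 v (ι i u)) Z Y ⟩
        (τ i u - Y) - 2ℚ * 𝐞 v (ι i u) ∎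
        where
        Y Z : ℚ
        Y = ∑N 𝒯 i (λ j e → 𝐞 (end i j e) u)
        Z = ∑N 𝒯 i (λ j e → β i j (comp v) * 𝐞 (end i j e) u)
        lemma : ∀ t e z y → (t - 2ℚ * (e + z)) + (2ℚ * z - y) ≡ (t - y) - 2ℚ * e
        lemma = solve-∀ ℚ-ring
        lemma₁ : ∀ b → 1ℚ * (2ℚ * b - 1ℚ) ≡ 2ℚ * (b * 1ℚ) - 1ℚ
        lemma₁ = solve-∀ ℚ-ring
        lemma₀ : ∀ x b → 0ℚ * x ≡ 2ℚ * (b * 0ℚ) - 0ℚ
        lemma₀ = solve-∀ ℚ-ring
        bridge-term : ∀ j e (d : Dec (u ≡ end i j e)) →
          ⟦ d ⟧ * (RG (ι i u) v - RG (other-end i j e) v) ≡ 2ℚ * (β i j (comp v) * ⟦ d ⟧) - ⟦ d ⟧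
        bridge-term j e (yes refl) = trans (cong (1ℚ *_) (RG-across e v)) (lemma₁ (β i j (comp v)))
        bridge-term j e (no _)     = lemma₀ (RG (ι i u) v - RG (other-end i j e) v) (β i j (comp v))

    chain-isResistance : IsResistance G chain-resistance
    chain-isResistance = record
      { diag = λ v → trans (cong₂ _+_ (∑-0 _ λ i → diag i (πᵥ i v)) (separation-diag (comp v))) refl
      ; τ = λ x → τG (from x)
      ; potential = λ v x → trans (cong (Δ G (λ x → RG x v)) (sym (ι-from x)))
          (trans (potential-ι v _ (proj₂ (from x))) (cong (λ y → τG (from x) - 2ℚ * 𝐞 v y) (ι-from x)))
      }
      where
      τG : Σ[ i ∈ Fin k ] Fin (n i) → ℚ
      τG (i , u) = τ i u - ∑N 𝒯 i (λ j e → 𝐞 (end i j e) u)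

-- Push-forwards and quadratic forms

∑-pushforward : (p : Fin k → Fin n) (d : Vector k) (F : Vector n) →
  ∑ (λ v → d v * F (p v)) ≡ ∑ λ a → (∑ λ v → d v * 𝐞 (p v) a) * F a
∑-pushforward p d F = begin
  ∑ (λ v → d v * F (p v))
    ≡⟨ ∑-cong (λ v → cong (d v *_) (𝐞· (p v) F)) ⟨
  ∑ (λ v → d v * ∑ λ a → 𝐞 (p v) a * F a)
    ≡⟨ ∑-cong (λ v → trans (*-∑ (d v) _) (∑-cong λ a → sym (ℚₚ.*-assoc (d v) (𝐞 (p v) a) (F a)))) ⟩
  ∑ (λ v → ∑ λ a → d v * 𝐞 (p v) a * F a)
    ≡⟨ ∑-swap (λ v a → d v * 𝐞 (p v) a * F a) ⟩
  ∑ (λ a → ∑ λ v → d v * 𝐞 (p v) a * F a)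
    ≡⟨ ∑-cong (λ a → ∑-* (F a) _) ⟨
  ∑ (λ a → (∑ λ v → d v * 𝐞 (p v) a) * F a) ∎

∑-weighted : (d : Vector n) (c : Matrix k) (f : Fin k → Fin k → Vector n) →
  ∑ (λ v → d v * ∑ λ a → ∑ λ b → c a b * f a b v) ≡ ∑ λ a → ∑ λ b → c a b * ∑ λ v → d v * f a b v
∑-weighted d c f = begin
  ∑ (λ v → d v * ∑ λ a → ∑ λ b → c a b * f a b v)
    ≡⟨ ∑-cong (λ v → trans (*-∑ (d v) _) (∑-cong λ a → trans (*-∑ (d v) _)
      (∑-cong λ b → lemma (d v) (c a b) (f a b v)))) ⟩
  ∑ (λ v → ∑ λ a → ∑ λ b → c a b * (d v * f a b v))
    ≡⟨ ∑-swap (λ v a → ∑ λ b → c a b * (d v * f a b v)) ⟩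
  ∑ (λ a → ∑ λ v → ∑ λ b → c a b * (d v * f a b v))
    ≡⟨ ∑-cong (λ a → ∑-swap λ v b → c a b * (d v * f a b v)) ⟩
  ∑ (λ a → ∑ λ b → ∑ λ v → c a b * (d v * f a b v))
    ≡⟨ ∑-cong (λ a → ∑-cong λ b → *-∑ (c a b) _) ⟨
  ∑ (λ a → ∑ λ b → c a b * ∑ λ v → d v * f a b v) ∎
  where
  lemma : ∀ d c f → d * (c * f) ≡ c * (d * f)
  lemma = solve-∀ ℚ-ring

*-sumEdges : ∀ (H : Graph n) c (f g : ∀ i j → Adj H i j → ℚ) → (∀ i j e → c * f i j e ≡ g i j e) →
             c * sumEdges H f ≡ sumEdges H g
*-sumEdges H c f g cf≡g = begin
  c * sumEdges H f
    ≡⟨ cong (c *_) (trans (sum≡∑ _) (∑-cong λ i → sum≡∑ _)) ⟩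
  c * ∑ (λ i → ∑ λ j → when (i <? j ×-dec adj? H i j) λ (_ , e) → f i j e)
    ≡⟨ trans (*-∑ c _) (∑-cong λ i → trans (*-∑ c _)
      (∑-cong λ j → term (i <? j ×-dec adj? H i j) (λ (_ , e) → cf≡g i j e))) ⟩
  ∑ (λ i → ∑ λ j → when (i <? j ×-dec adj? H i j) λ (_ , e) → g i j e)
    ≡⟨ trans (sum≡∑ _) (∑-cong λ i → sum≡∑ _) ⟨
  sumEdges H g ∎
  where
  term : ∀ {p} {P : Set p} (P? : Dec P) {f g : P → ℚ} → (∀ p → c * f p ≡ g p) → c * when P? f ≡ when P? g
  term (yes p) cf≡g = cf≡g p
  term (no _)  _    = ℚₚ.*-zeroʳ c

module _ (T : Graph k) (i : Fin k) (R : Matrix n) (R-sym : ∀ a b → R a b ≡ R b a) (d : Vector n)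
         (c : ∀ j → Adj T i j → ℚ) (z : ∀ j → Adj T i j → Fin n) where

  private
    M dR Rd : Vector n
    M a  = d a + ∑N T i λ j e → c j e * 𝐞 (z j e) a
    dR x = ∑ λ a → d a * R a x
    Rd x = ∑ λ a → R x a * d a

    Rd≡dR : ∀ x → Rd x ≡ dR x
    Rd≡dR x = ∑-cong λ a → trans (ℚₚ.*-comm (R x a) (d a)) (cong (d a *_) (R-sym x a))

    M· : ∀ F → ∑ (λ a → M a * F a) ≡ ∑ (λ a → d a * F a) + ∑N T i λ j e → c j e * F (z j e)
    M· F = begin
      ∑ (λ a → M a * F a)
        ≡⟨ ∑-cong (λ a → trans (ℚₚ.*-distribʳ-+ (F a) (d a) _)
          (cong (d a * F a +_) (trans (∑N-* T i (F a) _)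
            (∑N-cong T i λ j e → ℚₚ.*-assoc (c j e) (𝐞 (z j e) a) (F a))))) ⟩
      ∑ (λ a → d a * F a + ∑N T i λ j e → c j e * (𝐞 (z j e) a * F a))
        ≡⟨ ∑-+ _ _ ⟩
      ∑ (λ a → d a * F a) + ∑ (λ a → ∑N T i λ j e → c j e * (𝐞 (z j e) a * F a))
        ≡⟨ cong (∑ (λ a → d a * F a) +_) (∑-∑N-swap T i (λ a j e → c j e * (𝐞 (z j e) a * F a))) ⟩
      ∑ (λ a → d a * F a) + ∑N T i (λ j e → ∑ λ a → c j e * (𝐞 (z j e) a * F a))
        ≡⟨ cong (∑ (λ a → d a * F a) +_) (∑N-cong T i λ j e → trans (sym (*-∑ (c j e) _))
          (cong (c j e *_) (𝐞· (z j e) F))) ⟩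
      ∑ (λ a → d a * F a) + ∑N T i (λ j e → c j e * F (z j e)) ∎

    RM : ∀ x → ∑ (λ b → R x b * M b) ≡ Rd x + ∑N T i λ j e → c j e * R x (z j e)
    RM x = begin
      ∑ (λ b → R x b * M b)   ≡⟨ ∑-cong (λ b → ℚₚ.*-comm (R x b) (M b)) ⟩
      ∑ (λ b → M b * R x b)   ≡⟨ M· (R x) ⟩
      ∑ (λ b → d b * R x b) + ∑N T i (λ j e → c j e * R x (z j e))
        ≡⟨ cong (_+ ∑N T i (λ j e → c j e * R x (z j e))) (∑-cong λ b → ℚₚ.*-comm (d b) (R x b)) ⟩
      Rd x + ∑N T i (λ j e → c j e * R x (z j e)) ∎

  -- M is d with point masses c added at the vertices z. Symmetry of R merges the two mixed terms,
  -- which explains the factor 2.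
  quadratic-form : ∑ (λ a → M a * ∑ λ b → R a b * M b) ≡
    ∑ (λ a → d a * ∑ λ b → R a b * d b)
    + ∑N T i (λ j e → 2ℚ * (c j e * ∑ λ a → d a * R a (z j e)))
    + ∑N T i (λ j₁ e₁ → ∑N T i λ j₂ e₂ → c j₁ e₁ * c j₂ e₂ * R (z j₁ e₁) (z j₂ e₂))
  quadratic-form = begin
    ∑ (λ a → M a * ∑ λ b → R a b * M b)
      ≡⟨ M· (λ a → ∑ λ b → R a b * M b) ⟩
    ∑ (λ a → d a * ∑ λ b → R a b * M b) + ∑N T i (λ j e → c j e * ∑ λ b → R (z j e) b * M b)
      ≡⟨ cong₂ _+_ first second ⟩
    (dRd + Y) + (Y + Z)
      ≡⟨ lemma dRd Y Z ⟩
    dRd + 2ℚ * Y + Z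
      ≡⟨ cong (λ y → dRd + y + Z) (*-∑N T i 2ℚ _) ⟩
    dRd + ∑N T i (λ j e → 2ℚ * (c j e * dR (z j e))) + Z ∎
    where
    dRd Y Z : ℚ
    dRd = ∑ (λ a → d a * ∑ λ b → R a b * d b)
    Y = ∑N T i (λ j e → c j e * dR (z j e))
    Z = ∑N T i (λ j₁ e₁ → ∑N T i λ j₂ e₂ → c j₁ e₁ * c j₂ e₂ * R (z j₁ e₁) (z j₂ e₂))
    lemma : ∀ x y z → (x + y) + (y + z) ≡ x + 2ℚ * y + z
    lemma = solve-∀ ℚ-ring
    lemma₁ : ∀ d c r → d * (c * r) ≡ c * (d * r)
    lemma₁ = solve-∀ ℚ-ring
    first : ∑ (λ a → d a * ∑ λ b → R a b * M b) ≡ dRd + Y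
    first = begin
      ∑ (λ a → d a * ∑ λ b → R a b * M b)
        ≡⟨ ∑-cong (λ a → trans (cong (d a *_) (RM a)) (trans (ℚₚ.*-distribˡ-+ (d a) (Rd a) _)
             (cong (d a * Rd a +_) (trans (*-∑N T i (d a) _)
               (∑N-cong T i λ j e → lemma₁ (d a) (c j e) (R a (z j e))))))) ⟩
      ∑ (λ a → d a * Rd a + ∑N T i λ j e → c j e * (d a * R a (z j e)))
        ≡⟨ ∑-+ _ _ ⟩
      dRd + ∑ (λ a → ∑N T i λ j e → c j e * (d a * R a (z j e)))
        ≡⟨ cong (dRd +_) (trans (∑-∑N-swap T i (λ a j e → c j e * (d a * R a (z j e))))
          (∑N-cong T i λ j e → sym (*-∑ (c j e) _))) ⟩
      dRd + Y ∎
    second : ∑N T i (λ j e → c j e * ∑ λ b → R (z j e) b * M b) ≡ Y + Z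
    second = begin
      ∑N T i (λ j e → c j e * ∑ λ b → R (z j e) b * M b)
        ≡⟨ ∑N-cong T i (λ j e → trans (cong (c j e *_)
          (trans (RM (z j e)) (cong (_+ ∑N T i (λ j₂ e₂ → c j₂ e₂ * R (z j e) (z j₂ e₂))) (Rd≡dR (z j e)))))
             (trans (ℚₚ.*-distribˡ-+ (c j e) (dR (z j e)) _) (cong (c j e * dR (z j e) +_)
               (trans (*-∑N T i (c j e) _) (∑N-cong T i λ j₂ e₂ → sym
                 (ℚₚ.*-assoc (c j e) (c j₂ e₂) (R (z j e) (z j₂ e₂)))))))) ⟩
      ∑N T i (λ j e → c j e * dR (z j e) + ∑N T i λ j₂ e₂ → c j e * c j₂ e₂ * R (z j e) (z j₂ e₂))
        ≡⟨ ∑N-+ T i _ _ ⟩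
      Y + Z ∎

-- Degree sums beyond the bridges

module Masses {𝒯 : Graph k} (isTree : IsTree 𝒯) {n : Fin k → ℕ} {Gs : ∀ i → Graph (n i)}
              {N : ℕ} {G : Graph N} (C : Chain 𝒯 Gs G) where

  open Chained isTree C

  private
    d : Vector N
    d = 𝐝 G

  -- For an edge a ∼ b of the tree, the total degree in G of the pieces on the side of b; it will
  -- turn out to be 2 W̄ - 1 for the end in piece a.
  mass : Matrix k
  mass a b = ∑ λ v → d v * β a b (comp v)

  projected : ∀ i → Vector (n i)
  projected i a = ∑ λ v → d v * 𝐞 (πᵥ i v) a

  -- In the coefficient of a bridge end, `mass i j` is what is pushed onto it from beyond the
  -- bridge, and 1 is the share of the bridge in its own degree.
  projected-formula : ∀ i a → projected i a ≡
    𝐝 (Gs i) a + ∑N 𝒯 i (λ j e → (1ℚ + mass i j) * 𝐞 (end i j e) a)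
  projected-formula i a = begin
    ∑ (λ v → d v * 𝐞 (πᵥ i v) a)
      ≡⟨ ∑-cong (λ v → trans (cong (d v *_) (𝐞-π i v a)) (trans (ℚₚ.*-distribˡ-+ (d v) (𝐞 v (ι i a)) _)
           (cong (d v * 𝐞 v (ι i a) +_) (trans (*-∑N 𝒯 i (d v) _)
             (∑N-cong 𝒯 i λ j e → sym (ℚₚ.*-assoc (d v) (β i j (comp v)) (𝐞 (end i j e) a))))))) ⟩
    ∑ (λ v → d v * 𝐞 v (ι i a) + ∑N 𝒯 i λ j e → d v * β i j (comp v) * 𝐞 (end i j e) a)
      ≡⟨ ∑-+ _ _ ⟩
    ∑ (λ v → d v * 𝐞 v (ι i a)) + ∑ (λ v → ∑N 𝒯 i λ j e → d v * β i j (comp v) * 𝐞 (end i j e) a)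
      ≡⟨ cong₂ _+_ (trans (∑-cong λ v → cong (d v *_) (𝐞-sym v (ι i a))) (·𝐞 (ι i a) d))
           (trans (∑-∑N-swap 𝒯 i (λ v j e → d v * β i j (comp v) * 𝐞 (end i j e) a))
             (∑N-cong 𝒯 i λ j e → sym (∑-* (𝐞 (end i j e) a) _))) ⟩
    d (ι i a) + ∑N 𝒯 i (λ j e → mass i j * 𝐞 (end i j e) a)
      ≡⟨ cong (_+ ∑N 𝒯 i (λ j e → mass i j * 𝐞 (end i j e) a)) (𝐝-chain i a) ⟩
    𝐝 (Gs i) a + ∑N 𝒯 i (λ j e → 𝐞 (end i j e) a) + ∑N 𝒯 i (λ j e → mass i j * 𝐞 (end i j e) a)
      ≡⟨ ℚₚ.+-assoc (𝐝 (Gs i) a) _ _ ⟩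
    𝐝 (Gs i) a + (∑N 𝒯 i (λ j e → 𝐞 (end i j e) a) + ∑N 𝒯 i (λ j e → mass i j * 𝐞 (end i j e) a))
      ≡⟨ cong (𝐝 (Gs i) a +_) (trans (sym (∑N-+ 𝒯 i (λ j e → 𝐞 (end i j e) a)
        (λ j e → mass i j * 𝐞 (end i j e) a))) (∑N-cong 𝒯 i λ j e → lemma (mass i j) (𝐞 (end i j e) a))) ⟩
    𝐝 (Gs i) a + ∑N 𝒯 i (λ j e → (1ℚ + mass i j) * 𝐞 (end i j e) a) ∎
    where
    lemma : ∀ c e → e + c * e ≡ (1ℚ + c) * e
    lemma = solve-∀ ℚ-ring

  module _ {R : ∀ i → Matrix (n i)} (isR : ∀ i → IsResistance (Gs i) (R i)) where

    -- The piece terms depend on v and v′ only through entry points, so both degree vectors may be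
    -- pushed forward. An oriented bridge is counted for each pair with v on its head side and v′ on
    -- its tail side, giving a product of two masses.
    chain-form : ∑ (λ v → d v * ∑ λ v′ → chain-resistance isR v v′ * d v′) ≡
      ∑ (λ i → ∑ λ a → projected i a * ∑ λ b → R i a b * projected i b)
      + ∑ (λ a → ∑ λ b → 𝐚 𝒯 a b * (mass a b * mass b a))
    chain-form = begin
      ∑ (λ v → d v * ∑ λ v′ → chain-resistance isR v v′ * d v′)
        ≡⟨ ∑-cong (λ v → trans (cong (d v *_) (column v)) (ℚₚ.*-distribˡ-+ (d v) _ _)) ⟩
      ∑ (λ v → d v * ∑ (λ i → F i (πᵥ i v)) + d v * S (comp v))
        ≡⟨ ∑-+ _ _ ⟩
      ∑ (λ v → d v * ∑ λ i → F i (πᵥ i v)) + ∑ (λ v → d v * S (comp v))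
        ≡⟨ cong₂ _+_ (trans (trans (∑-cong λ v → *-∑ (d v) _) (∑-swap λ v i → d v * F i (πᵥ i v)))
          (∑-cong λ i → ∑-pushforward (πᵥ i) d (F i))) sep ⟩
      ∑ (λ i → ∑ λ a → projected i a * F i a) + ∑ (λ a → ∑ λ b → 𝐚 𝒯 a b * (mass a b * mass b a)) ∎
      where
      F : ∀ i → Vector (n i)
      F i a = ∑ λ b → R i a b * projected i b

      S : Vector k
      S l = ∑ λ a → ∑ λ b → 𝐚 𝒯 a b * (β a b l * mass b a)

      swap : ∀ d b m → d * (b * m) ≡ b * (d * m)
      swap = solve-∀ ℚ-ring

      part : ∀ i x → ∑ (λ v′ → R i x (πᵥ i v′) * d v′) ≡ F i x
      part i x = begin
        ∑ (λ v′ → R i x (πᵥ i v′) * d v′)   ≡⟨ ∑-cong (λ v′ → ℚₚ.*-comm (R i x (πᵥ i v′)) (d v′)) ⟩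
        ∑ (λ v′ → d v′ * R i x (πᵥ i v′))   ≡⟨ ∑-pushforward (πᵥ i) d (R i x) ⟩
        ∑ (λ a → projected i a * R i x a)   ≡⟨ ∑-cong (λ a → ℚₚ.*-comm (projected i a) (R i x a)) ⟩
        F i x                               ∎

      column : ∀ v → ∑ (λ v′ → chain-resistance isR v v′ * d v′) ≡ ∑ (λ i → F i (πᵥ i v)) + S (comp v)
      column v = begin
        ∑ (λ v′ → chain-resistance isR v v′ * d v′)
          ≡⟨ ∑-cong (λ v′ → trans (ℚₚ.*-distribʳ-+ (d v′) (∑ λ i → R i (πᵥ i v) (πᵥ i v′))
            (separation (comp v) (comp v′))) (cong₂ _+_ (∑-* (d v′) (λ i → R i (πᵥ i v) (πᵥ i v′)))
              (ℚₚ.*-comm (separation (comp v) (comp v′)) (d v′)))) ⟩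
        ∑ (λ v′ → ∑ (λ i → R i (πᵥ i v) (πᵥ i v′) * d v′) + d v′ * separation (comp v) (comp v′))
          ≡⟨ ∑-+ _ _ ⟩
        ∑ (λ v′ → ∑ λ i → R i (πᵥ i v) (πᵥ i v′) * d v′) + ∑ (λ v′ → d v′ * separation (comp v) (comp v′))
          ≡⟨ cong₂ _+_ (trans (∑-swap λ v′ i → R i (πᵥ i v) (πᵥ i v′) * d v′) (∑-cong λ i → part i (πᵥ i v)))
               (trans (∑-weighted d (𝐚 𝒯) (λ a b v′ → β a b (comp v) * β b a (comp v′)))
                 (∑-cong λ a → ∑-cong λ b → cong (𝐚 𝒯 a b *_)
                   (trans (∑-cong λ v′ → swap (d v′) (β a b (comp v)) (β b a (comp v′)))
                     (sym (*-∑ (β a b (comp v)) _))))) ⟩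
        ∑ (λ i → F i (πᵥ i v)) + S (comp v) ∎

      sep : ∑ (λ v → d v * S (comp v)) ≡ ∑ (λ a → ∑ λ b → 𝐚 𝒯 a b * (mass a b * mass b a))
      sep = begin
        ∑ (λ v → d v * S (comp v))
          ≡⟨ ∑-weighted d (𝐚 𝒯) (λ a b v → β a b (comp v) * mass b a) ⟩
        ∑ (λ a → ∑ λ b → 𝐚 𝒯 a b * ∑ λ v → d v * (β a b (comp v) * mass b a))
          ≡⟨ ∑-cong (λ a → ∑-cong λ b → cong (𝐚 𝒯 a b *_)
            (trans (∑-cong λ v → sym (ℚₚ.*-assoc (d v) (β a b (comp v)) (mass b a)))
              (sym (∑-* (mass b a) _)))) ⟩
        ∑ (λ a → ∑ λ b → 𝐚 𝒯 a b * (mass a b * mass b a)) ∎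

  mass-total : ∀ {i j} → Adj 𝒯 i j → mass i j + mass j i ≡ vol G
  mass-total {i} {j} e = trans (sym (∑-+ _ _)) (∑-cong λ v →
    trans (cong (λ x → d v * β i j (comp v) + d v * x) (β-complement e (comp v)))
      (lemma (d v) (β i j (comp v))))
    where
    lemma : ∀ d b → d * b + d * (1ℚ - b) ≡ d
    lemma = solve-∀ ℚ-ring

  chain-connected : (∀ i → Connected (Gs i)) → Connected G
  chain-connected conn = record
    { nonempty  = root
    ; reachable = λ u v → Reachable-sym G (from-root u) ◅◅ from-root v
    }
    where
    open IsTree isTree
    i₀ : Fin k
    i₀ = Connected.nonempty connected
    root : Fin N
    root = ι i₀ (Connected.nonempty (conn i₀))

    inside : ∀ l u v → Reachable G (ι l u) (ι l v)
    inside l u v = gmap (ι l) (λ {u} {v} → Equivalence.from (within l u v)) (Connected.reachable (conn l) u v)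

    step : ∀ {a b} → Adj 𝒯 a b → (∀ u → Reachable G root (ι a u)) → ∀ u → Reachable G root (ι b u)
    step {a} {b} e reach u = reach (end a b e) ◅◅
      (Equivalence.from (across a b (Adj-≢ 𝒯 e) _ _) (e , refl , refl) ◅ inside b _ u)

    from-root : ∀ v → Reachable G root v
    from-root v = subst (Reachable G root) (ι-from v)
      (invariant {H = 𝒯} (λ l → ∀ u → Reachable G root (ι l u)) step
        (Connected.reachable connected i₀ (comp v)) (inside i₀ _) (proj₂ (from v)))

  module _ (conn : ∀ i → Connected (Gs i)) {i j} (e : Adj 𝒯 i j) where

    private
      x y : Fin N
      x = ι i (end i j e)
      y = other-end i j e

      H : Graph N
      H = removeEdge G x y

      xy : Adj G x y
      xy = Equivalence.from (across i j (Adj-≢ 𝒯 e) _ _) (e , refl , refl)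

      comp-≡ : ∀ {a b u v} → ι a u ≡ ι b v → a ≡ b
      comp-≡ eq = cong proj₁ (ι-injective eq)

      -- A tree edge determines both ends of its bridge, so a bridge other than x ∼ y comes from a
      -- tree edge other than i ∼ j.
      step⇒ : ∀ a u b v → Adj H (ι a u) (ι b v) → Beyond j i a → Beyond j i b
      step⇒ a u b v h w with a ≟ b | removeEdge⁻ G h
      ... | yes refl | _ = w
      ... | no a≢b | h′ , ¬xy , ¬yx with Equivalence.to (across a b a≢b u v) h′
      ... | e′ , refl , refl = beyond-step e′ ¬p ¬q w
        where
        ¬p : ¬ (a ≡ j × b ≡ i)
        ¬p (refl , refl) = ¬yx
          ( cong (ι i) (cong (end i j) (T-irrelevant _ e))
          , cong (ι j) (cong (end j i) (T-irrelevant e′ _)))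
        ¬q : ¬ (b ≡ j × a ≡ i)
        ¬q (refl , refl) = ¬xy
          ( cong (ι i) (cong (end i j) (T-irrelevant e′ e))
          , cong (ι j) (cong (end j i) (T-irrelevant (flip 𝒯 e′) (flip 𝒯 e))))

      reach⇒ : ∀ {v} → Reachable H x v → Beyond j i (comp v)
      reach⇒ w = invariant {H = H} (λ v → Beyond j i (comp v))
        (λ {u} {v} h → step⇒ (comp u) (proj₂ (from u)) (comp v) (proj₂ (from v))
          (subst₂ (Adj H) (sym (ι-from u)) (sym (ι-from v)) h))
        w (subst (Beyond j i) (sym (comp-ι i _)) ε)

      inside : ∀ l {u v} → Reachable (Gs l) u v → Reachable H (ι l u) (ι l v)
      inside l = gmap (ι l) λ {u} {v} a → removeEdge⁺ G (Equivalence.from (within l u v) a)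
        (λ (p , q) → Adj-≢ 𝒯 e (trans (sym (comp-≡ p)) (comp-≡ q)))
        (λ (p , q) → Adj-≢ 𝒯 e (trans (sym (comp-≡ p)) (comp-≡ q)))

      -- A tree walk avoiding i ∼ j is lifted: connectedness of each piece leads from the arrival
      -- vertex to the end of the next bridge.
      reach⇐ : ∀ {l} → Beyond j i l → ∀ u → Reachable H x (ι l u)
      reach⇐ w = invariant {H = removeEdge 𝒯 j i} (λ l → ∀ u → Reachable H x (ι l u)) step w
        (λ u → inside i (Connected.reachable (conn i) _ u))
        where
        step : ∀ {a b} → Adj (removeEdge 𝒯 j i) a b →
               (∀ u → Reachable H x (ι a u)) → ∀ u → Reachable H x (ι b u)
        step {a} {b} f reach u with removeEdge⁻ 𝒯 f
        ... | f′ , ¬ji , ¬ij = reach (end a b f′) ◅◅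
          (removeEdge⁺ G (Equivalence.from (across a b (Adj-≢ 𝒯 f′) _ _) (f′ , refl , refl))
             (λ (p , q) → ¬ij (comp-≡ q , comp-≡ p)) (λ (p , q) → ¬ji (comp-≡ q , comp-≡ p))
           ◅ inside b (Connected.reachable (conn b) _ u))

    -- The component of x consists of all pieces on the side of i. Its degrees in G count its own
    -- edges twice and the bridge once.
    mass-W : mass j i ≡ 2ℚ * ℕ→ℚ (W i j e) + 1ℚ
    mass-W = begin
      ∑ (λ v → d v * β j i (comp v))
        ≡⟨ ∑-cong (λ v → trans (ℚₚ.*-comm (d v) (β j i (comp v)))
          (cong (_* d v) (sym (β-⟦⟧ (reachable? H x v) reach⇒
             λ b → subst (Reachable H x) (ι-from v) (reach⇐ b (proj₂ (from v))))))) ⟩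
      ∑ (λ v → ⟦ reachable? H x v ⟧ * d v)
        ≡⟨ component-degrees G xy (λ w → bridge (flip 𝒯 e) (subst (Beyond j i) (comp-ι j _) (reach⇒ w))) ⟩
      2ℚ * ℕ→ℚ (W i j e) + 1ℚ ∎

    -- The masses on the two sides add up to 2m, so `mass i j` is 2m - (2W + 1).
    mass-W̄ : 2ℚ * ℤ→ℚ (W̄ i j e) ≡ 1ℚ + mass i j
    mass-W̄ = begin
      2ℚ * ℤ→ℚ (W̄ i j e)
        ≡⟨ cong (2ℚ *_) (ℤ→ℚ-- (ℤ.+ ∣E∣ G) (ℤ.+ W i j e)) ⟩
      2ℚ * (ℕ→ℚ (∣E∣ G) - ℕ→ℚ (W i j e))
        ≡⟨ lemma₁ (ℕ→ℚ (∣E∣ G)) (ℕ→ℚ (W i j e)) ⟩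
      1ℚ + (2ℚ * ℕ→ℚ (∣E∣ G) - (2ℚ * ℕ→ℚ (W i j e) + 1ℚ))
        ≡⟨ cong₂ (λ a b → 1ℚ + (a - b)) (trans (sym (vol≡2∣E∣ G)) (sym (mass-total e))) (sym mass-W) ⟩
      1ℚ + (mass i j + mass j i - mass j i)
        ≡⟨ lemma₂ (mass i j) (mass j i) ⟩
      1ℚ + mass i j ∎
      where
      lemma₁ : ∀ m w → 2ℚ * (m - w) ≡ 1ℚ + (2ℚ * m - (2ℚ * w + 1ℚ))
      lemma₁ = solve-∀ ℚ-ring
      lemma₂ : ∀ a b → 1ℚ + (a + b - b) ≡ 1ℚ + a
      lemma₂ = solve-∀ ℚ-ring

-- Assembling the formula

open import Data.Integer using (+_)

theorem3p9 : ∀ {k : ℕ} (𝒯 : Graph k)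
    {n : Fin k → ℕ} (Gs : ∀ i → Graph (n i))
    {N : ℕ} (G : Graph N) →
    IsTree 𝒯 →
    (∀ i → Connected (Gs i)) →
    (C : Chain 𝒯 Gs G) →
    .{{_ : NonZero (∣E∣ G)}} →
    (κG : ℚ) → IsKemenyConstant G κG →
    (κ : Fin k → ℚ) → (∀ i → IsKemenyConstant (Gs i) (κ i)) →
    (L† : ∀ i → Matrix (n i)) →
    (∀ i → IsMoorePenroseInverse (laplacian (Gs i)) (L† i)) →
    let open Chain C
        m = ∣E∣ G
        R = λ i → resistance (L† i)
    in
    κG ≡
      sum (λ i → (+ ∣E∣ (Gs i) / m) * κ i)
      + sumEdges 𝒯 (λ i j e →
          let e′ = flip 𝒯 e in
          (W̄ i j e / m) * (𝐝 (Gs i) · (R i *ᵥ 𝐞 (end i j e)))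
          + (W̄ j i e′ / m) * (𝐝 (Gs j) · (R j *ᵥ 𝐞 (end j i e′))))
      + sum (λ i → sumNeighbours 𝒯 i λ j₁ e₁ → sumNeighbours 𝒯 i λ j₂ e₂ →
          ((W̄ i j₁ e₁ ℤ.* W̄ i j₂ e₂) / m) * R i (end i j₁ e₁) (end i j₂ e₂))
      + sumEdges 𝒯 (λ i j e →
          let e′ = flip 𝒯 e in
          _/_ ((+ 2 ℤ.* W̄ i j e ℤ.- + 1) ℤ.* (+ 2 ℤ.* W̄ j i e′ ℤ.- + 1))
              (2 ℕ.* m) {{m*n≢0 2 m}})
theorem3p9 {k} 𝒯 {n} Gs {N} G isTree conn C κG kemenyG κ kemeny L† penrose =
  -- The factor 4m clears all denominators and turns κ(G) into the quadratic form of the degrees in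
  -- the chain resistances.
  *-cancelˡ 4μ 4μ≢0 (begin
    4μ * κG
      ≡⟨ trans (cong (_* κG) (l₀ μ)) (trans (ℚₚ.*-assoc 2ℚ (2ℚ * μ) κG)
        (cong (λ x → 2ℚ * (x * κG)) (sym (vol≡2∣E∣ G)))) ⟩
    2ℚ * (vol G * κG)
      ≡⟨ kemeny-resistance G (chain-connected conn) kemenyG (chain-isResistance isR) ⟩
    ∑ (λ v → 𝐝 G v * ∑ λ v′ → chain-resistance isR v v′ * 𝐝 G v′)
      ≡⟨ chain-form isR ⟩
    ∑ (λ i → ∑ λ a → projected i a * ∑ λ b → R i a b * projected i b)
      + ∑ (λ a → ∑ λ b → 𝐚 𝒯 a b * (mass a b * mass b a))
      ≡⟨ cong (_+ ∑ (λ a → ∑ λ b → 𝐚 𝒯 a b * (mass a b * mass b a))) pieces ⟩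
    ∑ A + ∑ B + ∑ Γ + ∑ (λ a → ∑ λ b → 𝐚 𝒯 a b * (mass a b * mass b a))
      ≡⟨ cong₂ _+_ (cong₂ _+_ (cong₂ _+_ A≡ B≡) Γ≡) E≡ ⟨
    _ ≡⟨ l₁ 4μ _ _ _ _ ⟨
    4μ * _ ∎)
  where
  open Chain C using (end; W̄)
  open Chained isTree C using (chain-resistance; chain-isResistance)
  open Masses isTree C

  m : ℕ
  m = ∣E∣ G
  R : ∀ i → Matrix (n i)
  R i = resistance (L† i)
  isR : ∀ i → IsResistance (Gs i) (R i)
  isR i = resistance-isResistance (Gs i) (L† i) (conn i) (penrose i)

  μ 4μ : ℚ
  μ = ℕ→ℚ m
  4μ = 2ℚ * 2ℚ * μ
  4μ≢0 : 4μ ≢ 0ℚ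
  4μ≢0 eq = ℕ→ℚ-≢0 m (*-cancelˡ (2ℚ * 2ℚ) (λ ()) (trans eq (sym (ℚₚ.*-zeroʳ (2ℚ * 2ℚ)))))

  l₀ : ∀ x → 2ℚ * 2ℚ * x ≡ 2ℚ * (2ℚ * x)
  l₀ = solve-∀ ℚ-ring
  l₁ : ∀ c x y z w → c * (x + y + z + w) ≡ c * x + c * y + c * z + c * w
  l₁ = solve-∀ ℚ-ring
  l₂ : ∀ μ q x → 2ℚ * 2ℚ * μ * (q * x) ≡ 2ℚ * (2ℚ * (q * μ) * x)
  l₂ = solve-∀ ℚ-ring
  l₃ : ∀ μ q x → 2ℚ * 2ℚ * μ * (q * x) ≡ 2ℚ * 2ℚ * (q * μ) * x
  l₃ = solve-∀ ℚ-ring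
  l₄ : ∀ w w′ x → 2ℚ * 2ℚ * (w * w′) * x ≡ 2ℚ * w * (2ℚ * w′) * x
  l₄ = solve-∀ ℚ-ring
  l₅ : ∀ μ q → 2ℚ * 2ℚ * μ * q ≡ 2ℚ * (q * (2ℚ * μ))
  l₅ = solve-∀ ℚ-ring
  l₆ : ∀ a b → 2ℚ * (a * b) ≡ a * b + b * a
  l₆ = solve-∀ ℚ-ring
  l₇ : ∀ x → 1ℚ + x ℚ.- 1ℚ ≡ x
  l₇ = solve-∀ ℚ-ring

  dR : ∀ i → Vector (n i)
  dR i x = ∑ λ a → 𝐝 (Gs i) a * R i a x

  A B Γ : Vector k
  A i = ∑ λ a → 𝐝 (Gs i) a * ∑ λ b → R i a b * 𝐝 (Gs i) b
  B i = ∑N 𝒯 i λ j e → 2ℚ * ((1ℚ + mass i j) * dR i (end i j e))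
  Γ i = ∑N 𝒯 i λ j₁ e₁ → ∑N 𝒯 i λ j₂ e₂ →
    (1ℚ + mass i j₁) * (1ℚ + mass i j₂) * R i (end i j₁ e₁) (end i j₂ e₂)

  pieces : ∑ (λ i → ∑ λ a → projected i a * ∑ λ b → R i a b * projected i b) ≡ ∑ A + ∑ B + ∑ Γ
  pieces = trans (∑-cong λ i → trans
      (∑-cong λ a → cong₂ _*_ (projected-formula i a) (∑-cong λ b → cong (R i a b *_) (projected-formula i b)))
      (quadratic-form 𝒯 i (R i) (resistance-sym (Gs i) (L† i)) (𝐝 (Gs i)) (λ j _ → 1ℚ + mass i j) (end i)))
    (trans (∑-+ _ Γ) (cong (_+ ∑ Γ) (∑-+ A B)))

  2W̄ : ∀ {i j} (e : Adj 𝒯 i j) → 2ℚ * ℤ→ℚ (W̄ i j e) ≡ 1ℚ + mass i j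
  2W̄ = mass-W̄ conn

  2W̄-1 : ∀ {i j} (e : Adj 𝒯 i j) → ℤ→ℚ (+ 2 ℤ.* W̄ i j e ℤ.- + 1) ≡ mass i j
  2W̄-1 {i} {j} e = begin
    ℤ→ℚ (+ 2 ℤ.* W̄ i j e ℤ.- + 1)          ≡⟨ ℤ→ℚ-- (+ 2 ℤ.* W̄ i j e) (+ 1) ⟩
    ℤ→ℚ (+ 2 ℤ.* W̄ i j e) ℚ.- 1ℚ           ≡⟨ cong (ℚ._- 1ℚ) (trans (ℤ→ℚ-* (+ 2) (W̄ i j e)) (2W̄ e)) ⟩
    1ℚ + mass i j ℚ.- 1ℚ                   ≡⟨ l₇ (mass i j) ⟩
    mass i j                               ∎

  -- The relation between Kemeny's constant and resistances is used backwards here, for each piece: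
  -- 4 times its number of edges times κ is its own quadratic form.
  A≡ : 4μ * sum (λ i → (+ ∣E∣ (Gs i) / m) * κ i) ≡ ∑ A
  A≡ = trans (cong (4μ *_) (sum≡∑ _)) (trans (*-∑ 4μ _) (∑-cong λ i → begin
    4μ * ((+ ∣E∣ (Gs i) / m) * κ i)        ≡⟨ l₂ μ (+ ∣E∣ (Gs i) / m) (κ i) ⟩
    2ℚ * (2ℚ * ((+ ∣E∣ (Gs i) / m) * μ) * κ i)
      ≡⟨ cong (λ x → 2ℚ * (x * κ i)) (trans (cong (2ℚ *_) (/-* (+ ∣E∣ (Gs i)) m)) (sym (vol≡2∣E∣ (Gs i)))) ⟩
    2ℚ * (vol (Gs i) * κ i)                ≡⟨ kemeny-resistance (Gs i) (conn i) (kemeny i) (isR i) ⟩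
    A i                                    ∎))

  B-term : ∀ i j e → 4μ * ((W̄ i j e / m) * (𝐝 (Gs i) · (R i *ᵥ 𝐞 (end i j e)))) ≡
                     2ℚ * ((1ℚ + mass i j) * dR i (end i j e))
  B-term i j e = begin
    4μ * ((W̄ i j e / m) * (𝐝 (Gs i) · (R i *ᵥ 𝐞 (end i j e))))
      ≡⟨ l₂ μ (W̄ i j e / m) _ ⟩
    2ℚ * (2ℚ * ((W̄ i j e / m) * μ) * (𝐝 (Gs i) · (R i *ᵥ 𝐞 (end i j e))))
      ≡⟨ cong₂ (λ x y → 2ℚ * (x * y)) (trans (cong (2ℚ *_) (/-* (W̄ i j e) m)) (2W̄ e))
           (trans (sum≡∑ _) (∑-cong λ a → cong (𝐝 (Gs i) a *_) (trans (sum≡∑ _) (·𝐞 (end i j e) (R i a))))) ⟩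
    2ℚ * ((1ℚ + mass i j) * dR i (end i j e)) ∎

  B≡ : 4μ * sumEdges 𝒯 (λ i j e →
      (W̄ i j e / m) * (𝐝 (Gs i) · (R i *ᵥ 𝐞 (end i j e)))
      + (W̄ j i (flip 𝒯 e) / m) * (𝐝 (Gs j) · (R j *ᵥ 𝐞 (end j i (flip 𝒯 e))))) ≡ ∑ B
  B≡ = trans (cong (4μ *_) (sumEdges≡∑∑N 𝒯 λ i j e → (W̄ i j e / m) * (𝐝 (Gs i) · (R i *ᵥ 𝐞 (end i j e)))))
    (trans (*-∑ 4μ _) (∑-cong λ i → trans (*-∑N 𝒯 i 4μ _) (∑N-cong 𝒯 i (B-term i))))

  -- The 4 is shared out as one 2 for each W̄, each doubled W̄ being the coefficient of a point mass
  -- in the push-forward.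
  Γ-term : ∀ i j₁ e₁ j₂ e₂ r → 4μ * (((W̄ i j₁ e₁ ℤ.* W̄ i j₂ e₂) / m) * r) ≡
                               (1ℚ + mass i j₁) * (1ℚ + mass i j₂) * r
  Γ-term i j₁ e₁ j₂ e₂ r = begin
    4μ * (((W̄ i j₁ e₁ ℤ.* W̄ i j₂ e₂) / m) * r)
      ≡⟨ l₃ μ ((W̄ i j₁ e₁ ℤ.* W̄ i j₂ e₂) / m) r ⟩
    2ℚ * 2ℚ * (((W̄ i j₁ e₁ ℤ.* W̄ i j₂ e₂) / m) * μ) * r
      ≡⟨ cong (λ x → 2ℚ * 2ℚ * x * r) (trans (/-* (W̄ i j₁ e₁ ℤ.* W̄ i j₂ e₂) m)
        (ℤ→ℚ-* (W̄ i j₁ e₁) (W̄ i j₂ e₂))) ⟩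
    2ℚ * 2ℚ * (ℤ→ℚ (W̄ i j₁ e₁) * ℤ→ℚ (W̄ i j₂ e₂)) * r
      ≡⟨ l₄ (ℤ→ℚ (W̄ i j₁ e₁)) (ℤ→ℚ (W̄ i j₂ e₂)) r ⟩
    2ℚ * ℤ→ℚ (W̄ i j₁ e₁) * (2ℚ * ℤ→ℚ (W̄ i j₂ e₂)) * r
      ≡⟨ cong₂ (λ x y → x * y * r) (2W̄ e₁) (2W̄ e₂) ⟩
    (1ℚ + mass i j₁) * (1ℚ + mass i j₂) * r ∎

  Γ≡ : 4μ * sum (λ i → sumNeighbours 𝒯 i λ j₁ e₁ → sumNeighbours 𝒯 i λ j₂ e₂ →
         ((W̄ i j₁ e₁ ℤ.* W̄ i j₂ e₂) / m) * R i (end i j₁ e₁) (end i j₂ e₂)) ≡ ∑ Γ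
  Γ≡ = trans (cong (4μ *_) (sum≡∑ _)) (trans (*-∑ 4μ _) (∑-cong λ i →
    trans (cong (4μ *_) (sumNeighbours≡∑N 𝒯 i _)) (trans (*-∑N 𝒯 i 4μ _) (∑N-cong 𝒯 i λ j₁ e₁ →
    trans (cong (4μ *_) (sumNeighbours≡∑N 𝒯 i _)) (trans (*-∑N 𝒯 i 4μ _) (∑N-cong 𝒯 i λ j₂ e₂ →
    Γ-term i j₁ e₁ j₂ e₂ (R i (end i j₁ e₁) (end i j₂ e₂))))))))

  -- Of 4m only 2 survives the denominator 2m: one product of masses for each orientation of the
  -- bridge, as in the quadratic form.
  E-term : ∀ i j e → 4μ * (_/_ ((+ 2 ℤ.* W̄ i j e ℤ.- + 1) ℤ.* (+ 2 ℤ.* W̄ j i (flip 𝒯 e) ℤ.- + 1))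
    (2 ℕ.* m) {{m*n≢0 2 m}})
                     ≡ mass i j * mass j i + mass j i * mass i j
  E-term i j e = begin
    4μ * q                          ≡⟨ l₅ μ q ⟩
    2ℚ * (q * (2ℚ * μ))             ≡⟨ cong (λ x → 2ℚ * (q * x)) (ℕ→ℚ-* 2 m) ⟨
    2ℚ * (q * ℕ→ℚ (2 ℕ.* m))        ≡⟨ cong (2ℚ *_) (/-* (P ℤ.* Q) (2 ℕ.* m) {{m*n≢0 2 m}}) ⟩
    2ℚ * ℤ→ℚ (P ℤ.* Q)              ≡⟨ cong (2ℚ *_)
      (trans (ℤ→ℚ-* P Q) (cong₂ _*_ (2W̄-1 e) (2W̄-1 (flip 𝒯 e)))) ⟩
    2ℚ * (mass i j * mass j i)      ≡⟨ l₆ (mass i j) (mass j i) ⟩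
    mass i j * mass j i + mass j i * mass i j ∎
    where
    P Q : ℤ.ℤ
    P = + 2 ℤ.* W̄ i j e ℤ.- + 1
    Q = + 2 ℤ.* W̄ j i (flip 𝒯 e) ℤ.- + 1
    q : ℚ
    q = _/_ (P ℤ.* Q) (2 ℕ.* m) {{m*n≢0 2 m}}

  E≡ : 4μ * sumEdges 𝒯 (λ i j e →
      _/_ ((+ 2 ℤ.* W̄ i j e ℤ.- + 1) ℤ.* (+ 2 ℤ.* W̄ j i (flip 𝒯 e) ℤ.- + 1)) (2 ℕ.* m) {{m*n≢0 2 m}})
    ≡ ∑ (λ a → ∑ λ b → 𝐚 𝒯 a b * (mass a b * mass b a))
  E≡ = trans (*-sumEdges 𝒯 4μ _ (λ i j e → mass i j * mass j i + mass j i * mass i j) E-term)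
    (trans (sumEdges≡∑∑N 𝒯 λ i j _ → mass i j * mass j i)
      (∑-cong λ a → ∑-cong λ b → when-⟦⟧ (adj? 𝒯 a b) _ (mass a b * mass b a) λ _ → refl))
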